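{- There is a constant $k$ and a family $\{F_n\}_{n=1}^{\infty}$ of unsatisfiable $k$-CNF formulas of size $\Theta(n)$ such that: (1) the minimal clause space of refuting $F_n$ in resolution is $\mathit{Sp}(F_n\vdash 0)=\Theta(\sqrt[3]{n})$; (2) any resolution refutation $\pi$ of $F_n$ in minimal clause space (i.e. with $\mathit{Sp}(\pi)=\mathit{Sp}(F_n\vdash 0)$) must have length $L(\pi)=\exp\bigl(\Omega(\sqrt[3]{n})\bigr)$; (3) there are resolution refutations $\pi'$ of $F_n$ in asymptotically minimal clause space $\mathit{Sp}(\pi')=O\bigl(\mathit{Sp}(F_n\vdash 0)\bigr)$ and (simultaneously) length $L(\pi')=O(n)$, i.e. linear in the formula size.
   Context: A literal is a propositional variable $x$ or its negation $\overline{x}$. A clause is a finite set (disjunction) of literals over pairwise distinct variables; $0$ denotes the empty clause. A CNF formula is a finite set of clauses; it is a $k$-CNF formula if every clause has at most $k$ literals. The size of a CNF formula is the total number of literals in it, counted with repetitions. The resolution rule derives $B\vee C$ from $B\vee x$ and $C\vee\overline{x}$. A resolution derivation from a CNF formula $F$ is a sequence $\{\mathbb{C}_0,\dots,\mathbb{C}_\tau\}$ of sets of clauses with $\mathbb{C}_0=\emptyset$ such that each $\mathbb{C}_t$ is obtained from $\mathbb{C}_{t-1}$ by one of: axiom download (adding some $C\in F$), erasure (removing some clause of $\mathbb{C}_{t-1}$), inference (adding a clause derived by the resolution rule from two clauses in $\mathbb{C}_{t-1}$). A refutation of $F$ is a derivation with $\mathbb{C}_\tau=\{0\}$. The length $L(\pi)$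 of a derivation $\pi$ is the number of distinct clauses in it, and its clause space is $\mathit{Sp}(\pi)=\max_t|\mathbb{C}_t|$. $\mathit{Sp}(F\vdash 0)$ is the minimum clause space over all refutations of $F$. -}

module Defs where

open import Data.Bool using (Bool; true; false)
import Data.Bool.Properties as Bool
open import Data.Fin using (Fin)
open import Data.List using (List; []; _∷_; [_]; length; map; concatMap; deduplicate)
open import Data.List.Extrema.Nat using (max)
open import Data.List.Membership.Propositional using (_∈_; _─_)
open import Data.List.Relation.Binary.BagAndSetEquality using (_∼[_]_; set)
open import Data.List.Relation.Unary.All using (All; [])
open import Data.List.Relation.Unary.AllPairs using ([]; _∷_)
open import Data.List.Relation.Unary.Unique.Propositional using (Unique)
open import Data.Maybe using (Maybe; just; nothing; is-just)
import Data.Maybe.Properties as Maybe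
open import Data.Nat using (ℕ; _+_; _*_; _≤_; NonZero)
open import Data.Nat.ListAction using (sum)
open import Data.Product using (_×_; _,_; ∃-syntax; Σ-syntax)
open import Data.Sum using (_⊎_)
open import Data.Vec using (Vec; lookup; replicate; countᵇ; _[_]≔_)
import Data.Vec.Properties as Vec
open import Function.Bundles using (_⇔_)
open import Relation.Binary.Construct.Closure.ReflexiveTransitive using (Star; ε; _◅_)
open import Relation.Binary.Definitions using (DecidableEquality)
open import Relation.Binary.PropositionalEquality using (_≡_)
open import Relation.Nullary using (¬_)

-- (x , true) is the variable x and (x , false) its negation.
Literal : ℕ → Set
Literal v = Fin v × Bool

-- A finite set of literals over pairwise distinct variables is a partial
-- map from variables to signs: entry x is `just b` if the literal (x , b)
-- occurs, and `nothing` if the variable x does not occur.  In this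
-- representation equality of clauses is _≡_, and no clause contains both
-- a variable and its negation.
Clause : ℕ → Set
Clause v = Vec (Maybe Bool) v

_∈ᶜ_ : ∀ {v} → Literal v → Clause v → Set
(x , b) ∈ᶜ C = lookup C x ≡ just b

_≟ᶜ_ : ∀ {v} → DecidableEquality (Clause v)
_≟ᶜ_ = Vec.≡-dec (Maybe.≡-dec Bool._≟_)

emptyClause : ∀ {v} → Clause v
emptyClause = replicate _ nothing

unitClause : ∀ {v} → Literal v → Clause v
unitClause (x , b) = emptyClause [ x ]≔ just b

width : ∀ {v} → Clause v → ℕ
width = countᵇ is-just

-- Disjunction is a relation, since B ∨ C is a clause only when B and C
-- contain no complementary literals.
_≐_∨_ : ∀ {v} → Clause v → Clause v → Clause v → Set
D ≐ B ∨ C = ∀ l → (l ∈ᶜ D) ⇔ ((l ∈ᶜ B) ⊎ (l ∈ᶜ C))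

_∉vars_ : ∀ {v} → Fin v → Clause v → Set
x ∉vars C = lookup C x ≡ nothing

-- Derive B ∨ C from P = B ∨ x and N = C ∨ x̄; as the literals of a clause
-- are over distinct variables, x occurs in neither B nor C.
data Resolves {v} (P N D : Clause v) : Set where
  resolve : ∀ (x : Fin v) (B C : Clause v) →
            x ∉vars B → x ∉vars C →
            P ≐ B ∨ unitClause (x , true) →
            N ≐ C ∨ unitClause (x , false) →
            D ≐ B ∨ C →
            Resolves P N D

-- A finite set is a duplicate-free list; the order of the list carries no
-- meaning, and sets are compared by _∼[ set ]_ below.
record ClauseSet (v : ℕ) : Set where
  constructor mkClauseSet
  field
    elems  : List (Clause v)
    unique : Unique elems

open ClauseSet public

∣_∣ˢ : ∀ {v} → ClauseSet v → ℕ
∣ ℂ ∣ˢ = length (elems ℂ)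

∅ : ∀ {v} → ClauseSet v
∅ = mkClauseSet [] []

｛0｝ : ∀ {v} → ClauseSet v
｛0｝ = mkClauseSet [ emptyClause ] ([] ∷ [])

record CNF : Set where
  field
    vars    : ℕ
    clauses : ClauseSet vars

open CNF public

size : CNF → ℕ
size F = sum (map width (elems (clauses F)))

Is_-CNF : ℕ → CNF → Set
Is k -CNF F = All (λ C → width C ≤ k) (elems (clauses F))

Satisfies : ∀ {v} → (Fin v → Bool) → Clause v → Set
Satisfies {v} α C = ∃[ x ] ((x , α x) ∈ᶜ C)

Unsatisfiable : CNF → Set
Unsatisfiable F =
  ∀ (α : Fin (vars F) → Bool) → ¬ All (Satisfies α) (elems (clauses F))

data Step (F : CNF) (ℂ ℂ′ : ClauseSet (vars F)) : Set where
  download : ∀ {C} → C ∈ elems (clauses F) →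
             elems ℂ′ ∼[ set ] (C ∷ elems ℂ) → Step F ℂ ℂ′
  erase    : ∀ {C} (C∈ℂ : C ∈ elems ℂ) →
             elems ℂ′ ∼[ set ] (elems ℂ ─ C∈ℂ) → Step F ℂ ℂ′
  infer    : ∀ {P N D} → P ∈ elems ℂ → N ∈ elems ℂ → Resolves P N D →
             elems ℂ′ ∼[ set ] (D ∷ elems ℂ) → Step F ℂ ℂ′

Derivation : (F : CNF) → ClauseSet (vars F) → Set
Derivation F = Star (Step F) ∅

Refutation : CNF → Set
Refutation F = Derivation F ｛0｝

configurations : ∀ {F ℂ ℂ′} → Star (Step F) ℂ ℂ′ → List (ClauseSet (vars F))
configurations {ℂ = ℂ} ε        = [ ℂ ]
configurations {ℂ = ℂ} (_ ◅ π) = ℂ ∷ configurations π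

Len : ∀ {F} → Refutation F → ℕ
Len π = length (deduplicate _≟ᶜ_ (concatMap elems (configurations π)))

Sp : ∀ {F} → Refutation F → ℕ
Sp π = max 0 (map ∣_∣ˢ (configurations π))

-- IsMinSpace F s says that Sp(F ⊢ 0) = s.
IsMinSpace : CNF → ℕ → Set
IsMinSpace F s =
  (Σ[ π ∈ Refutation F ] Sp π ≡ s) × (∀ (π : Refutation F) → s ≤ Sp π)

-- Families indexed by n = 1, 2, 3, …
Family : Set → Set
Family A = (n : ℕ) .⦃ _ : NonZero n ⦄ → A

infix 4 _=O_ _=Θ_

_=O_ : Family ℕ → Family ℕ → Set
f =O g = ∃[ c ] ∃[ N ] ∀ n .⦃ _ : NonZero n ⦄ → N ≤ n → f n ≤ c * g n

_=Θ_ : Family ℕ → Family ℕ → Set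
f =Θ g = (f =O g) × (g =O f)

{-# OPTIONS --safe #-}
-- F is a conjunction, in disjoint variables, of an ordering principle G (no finite order is without a
-- minimum) with Θ(∛n) elements and of a smaller ordering principle H in which each variable is replaced
-- by the exclusive or of two variables.  As the parts share no variables, a refutation of F refutes one of them.
--
-- The part H has a decision tree of depth O(∛n), hence a refutation in space O(∛n), and G is chosen large
-- enough to require strictly more space than that: an adversary keeps all clauses of G in memory satisfied
-- by remembering one variable per clause and by moving an untouched element to the bottom of a preorder.
-- So a refutation in minimal space refutes H.  If it were short, fixing one half of each variable of H
-- at random would kill all wide clauses, while the same adversary shows that the original ordering
-- principle needs wide clauses.  On the other hand, eliminating the elements of G one at a time
-- refutes G in length O(n) and space O(∛n).
--
-- The minimal space is found constructively by a search in the finite graph of configurations.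
module Submission where

open import Defs
open import Data.Bool using (Bool; true; false; not; _xor_; _∨_; if_then_else_)
import Data.Bool.Properties as Bool
open import Data.Empty using (⊥; ⊥-elim)
open import Data.Fin using (Fin; zero; suc; inject₁; fromℕ; toℕ)
open import Data.Fin.Induction using (<-weakInduction; >-weakInduction)
import Data.Fin.Properties as Fin
open import Data.List using (List; []; _∷_; _++_; [_]; length; map; filter; foldr; concatMap; deduplicate; allFin; cartesianProduct)
import Data.List as List
open import Data.List.Extrema.Nat using (max≤v⁺; xs≤max)
open import Data.List.Membership.Propositional using (_∈_; _∉_; _─_; find; lose)
open import Data.List.Membership.Propositional.Properties
open import Data.List.Properties using (length-++; ++-assoc; length-map; length-filter; length-tabulate; map-id)
open import Data.List.Relation.Binary.BagAndSetEquality using (_∼[_]_; set)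
open import Data.List.Relation.Binary.Pointwise as Pointwise using (Pointwise; []; _∷_)
open import Data.List.Relation.Binary.Subset.Propositional using (_⊆_)
import Data.List.Relation.Binary.Subset.Propositional.Properties as ⊆
open import Data.List.Relation.Unary.All as All using (All; []; _∷_; all?)
import Data.List.Relation.Unary.All.Properties as All
open import Data.List.Relation.Unary.AllPairs using ([]; _∷_)
open import Data.List.Relation.Unary.Any using (here; there; any?)
open import Data.List.Relation.Unary.Unique.DecPropositional.Properties using (deduplicate-!)
open import Data.List.Relation.Unary.Unique.Propositional using (Unique)
open import Data.List.Relation.Unary.Unique.Propositional.Properties using (Unique[x∷xs]⇒x∉xs; allFin⁺)
import Data.List.Relation.Unary.Unique.Propositional.Properties as Unique
open import Data.Maybe using (Maybe; just; nothing; _<∣>_)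
import Data.Maybe.Properties as Maybe
open import Data.Nat using (ℕ; zero; suc; _+_; _*_; _∸_; _^_; _≤_; _<_; _≤?_; _<?_; z≤n; s≤s; NonZero; ≢-nonZero; ≢-nonZero⁻¹)
open import Data.Nat.ListAction using (sum)
open import Data.Nat.Properties hiding (_≟_)
open import Data.Nat.Solver using (module +-*-Solver)
open import Data.Product using (_×_; _,_; proj₁; proj₂; ∃-syntax; Σ-syntax; map₁)
open import Data.Product.Function.NonDependent.Propositional using (_×-↔_)
open import Data.Product.Properties using (≡-dec)
open import Data.Sum as Sum using (_⊎_; inj₁; inj₂; [_,_]′)
open import Data.Sum.Function.Propositional using (_⊎-↔_)
open import Data.Sum.Properties using (inj₁-injective; inj₂-injective)
open import Data.Unit using (⊤; tt)
open import Data.Vec using ([]; _∷_; lookup; tabulate; _[_]≔_)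
import Data.Vec.Properties as Vec
open import Function using (_∘_; id)
open import Function.Bundles using (_⇔_; _↔_; mk⇔; Inverse; Equivalence)
open import Function.Construct.Identity using (↔-id)
open import Function.Properties.Inverse using (↔-sym; ↔-trans)
open import Relation.Binary.Construct.Closure.ReflexiveTransitive using (Star; ε; _◅_; _◅◅_)
open import Relation.Binary.Definitions using (DecidableEquality)
open import Relation.Binary.PropositionalEquality hiding ([_])
open import Relation.Nullary using (¬_; Dec; yes; no; does; contradiction)
open import Relation.Nullary.Decidable using (¬?; map′; ⌊_⌋; dec-true; dec-false; _×-dec_; _⊎-dec_; _→-dec_)

-- The cube root stems from transitivity, whose clauses are cubic in number: with Θ(∛n) elements
-- both parts have O(n) clauses, and n padding clauses push the size up to n. Both the decision tree
-- depth of H and the space needed by G are linear in the number of elements, so G has to exceed H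
-- by a constant factor only. The substitution is what relates width to length. The ordering
-- principle itself has short refutations although it needs wide clauses; after the substitution,
-- fixing one half of each variable leaves the same principle behind, up to renaming and signs,
-- while satisfying every wide clause of a short refutation. The obstacle is that a refutation in
-- minimal space may work on G too. Space belongs to the whole memory and width to single clauses,
-- so two defences run side by side: all G-clauses in memory are satisfied by one evolving
-- assignment, whereas each H-clause carries a statement about all safe assignments. Resolution
-- steps never mix them, because the pivot belongs to one part only.

-- Sums and cardinalities of duplicate-free lists.

module _ {A : Set} where

  ∈-─⁺ : ∀ {x y : A} {xs} (p : x ∈ xs) → y ∈ xs → y ≢ x → y ∈ xs ─ p
  ∈-─⁺ (here refl) (here refl) y≢x = contradiction refl y≢x
  ∈-─⁺ (here refl) (there q)   y≢x = q
  ∈-─⁺ (there p)   (here refl) y≢x = here refl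
  ∈-─⁺ (there p)   (there q)   y≢x = there (∈-─⁺ p q y≢x)

  ∈-─⁻ : ∀ {x y : A} {xs} (p : x ∈ xs) → y ∈ xs ─ p → y ∈ xs
  ∈-─⁻ (here refl) q           = there q
  ∈-─⁻ (there p)   (here refl) = here refl
  ∈-─⁻ (there p)   (there q)   = there (∈-─⁻ p q)

  ∉-─ : ∀ {x : A} {xs} → Unique xs → (p : x ∈ xs) → x ∉ xs ─ p
  ∉-─ uxs (here refl) q = Unique[x∷xs]⇒x∉xs uxs q
  ∉-─ uxs (there p) (here refl) = Unique[x∷xs]⇒x∉xs uxs p
  ∉-─ (_ ∷ uxs) (there p) (there q) = ∉-─ uxs p q

  sum-─ : ∀ (f : A → ℕ) {x xs} (p : x ∈ xs) → sum (map f xs) ≡ f x + sum (map f (xs ─ p))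
  sum-─ f (here refl) = refl
  sum-─ f {x} {y ∷ xs} (there p) = begin
    f y + sum (map f xs)                    ≡⟨ cong (f y +_) (sum-─ f p) ⟩
    f y + (f x + sum (map f (xs ─ p)))      ≡⟨ sym (+-assoc (f y) (f x) _) ⟩
    f y + f x + sum (map f (xs ─ p))        ≡⟨ cong (_+ sum (map f (xs ─ p))) (+-comm (f y) (f x)) ⟩
    f x + f y + sum (map f (xs ─ p))        ≡⟨ +-assoc (f x) (f y) _ ⟩
    f x + (f y + sum (map f (xs ─ p)))      ∎
    where open ≡-Reasoning

  sum-⊆ : ∀ (f : A → ℕ) {xs ys} → Unique xs → xs ⊆ ys → sum (map f xs) ≤ sum (map f ys)
  sum-⊆ f {[]} _ _ = z≤n
  sum-⊆ f {x ∷ xs} {ys} uxs@(_ ∷ u) xs⊆ys = begin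
    f x + sum (map f xs)          ≤⟨ +-monoʳ-≤ (f x) (sum-⊆ f u sub) ⟩
    f x + sum (map f (ys ─ p))    ≡⟨ sym (sum-─ f p) ⟩
    sum (map f ys)                ∎
    where
    open ≤-Reasoning
    p : x ∈ ys
    p = xs⊆ys (here refl)
    sub : xs ⊆ ys ─ p
    sub q = ∈-─⁺ p (xs⊆ys (there q)) (λ { refl → Unique[x∷xs]⇒x∉xs uxs q })

  sum-const : ∀ {f : A → ℕ} {c} xs → All (λ x → f x ≡ c) xs → sum (map f xs) ≡ length xs * c
  sum-const [] [] = refl
  sum-const (x ∷ xs) (e ∷ es) = cong₂ _+_ e (sum-const xs es)

  sum-≤ : ∀ {f : A → ℕ} {c} xs → All (λ x → f x ≤ c) xs → sum (map f xs) ≤ length xs * c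
  sum-≤ [] [] = z≤n
  sum-≤ (x ∷ xs) (e ∷ es) = +-mono-≤ e (sum-≤ xs es)

  length-⊆ : ∀ {xs ys : List A} → Unique xs → xs ⊆ ys → length xs ≤ length ys
  length-⊆ {xs} {ys} u sub = subst₂ _≤_ (card xs) (card ys) (sum-⊆ (λ _ → 1) u sub)
    where
    card : ∀ zs → sum (map (λ _ → 1) zs) ≡ length zs
    card zs = trans (sum-const zs (All.tabulate (λ _ → refl))) (*-identityʳ _)

-- Formulas over arbitrary variable types and their encoding as CNFs.

Lit : Set → Set
Lit V = V × Bool

neg : ∀ {V} → Lit V → Lit V
neg (u , b) = u , not b

-- CNF formulas over an arbitrary set of variables; repetitions and tautological
-- clauses are allowed here and removed by `cnf`.
Formula : Set → Set
Formula V = List (List (Lit V))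

Pos Neg : ∀ {V : Set} → V → Lit V
Pos u = u , true
Neg u = u , false

Consistent : ∀ {V : Set} → (Lit V → Set) → Set
Consistent Q = ∀ u → Q (Pos u) → Q (Neg u) → ⊥

module Encoding {V : Set} {v : ℕ} (iso : V ↔ Fin v) where

  enc : V → Fin v
  enc = Inverse.to iso

  dec : Fin v → V
  dec = Inverse.from iso

  enc-dec : ∀ x → enc (dec x) ≡ x
  enc-dec x = Inverse.inverseˡ iso refl

  dec-enc : ∀ u → dec (enc u) ≡ u
  dec-enc u = Inverse.inverseʳ iso refl

  enc-injective : ∀ {u w} → enc u ≡ enc w → u ≡ w
  enc-injective {u} {w} e = trans (sym (dec-enc u)) (trans (cong dec e) (dec-enc w))

  _≟ⱽ_ : DecidableEquality V
  u ≟ⱽ w = map′ enc-injective (cong enc) (enc u Fin.≟ enc w)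

  _≟ˡ_ : DecidableEquality (Lit V)
  _≟ˡ_ = ≡-dec _≟ⱽ_ Bool._≟_

  open import Data.List.Membership.DecPropositional _≟ˡ_ using (_∉?_)

  infix 4 _has_ _⊑_
  _has_ : Clause v → Lit V → Set
  C has (u , b) = lookup C (enc u) ≡ just b

  _⊑_ : Clause v → (Lit V → Set) → Set
  C ⊑ Q = ∀ {l} → C has l → Q l

  from-lookup : ∀ C {x b} → lookup C x ≡ just b → C has (dec x , b)
  from-lookup C {x} p = trans (cong (lookup C) (enc-dec x)) p

  lookup-ext : ∀ {C D : Clause v} → (∀ u → lookup C (enc u) ≡ lookup D (enc u)) → C ≡ D
  lookup-ext {C} {D} h = begin
    C                      ≡⟨ sym (Vec.tabulate∘lookup C) ⟩
    tabulate (lookup C)    ≡⟨ Vec.tabulate-cong (λ x → subst (λ y → lookup C y ≡ lookup D y) (enc-dec x) (h (dec x))) ⟩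
    tabulate (lookup D)    ≡⟨ Vec.tabulate∘lookup D ⟩
    D                      ∎
    where open ≡-Reasoning

  empty-⊑ : ∀ {Q} → emptyClause ⊑ Q
  empty-⊑ {_} {u , b} p with trans (sym (Vec.lookup-replicate (enc u) nothing)) p
  ... | ()

  ⊑⊥⇒empty : ∀ {C} → C ⊑ (λ _ → ⊥) → C ≡ emptyClause
  ⊑⊥⇒empty {C} h = lookup-ext λ u → trans (none u) (sym (Vec.lookup-replicate (enc u) nothing))
    where
    none : ∀ u → lookup C (enc u) ≡ nothing
    none u with lookup C (enc u) in e
    ... | nothing = refl
    ... | just b  = ⊥-elim (h {u , b} e)

  clause : List (Lit V) → Clause v
  clause = foldr (λ { (u , b) D → D [ enc u ]≔ just b }) emptyClause

  clause-⊑ : ∀ ls → clause ls ⊑ (_∈ ls)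
  clause-⊑ [] {l} p = empty-⊑ {_∈ []} {l} p
  clause-⊑ ((u , b) ∷ ls) {w , c} p with w ≟ⱽ u
  ... | yes refl with trans (sym p) (Vec.lookup∘updateAt (enc u) (clause ls))
  ...   | refl = here refl
  clause-⊑ ((u , b) ∷ ls) {w , c} p | no w≢u =
    there (clause-⊑ ls (trans (sym (Vec.lookup∘updateAt′ (enc w) (enc u) (w≢u ∘ enc-injective) (clause ls))) p))

  clause-has : ∀ ls → Consistent (_∈ ls) → ∀ {l} → l ∈ ls → clause ls has l
  clause-has ((u , b) ∷ ls) con {w , c} p with w ≟ⱽ u
  clause-has ((u , b) ∷ ls) con {w , c} p | yes refl =
    trans (Vec.lookup∘updateAt (enc u) (clause ls)) (cong just (agree b c (here refl) p))
    where
    agree : ∀ b′ c → (u , b′) ∈ (u , b) ∷ ls → (u , c) ∈ (u , b) ∷ ls → b′ ≡ c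
    agree true  true  _ _ = refl
    agree false false _ _ = refl
    agree true  false p q = ⊥-elim (con u p q)
    agree false true  p q = ⊥-elim (con u q p)
  clause-has ((u , b) ∷ ls) con {w , c} (here refl) | no w≢u = contradiction refl w≢u
  clause-has ((u , b) ∷ ls) con {w , c} (there p)   | no w≢u =
    trans (Vec.lookup∘updateAt′ (enc w) (enc u) (w≢u ∘ enc-injective) (clause ls))
          (clause-has ls (λ x p q → con x (there p) (there q)) p)

  width-clause : ∀ ls → width (clause ls) ≤ length ls
  width-clause [] = ≤-reflexive (width-empty v)
    where
    width-empty : ∀ n → width (emptyClause {n}) ≡ 0
    width-empty zero    = refl
    width-empty (suc n) = width-empty n
  width-clause ((u , b) ∷ ls) = ≤-trans (width-update (clause ls) (enc u)) (s≤s (width-clause ls))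
    where
    width-update : ∀ {n} (C : Clause n) x → width (C [ x ]≔ just b) ≤ suc (width C)
    width-update (nothing ∷ C) zero    = ≤-refl
    width-update (just _ ∷ C)  zero    = n≤1+n _
    width-update (nothing ∷ C) (suc x) = width-update C x
    width-update (just _ ∷ C)  (suc x) = s≤s (width-update C x)

  consistent? : ∀ ls → Dec (Consistent (_∈ ls))
  consistent? ls = map′ to from (all? (λ l → neg l ∉? ls) ls)
    where
    to : All (λ l → neg l ∉ ls) ls → Consistent (_∈ ls)
    to a u p q = All.lookup a p q
    from : Consistent (_∈ ls) → All (λ l → neg l ∉ ls) ls
    from con = All.tabulate λ { {u , true} p q → con u p q ; {u , false} p q → con u q p }

  cnf : Formula V → CNF
  cnf φ = record
    { vars    = v
    ; clauses = mkClauseSet (deduplicate _≟ᶜ_ (map clause (filter consistent? φ))) (deduplicate-! _≟ᶜ_ _)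
    }

  axiom⁺ : ∀ {φ ls} → ls ∈ φ → Consistent (_∈ ls) → clause ls ∈ elems (clauses (cnf φ))
  axiom⁺ p con = ∈-deduplicate⁺ _≟ᶜ_ (∈-map⁺ clause (∈-filter⁺ consistent? p con))

  axiom⁻ : ∀ φ {C} → C ∈ elems (clauses (cnf φ)) → ∃[ ls ] ls ∈ φ × Consistent (_∈ ls) × C ≡ clause ls
  axiom⁻ φ p with ∈-map⁻ clause (∈-deduplicate⁻ _≟ᶜ_ (map clause (filter consistent? φ)) p)
  ... | ls , q , refl with ∈-filter⁻ consistent? {xs = φ} q
  ...   | r , con = ls , r , con , refl

  cnf-width : ∀ φ k → All (λ ls → length ls ≤ k) φ → Is k -CNF (cnf φ)
  cnf-width φ k h = All.tabulate λ p → bound (axiom⁻ φ p)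
    where
    bound : ∀ {C} → ∃[ ls ] ls ∈ φ × Consistent (_∈ ls) × C ≡ clause ls → width C ≤ k
    bound (ls , q , _ , refl) = ≤-trans (width-clause ls) (All.lookup h q)

  size-≤ : ∀ φ k → All (λ ls → length ls ≤ k) φ → size (cnf φ) ≤ length φ * k
  size-≤ φ k h = begin
    size (cnf φ)                                 ≤⟨ sum-≤ (elems (clauses (cnf φ))) (cnf-width φ k h) ⟩
    length (elems (clauses (cnf φ))) * k         ≤⟨ *-monoˡ-≤ k len ⟩
    length φ * k                                 ∎
    where
    open ≤-Reasoning
    len : length (elems (clauses (cnf φ))) ≤ length φ
    len = begin
      length (elems (clauses (cnf φ)))
        ≤⟨ length-⊆ (unique (clauses (cnf φ))) (∈-deduplicate⁻ _≟ᶜ_ (map clause (filter consistent? φ))) ⟩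
      length (map clause (filter consistent? φ)) ≡⟨ length-map clause (filter consistent? φ) ⟩
      length (filter consistent? φ)              ≤⟨ length-filter consistent? φ ⟩
      length φ                                   ∎

  resolves : ∀ {P N D : Clause v} u → P has Pos u → N has Neg u →
             lookup D (enc u) ≡ nothing →
             (∀ {w b} → w ≢ u → P has (w , b) → D has (w , b)) →
             (∀ {w b} → w ≢ u → N has (w , b) → D has (w , b)) →
             (∀ {l} → D has l → P has l ⊎ N has l) →
             Resolves P N D
  resolves {P} {N} {D} u Pu Nu Du P⇒D N⇒D D⇒ =
    resolve x (P [ x ]≔ nothing) (N [ x ]≔ nothing)
      (Vec.lookup∘updateAt x P) (Vec.lookup∘updateAt x N)
      (split P Pu) (split N Nu) (λ l → mk⇔ (to l) (from l))
    where
    x : Fin v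
    x = enc u
    unit-has : ∀ b → lookup (unitClause {v} (x , b)) x ≡ just b
    unit-has b = Vec.lookup∘updateAt x emptyClause
    other : ∀ (C : Clause v) {y c} → y ≢ x → lookup (C [ x ]≔ c) y ≡ lookup C y
    other C {y} y≢x = Vec.lookup∘updateAt′ y x y≢x C
    split : ∀ C {b} → lookup C x ≡ just b → C ≐ (C [ x ]≔ nothing) ∨ unitClause (x , b)
    split C {b} Cu (y , c) = mk⇔ f g
      where
      f : lookup C y ≡ just c →
          (lookup (C [ x ]≔ nothing) y ≡ just c) ⊎ (lookup (unitClause (x , b)) y ≡ just c)
      f p with y Fin.≟ x
      ... | yes refl = inj₂ (trans (unit-has b) (trans (sym Cu) p))
      ... | no y≢x   = inj₁ (trans (other C y≢x) p)
      g : (lookup (C [ x ]≔ nothing) y ≡ just c) ⊎ (lookup (unitClause (x , b)) y ≡ just c) →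
          lookup C y ≡ just c
      g p with y Fin.≟ x
      g (inj₁ p) | yes refl = contradiction (trans (sym p) (Vec.lookup∘updateAt x C)) λ ()
      g (inj₂ p) | yes refl = trans Cu (trans (sym (unit-has b)) p)
      g (inj₁ p) | no y≢x   = trans (sym (other C y≢x)) p
      g (inj₂ p) | no y≢x   =
        contradiction (trans (sym (Vec.lookup-replicate y nothing)) (trans (sym (other emptyClause y≢x)) p)) λ ()
    to : ∀ l → l ∈ᶜ D → (l ∈ᶜ (P [ x ]≔ nothing)) ⊎ (l ∈ᶜ (N [ x ]≔ nothing))
    to (y , c) p with y Fin.≟ x
    ... | yes refl = contradiction (trans (sym p) Du) λ ()
    ... | no y≢x with D⇒ (from-lookup D p)
    ...   | inj₁ q = inj₁ (trans (other P y≢x) (subst (λ z → lookup P z ≡ just c) (enc-dec y) q))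
    ...   | inj₂ q = inj₂ (trans (other N y≢x) (subst (λ z → lookup N z ≡ just c) (enc-dec y) q))
    from : ∀ l → (l ∈ᶜ (P [ x ]≔ nothing)) ⊎ (l ∈ᶜ (N [ x ]≔ nothing)) → l ∈ᶜ D
    from (y , c) p with y Fin.≟ x
    from (y , c) (inj₁ p) | yes refl = contradiction (trans (sym p) (Vec.lookup∘updateAt x P)) λ ()
    from (y , c) (inj₂ p) | yes refl = contradiction (trans (sym p) (Vec.lookup∘updateAt x N)) λ ()
    from (y , c) (inj₁ p) | no y≢x =
      subst (λ z → lookup D z ≡ just c) (enc-dec y)
        (P⇒D (λ e → y≢x (trans (sym (enc-dec y)) (cong enc e))) (from-lookup P (trans (sym (other P y≢x)) p)))
    from (y , c) (inj₂ p) | no y≢x =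
      subst (λ z → lookup D z ≡ just c) (enc-dec y)
        (N⇒D (λ e → y≢x (trans (sym (enc-dec y)) (cong enc e))) (from-lookup N (trans (sym (other N y≢x)) p)))

  -- What the adversaries use of a resolution step: literals off the pivot survive, and none is new.
  -- The side clauses have disappeared.
  record Cuts (P N D : Clause v) : Set where
    field
      pivot   : V
      P-pivot : P has Pos pivot
      N-pivot : N has Neg pivot
      P-rest  : ∀ {l} → P has l → l ≢ Pos pivot → D has l
      N-rest  : ∀ {l} → N has l → l ≢ Neg pivot → D has l
      D-from  : ∀ {l} → D has l → P has l ⊎ N has l

  cuts : ∀ {P N D} → Resolves P N D → Cuts P N D
  cuts {P} {N} {D} (resolve x B C x∉B x∉C P≐ N≐ D≐) = record
    { pivot   = dec x
    ; P-pivot = from-lookup P (Equivalence.from (P≐ (x , true)) (inj₂ (Vec.lookup∘updateAt x emptyClause)))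
    ; N-pivot = from-lookup N (Equivalence.from (N≐ (x , false)) (inj₂ (Vec.lookup∘updateAt x emptyClause)))
    ; P-rest  = λ {l} p l≢ → [ (λ q → Equivalence.from (D≐ _) (inj₁ q)) , (λ q → contradiction (unit q) l≢) ]′
                               (Equivalence.to (P≐ _) p)
    ; N-rest  = λ {l} p l≢ → [ (λ q → Equivalence.from (D≐ _) (inj₂ q)) , (λ q → contradiction (unit q) l≢) ]′
                               (Equivalence.to (N≐ _) p)
    ; D-from  = λ p → [ (λ q → inj₁ (Equivalence.from (P≐ _) (inj₁ q)))
                      , (λ q → inj₂ (Equivalence.from (N≐ _) (inj₁ q))) ]′ (Equivalence.to (D≐ _) p)
    }
    where
    unit : ∀ {l b} → unitClause (x , b) has l → l ≡ (dec x , b)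
    unit {w , c} {b} p with enc w Fin.≟ x
    ... | yes refl with trans (sym p) (Vec.lookup∘updateAt x emptyClause)
    ...   | refl = cong (_, b) (sym (dec-enc w))
    unit {w , c} {b} p | no w≢ = contradiction
      (trans (sym (Vec.lookup-replicate (enc w) nothing)) (trans (sym (Vec.lookup∘updateAt′ (enc w) x w≢ emptyClause)) p)) λ ()

-- Derivations with bounded space and a bounded supply of clauses.

infix 4 _≃_
_≃_ : ∀ {A : Set} → List A → List A → Set
xs ≃ ys = (xs ⊆ ys) × (ys ⊆ xs)

≃-refl : ∀ {A : Set} {xs : List A} → xs ≃ xs
≃-refl = id , id

≃-sym : ∀ {A : Set} {xs ys : List A} → xs ≃ ys → ys ≃ xs
≃-sym (p , q) = q , p

≃-trans : ∀ {A : Set} {xs ys zs : List A} → xs ≃ ys → ys ≃ zs → xs ≃ zs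
≃-trans (p , q) (p′ , q′) = p′ ∘ p , q ∘ q′

≃-∷ : ∀ {A : Set} {x : A} {xs ys} → xs ≃ ys → x ∷ xs ≃ x ∷ ys
≃-∷ {x = x} (p , q) = ⊆.∷⁺ʳ x p , ⊆.∷⁺ʳ x q

≃⇒set : ∀ {A : Set} {xs ys : List A} → xs ≃ ys → xs ∼[ set ] ys
≃⇒set (p , q) = mk⇔ p q

set⇒≃ : ∀ {A : Set} {xs ys : List A} → xs ∼[ set ] ys → xs ≃ ys
set⇒≃ e = (λ p → Equivalence.to e p) , (λ p → Equivalence.from e p)

toSet : ∀ {v} → List (Clause v) → ClauseSet v
toSet A = mkClauseSet (deduplicate _≟ᶜ_ A) (deduplicate-! _≟ᶜ_ A)

toSet-≃ : ∀ {v} (A : List (Clause v)) → elems (toSet A) ≃ A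
toSet-≃ A = ∈-deduplicate⁻ _≟ᶜ_ A , ∈-deduplicate⁺ _≟ᶜ_

∣∣-≤ : ∀ {v} (a : ClauseSet v) {A} → elems a ⊆ A → ∣ a ∣ˢ ≤ length A
∣∣-≤ a sub = length-⊆ (unique a) sub

without : ∀ {v} → Clause v → List (Clause v) → List (Clause v)
without C = filter (λ D → ¬? (D ≟ᶜ C))

∈-without⁻ : ∀ {v} {C D : Clause v} {A} → D ∈ without C A → D ∈ A × D ≢ C
∈-without⁻ {C = C} {A = A} = ∈-filter⁻ (λ D → ¬? (D ≟ᶜ C)) {xs = A}

∈-without⁺ : ∀ {v} {C D : Clause v} {A} → D ∈ A → D ≢ C → D ∈ without C A
∈-without⁺ {C = C} = ∈-filter⁺ (λ D → ¬? (D ≟ᶜ C))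

─-≃ : ∀ {v} {C : Clause v} {A} → Unique A → (p : C ∈ A) → A ─ p ≃ without C A
─-≃ {A = A} u p = (λ q → ∈-without⁺ (∈-─⁻ p q) λ { refl → ∉-─ u p q })
                , (λ q → let m , ≢C = ∈-without⁻ {A = A} q in ∈-─⁺ p m ≢C)

module Derive (F : CNF) where

  private
    v : ℕ
    v = vars F
    open import Data.List.Membership.DecPropositional (_≟ᶜ_ {v}) using (_∈?_)

  Configs : (ClauseSet v → Set) → ∀ {a b} → Star (Step F) a b → Set
  Configs P π = All P (configurations π)

  configs-source : ∀ {P a b} (π : Star (Step F) a b) → Configs P π → P a
  configs-source ε       (p ∷ _) = p
  configs-source (_ ◅ _) (p ∷ _) = p

  configs-target : ∀ {P a b} (π : Star (Step F) a b) → Configs P π → P b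
  configs-target ε       (p ∷ _)  = p
  configs-target (_ ◅ π) (_ ∷ ps) = configs-target π ps

  configs-◅◅ : ∀ {P a b c} (π : Star (Step F) a b) (π′ : Star (Step F) b c) →
               Configs P π → Configs P π′ → Configs P (π ◅◅ π′)
  configs-◅◅ ε       π′ _        qs = qs
  configs-◅◅ (_ ◅ π) π′ (p ∷ ps) qs = p ∷ configs-◅◅ π π′ ps qs

  step-target : ∀ {a b c} → Step F a b → elems c ≃ elems b → Step F a c
  step-target (download p e)  c≃b = download p (≃⇒set (≃-trans c≃b (set⇒≃ e)))
  step-target (erase p e)     c≃b = erase p (≃⇒set (≃-trans c≃b (set⇒≃ e)))
  step-target (infer p q r e) c≃b = infer p q r (≃⇒set (≃-trans c≃b (set⇒≃ e)))

  -- A run ends in a list that represents the right set, whereas a refutation has to end in the very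
  -- list `｛0｝`. The last step can be redirected, as it determines its target only as a set; a run
  -- without steps cannot, hence the first alternative.
  star-target : ∀ {P} → (∀ {b c} → elems c ≃ elems b → P b → P c) →
                ∀ {a b c} → elems c ≃ elems b → (π : Star (Step F) a b) → Configs P π →
                (elems c ≃ elems a) ⊎ (Σ[ π′ ∈ Star (Step F) a c ] Configs P π′)
  star-target resp c≃b ε _ = inj₁ c≃b
  star-target resp c≃b (st ◅ π) (p ∷ ps) with star-target resp c≃b π ps
  ... | inj₁ c≃a′      = inj₂ (step-target st c≃a′ ◅ ε , p ∷ resp c≃a′ (configs-source π ps) ∷ [])
  ... | inj₂ (π′ , qs) = inj₂ (st ◅ π′ , p ∷ qs)

  -- `Z` is a common list for all clauses that ever occur, so that its length bounds the length of
  -- the derivation.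
  record Within (s : ℕ) (Z : List (Clause v)) (c : ClauseSet v) : Set where
    constructor within
    field
      space   : ∣ c ∣ˢ ≤ s
      content : elems c ⊆ Z

  within-⊆ : ∀ {s s′ Z Z′ c} → s ≤ s′ → Z ⊆ Z′ → Within s Z c → Within s′ Z′ c
  within-⊆ s≤ Z⊆ (within p q) = within (≤-trans p s≤) λ m → Z⊆ (q m)

  -- From memory content A one reaches B in space s, with at most ℓ clauses added.
  infix 4 _⇝[_,_]_
  record _⇝[_,_]_ (A : List (Clause v)) (s ℓ : ℕ) (B : List (Clause v)) : Set where
    constructor mk⇝
    field
      added : List (Clause v)
      cost  : length added ≤ ℓ
      run   : ∀ a → elems a ≃ A →
              Σ[ b ∈ ClauseSet v ] (elems b ≃ B) ×
              (Σ[ π ∈ Star (Step F) a b ] Configs (Within s (A ++ added)) π)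

  ⇝-resp : ∀ {A B s} → length A ≤ s → A ≃ B → A ⇝[ s , 0 ] B
  ⇝-resp {A} le A≃B = mk⇝ [] z≤n λ a a≃A →
    a , ≃-trans a≃A A≃B , ε ,
    within (≤-trans (∣∣-≤ a (proj₁ a≃A)) le) (λ m → ∈-++⁺ˡ (proj₁ a≃A m)) ∷ []

  ⇝-weaken : ∀ {A B s s′ ℓ ℓ′} → s ≤ s′ → ℓ ≤ ℓ′ → A ⇝[ s , ℓ ] B → A ⇝[ s′ , ℓ′ ] B
  ⇝-weaken s≤ ℓ≤ (mk⇝ Z c r) = mk⇝ Z (≤-trans c ℓ≤) λ a a≃A →
    let b , b≃B , π , ps = r a a≃A in b , b≃B , π , All.map (within-⊆ s≤ id) ps

  ⇝-cost-≤ : ∀ {A B s ℓ ℓ′} → ℓ ≤ ℓ′ → A ⇝[ s , ℓ ] B → A ⇝[ s , ℓ′ ] B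
  ⇝-cost-≤ = ⇝-weaken ≤-refl

  ⇝-cost : ∀ {A B s ℓ ℓ′} → ℓ ≡ ℓ′ → A ⇝[ s , ℓ ] B → A ⇝[ s , ℓ′ ] B
  ⇝-cost refl r = r

  ⇝-trans : ∀ {A B C s ℓ ℓ′} → A ⇝[ s , ℓ ] B → B ⇝[ s , ℓ′ ] C → A ⇝[ s , ℓ + ℓ′ ] C
  ⇝-trans {A} {B} {C} {s} (mk⇝ Z c r) (mk⇝ Z′ c′ r′) =
    mk⇝ (Z ++ Z′) (subst (_≤ _) (sym (length-++ Z)) (+-mono-≤ c c′)) run
    where
    run : ∀ a → elems a ≃ A →
          Σ[ b ∈ ClauseSet v ] (elems b ≃ C) ×
          (Σ[ π ∈ Star (Step F) a b ] Configs (Within s (A ++ (Z ++ Z′))) π)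
    run a a≃A with r a a≃A
    ... | b , b≃B , π , ps with r′ b b≃B
    ...   | d , d≃C , π′ , qs = d , d≃C , π ◅◅ π′ , configs-◅◅ π π′ (All.map (within-⊆ ≤-refl left) ps) (All.map (within-⊆ ≤-refl right) qs)
      where
      assoc : (A ++ Z) ++ Z′ ⊆ A ++ (Z ++ Z′)
      assoc p = subst (_ ∈_) (++-assoc A Z Z′) p
      B⊆ : B ⊆ A ++ Z
      B⊆ p = Within.content (configs-target π ps) (proj₂ b≃B p)
      left : A ++ Z ⊆ A ++ (Z ++ Z′)
      left m = assoc (∈-++⁺ˡ m)
      right : B ++ Z′ ⊆ A ++ (Z ++ Z′)
      right m = assoc ([ (λ x → ∈-++⁺ˡ (B⊆ x)) , ∈-++⁺ʳ (A ++ Z) ]′ (∈-++⁻ B m))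

  private
    add : ∀ {A s D} → length A < s →
          (∀ {a b} → elems a ≃ A → elems b ≃ D ∷ elems a → Step F a b) →
          A ⇝[ s , 1 ] D ∷ A
    add {A} {s} {D} A<s step = mk⇝ [ D ] ≤-refl λ a a≃A →
      let b = toSet (D ∷ elems a)
          b≃a = toSet-≃ (D ∷ elems a)
          b≃ = ≃-trans b≃a (≃-∷ a≃A)
          b⊆ : elems b ⊆ A ++ [ D ]
          b⊆ = comm ∘ proj₁ b≃
      in b , b≃ , step a≃A b≃a ◅ ε
           , within (≤-trans (∣∣-≤ a (proj₁ a≃A)) (<⇒≤ A<s)) (λ m → ∈-++⁺ˡ (proj₁ a≃A m))
           ∷ within (≤-trans (∣∣-≤ b (proj₁ b≃)) A<s) b⊆ ∷ []
      where
      comm : D ∷ A ⊆ A ++ [ D ]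
      comm (here e)  = ∈-++⁺ʳ A (here e)
      comm (there p) = ∈-++⁺ˡ p

  ⇝-download : ∀ {A s C} → length A < s → C ∈ elems (clauses F) → A ⇝[ s , 1 ] C ∷ A
  ⇝-download A<s C∈F = add A<s λ _ b≃ → download C∈F (≃⇒set b≃)

  ⇝-infer : ∀ {A s P N D} → length A < s → P ∈ A → N ∈ A → Resolves P N D → A ⇝[ s , 1 ] D ∷ A
  ⇝-infer A<s p q r = add A<s λ a≃A b≃ → infer (proj₂ a≃A p) (proj₂ a≃A q) r (≃⇒set b≃)

  private
    remove : ∀ {C} (a : ClauseSet v) → C ∈ elems a →
             Σ[ b ∈ ClauseSet v ] Step F a b × (elems b ⊆ elems a) ×
               (C ∉ elems b) × (∀ {D} → D ∈ elems a → D ≢ C → D ∈ elems b)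
    remove {C} a p =
      mkClauseSet (without C (elems a)) (Unique.filter⁺ (λ D → ¬? (D ≟ᶜ C)) (unique a)) ,
      erase p (≃⇒set (≃-sym (─-≃ (unique a) p))) ,
      (proj₁ ∘ ∈-without⁻) , (λ m → proj₂ (∈-without⁻ {A = elems a} m) refl) , ∈-without⁺

    -- Every configuration on the way is a subset of the first one, so `P` is assumed for all of
    -- these. `E` lists the clauses still to be examined and makes the recursion structural.
    erases : ∀ {B P} E (a : ClauseSet v) → (∀ c → elems c ⊆ elems a → P c) →
             B ⊆ elems a → (∀ {D} → D ∈ elems a → D ∈ B ⊎ D ∈ E) →
             Σ[ b ∈ ClauseSet v ] (elems b ≃ B) × (Σ[ π ∈ Star (Step F) a b ] Configs P π)
    erases [] a P⊆ B⊆a cov = a , ((λ m → [ id , (λ ()) ]′ (cov m)) , B⊆a) , ε , P⊆ a id ∷ []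
    erases {B} (C ∷ E) a P⊆ B⊆a cov with C ∈? B | C ∈? elems a
    ... | yes C∈B | _ = erases E a P⊆ B⊆a λ m → cov′ (cov m)
      where
      cov′ : ∀ {D} → D ∈ B ⊎ D ∈ C ∷ E → D ∈ B ⊎ D ∈ E
      cov′ (inj₁ p)           = inj₁ p
      cov′ (inj₂ (here refl)) = inj₁ C∈B
      cov′ (inj₂ (there p))   = inj₂ p
    ... | no _ | no C∉a = erases E a P⊆ B⊆a λ m → cov′ m (cov m)
      where
      cov′ : ∀ {D} → D ∈ elems a → D ∈ B ⊎ D ∈ C ∷ E → D ∈ B ⊎ D ∈ E
      cov′ m (inj₁ p)           = inj₁ p
      cov′ m (inj₂ (here refl)) = contradiction m C∉a
      cov′ m (inj₂ (there p))   = inj₂ p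
    ... | no C∉B | yes C∈a with remove a C∈a
    ...   | a′ , st , a′⊆a , C∉a′ , keep with erases E a′ (λ c c⊆ → P⊆ c (λ m → a′⊆a (c⊆ m))) (λ m → keep (B⊆a m) λ { refl → C∉B m }) cov′
      where
      cov′ : ∀ {D} → D ∈ elems a′ → D ∈ B ⊎ D ∈ E
      cov′ m with cov (a′⊆a m)
      ... | inj₁ p           = inj₁ p
      ... | inj₂ (here refl) = contradiction m C∉a′
      ... | inj₂ (there p)   = inj₂ p
    ...     | b , b≃B , π , ps = b , b≃B , st ◅ π , P⊆ a id ∷ ps

  ⇝-forget : ∀ {A B s} → length A ≤ s → B ⊆ A → A ⇝[ s , 0 ] B
  ⇝-forget {A} {B} {s} A≤s B⊆A = mk⇝ [] z≤n λ a a≃A →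
    erases A a (fits {a} a≃A) (λ m → proj₂ a≃A (B⊆A m)) (λ m → inj₂ (proj₁ a≃A m))
    where
    fits : ∀ {a} → elems a ≃ A → ∀ c → elems c ⊆ elems a → Within s (A ++ []) c
    fits {a} a≃A c c⊆a = within (≤-trans (∣∣-≤ c (λ m → proj₁ a≃A (c⊆a m))) A≤s) (λ m → ∈-++⁺ˡ (proj₁ a≃A (c⊆a m)))

  Sp-≤ : ∀ {s} (π : Refutation F) → Configs (λ c → ∣ c ∣ˢ ≤ s) π → Sp π ≤ s
  Sp-≤ π ps = max≤v⁺ {⊥ = 0} {xs = map ∣_∣ˢ (configurations π)} z≤n (All.map⁺ ps)

  ≤-Sp : ∀ (π : Refutation F) → Configs (λ c → ∣ c ∣ˢ ≤ Sp π) π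
  ≤-Sp π = All.map⁻ (xs≤max 0 (map ∣_∣ˢ (configurations π)))

  Len-≤ : ∀ Z (π : Refutation F) → Configs (λ c → elems c ⊆ Z) π → Len π ≤ length Z
  Len-≤ Z π ps = length-⊆ (deduplicate-! _≟ᶜ_ (concatMap elems (configurations π))) (sub ∘ ∈-deduplicate⁻ _≟ᶜ_ _)
    where
    sub : concatMap elems (configurations π) ⊆ Z
    sub m with find (∈-concatMap⁻ elems {xs = configurations π} m)
    ... | c , c∈ , D∈c = All.lookup ps c∈ D∈c

  refutation : ∀ {s ℓ} → [] ⇝[ s , ℓ ] [ emptyClause ] → Σ[ π ∈ Refutation F ] (Sp π ≤ s) × (Len π ≤ ℓ)
  refutation {s} {ℓ} (mk⇝ Z c r) = finish (r ∅ ≃-refl)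
    where
    narrow : ∀ {b c} → elems c ≃ elems b → Within s Z b → Within s Z c
    narrow {b} {c} c≃b (within p q) = within (≤-trans (∣∣-≤ c (proj₁ c≃b)) p) (λ m → q (proj₁ c≃b m))
    finish : Σ[ b ∈ ClauseSet v ] (elems b ≃ [ emptyClause ]) ×
             (Σ[ π ∈ Star (Step F) ∅ b ] Configs (Within s Z) π) →
             Σ[ π ∈ Refutation F ] (Sp π ≤ s) × (Len π ≤ ℓ)
    finish (b , b≃0 , π , ps) with star-target narrow {c = ｛0｝} (≃-sym b≃0) π ps
    ... | inj₁ (0⊆∅ , _) = contradiction (0⊆∅ (here refl)) λ ()
    ... | inj₂ (π′ , qs) = π′ , Sp-≤ π′ (All.map Within.space qs) , ≤-trans (Len-≤ Z π′ (All.map Within.content qs)) c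

-- Decision trees and their conversion into refutations.

-- A decision tree that finds a falsified clause; `ρ` holds the answers so far, and the index bounds
-- the number of further queries from above. `conflict` closes contradictory branches, so a tree may
-- repeat a query without any bookkeeping.
data Tree {V : Set} (φ : Formula V) : ℕ → List (Lit V) → Set where
  conflict : ∀ {d ρ} u → Pos u ∈ ρ → Neg u ∈ ρ → Tree φ d ρ
  leaf     : ∀ {d ρ ls} → ls ∈ φ → (∀ {l} → l ∈ ls → neg l ∈ ρ) → Tree φ d ρ
  query    : ∀ {d ρ} u → (∀ b → Tree φ d ((u , b) ∷ ρ)) → Tree φ (suc d) ρ

neg-involutive : ∀ {V : Set} (l : Lit V) → neg (neg l) ≡ l
neg-involutive (u , b) = cong (u ,_) (Bool.not-involutive b)

module Refute {V : Set} {v : ℕ} (iso : V ↔ Fin v) (φ : Formula V) where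

  open Encoding iso public
  open Derive (cnf φ) public
  open import Data.List.Membership.DecPropositional _≟ˡ_ using (_∈?_)

  private
    join : V → Clause v → Clause v → Clause v
    join u P N = tabulate λ x → if does (x Fin.≟ enc u) then nothing else (lookup P x <∣> lookup N x)

    join-pivot : ∀ u P N → lookup (join u P N) (enc u) ≡ nothing
    join-pivot u P N rewrite Vec.lookup∘tabulate (λ x → if does (x Fin.≟ enc u) then nothing else (lookup P x <∣> lookup N x)) (enc u)
      with enc u Fin.≟ enc u
    ... | yes _ = refl
    ... | no ≢  = contradiction refl ≢

    join-rest : ∀ u P N {w} → w ≢ u → lookup (join u P N) (enc w) ≡ (lookup P (enc w) <∣> lookup N (enc w))
    join-rest u P N {w} w≢u
      rewrite Vec.lookup∘tabulate (λ x → if does (x Fin.≟ enc u) then nothing else (lookup P x <∣> lookup N x)) (enc w)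
      with enc w Fin.≟ enc u
    ... | yes e = contradiction (enc-injective e) w≢u
    ... | no _  = refl

  _has?_ : ∀ (C : Clause v) l → Dec (C has l)
  C has? (u , b) = Maybe.≡-dec Bool._≟_ (lookup C (enc u)) (just b)

  ⊑-drop : ∀ {C l Q} → ¬ (C has l) → C ⊑ (λ k → k ≡ l ⊎ Q k) → C ⊑ Q
  ⊑-drop {C} ¬h sub {k} h with sub {k} h
  ... | inj₁ refl = contradiction h ¬h
  ... | inj₂ q    = q

  -- Working with clauses contained in Q, rather than with exact clauses, makes
  -- resolution admissible even if the pivot is missing from a premise.
  cut : ∀ {Q u A s P N} → Consistent Q → P ∈ A → N ∈ A →
        P ⊑ (λ l → l ≡ Pos u ⊎ Q l) → N ⊑ (λ l → l ≡ Neg u ⊎ Q l) → length A < s →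
        Σ[ D ∈ Clause v ] (D ⊑ Q) × (A ⇝[ s , 1 ] D ∷ A)
  cut {Q} {u} {A} {s} {P} {N} con P∈A N∈A P⊑ N⊑ A<s with P has? Pos u | N has? Neg u
  ... | no ¬p | _ = P , ⊑-drop {P} {Pos u} {Q} ¬p P⊑ ,
    ⇝-weaken ≤-refl z≤n (⇝-resp (<⇒≤ A<s) (there , λ { (here refl) → P∈A ; (there m) → m }))
  ... | _ | no ¬n = N , ⊑-drop {N} {Neg u} {Q} ¬n N⊑ ,
    ⇝-weaken ≤-refl z≤n (⇝-resp (<⇒≤ A<s) (there , λ { (here refl) → N∈A ; (there m) → m }))
  ... | yes p | yes n = D , (λ {l} → D⊑ {l}) ,
    ⇝-infer A<s P∈A N∈A (resolves u p n (join-pivot u P N) P⇒D N⇒D D⇒)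
    where
    D : Clause v
    D = join u P N
    Qof : ∀ {C l m} → C ⊑ (λ k → k ≡ (u , m) ⊎ Q k) → proj₁ l ≢ u → C has l → Q l
    Qof {C} {l} sub ≢u h with sub {l} h
    ... | inj₁ refl = contradiction refl ≢u
    ... | inj₂ q    = q
    agree : ∀ {w b c} → Q (w , b) → Q (w , c) → b ≡ c
    agree {b = true}  {true}  _ _ = refl
    agree {b = false} {false} _ _ = refl
    agree {b = true}  {false} q r = ⊥-elim (con _ q r)
    agree {b = false} {true}  q r = ⊥-elim (con _ r q)
    P⇒D : ∀ {w b} → w ≢ u → P has (w , b) → D has (w , b)
    P⇒D {w} w≢u h = trans (join-rest u P N w≢u) (cong (_<∣> lookup N (enc w)) h)
    D⇒ : ∀ {l} → D has l → P has l ⊎ N has l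
    D⇒ {w , b} h with w ≟ⱽ u
    ... | yes refl = contradiction (trans (sym h) (join-pivot u P N)) λ ()
    ... | no w≢u with lookup P (enc w) | trans (sym (join-rest u P N w≢u)) h
    ...   | just _  | e = inj₁ e
    ...   | nothing | e = inj₂ e
    N⇒D : ∀ {w b} → w ≢ u → N has (w , b) → D has (w , b)
    N⇒D {w} {b} w≢u h with lookup P (enc w) in e | join-rest u P N w≢u
    ... | nothing | j = trans j h
    ... | just c  | j = trans j (cong just (agree (Qof {P} P⊑ w≢u e) (Qof {N} N⊑ w≢u h)))
    D⊑ : D ⊑ Q
    D⊑ {w , b} h with w ≟ⱽ u
    ... | yes refl = contradiction (trans (sym h) (join-pivot u P N)) λ ()
    ... | no w≢u with D⇒ {w , b} h
    ...   | inj₁ q = Qof {P} P⊑ w≢u q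
    ...   | inj₂ q = Qof {N} N⊑ w≢u q

  axiom : ∀ {ls A s} → ls ∈ φ → Consistent (_∈ ls) → length A < s → A ⇝[ s , 1 ] clause ls ∷ A
  axiom {ls} p con A<s = ⇝-download A<s (axiom⁺ p con)

  -- The axiom stays in memory only during the cut: two clauses are added at the peak and one in the
  -- end.
  cut-axiom : ∀ {Q u ls A s P} → Consistent Q → P ∈ A → ls ∈ φ → Consistent (_∈ ls) →
              P ⊑ (λ l → l ≡ Pos u ⊎ Q l) → (∀ {l} → l ∈ ls → l ≡ Neg u ⊎ Q l) → 2 + length A ≤ s →
              Σ[ D ∈ Clause v ] (D ⊑ Q) × (A ⇝[ s , 2 ] D ∷ A)
  cut-axiom {Q} {u} {ls} {A} {s} {P} con P∈A ls∈φ lscon P⊑ ls⊆ A<s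
    with cut {Q} {u} con (there P∈A) (here refl) P⊑ (λ {l} h → ls⊆ (clause-⊑ ls {l} h)) A<s
  ... | D , D⊑ , D⇝ = D , D⊑ ,
    ⇝-trans (axiom ls∈φ lscon (<⇒≤ A<s))
      (⇝-trans D⇝ (⇝-forget A<s (λ { (here refl) → here refl ; (there m) → there (there m) })))

  private
    consistent-∷ : ∀ {ρ : List (Lit V)} {u b} → Consistent (_∈ ρ) → neg (u , b) ∉ ρ → Consistent (_∈ ((u , b) ∷ ρ))
    consistent-∷ con l∉ w (here refl) (there n)   = l∉ n
    consistent-∷ con l∉ w (there p)   (here refl) = l∉ p
    consistent-∷ con l∉ w (there p)   (there n)   = con w p n

    absorb : ∀ {k l : Lit V} {ρ} → k ∈ ρ → l ∈ k ∷ ρ → l ∈ ρ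
    absorb p (here refl) = p
    absorb p (there q)   = q

    split : ∀ {u b ρ} {l : Lit V} → neg l ∈ (u , b) ∷ ρ → l ≡ (u , not b) ⊎ neg l ∈ ρ
    split {l = w , c} (here refl) = inj₁ (sym (neg-involutive (w , c)))
    split (there p) = inj₂ p

  -- The clause of one branch is kept while the other branch is processed, so space grows by one per
  -- level of the tree, however many clauses are derived. The path `ρ` is kept consistent
  -- throughout.
  tree-derives : ∀ {d ρ A s} → Tree φ d ρ → Consistent (_∈ ρ) → 2 + d + length A ≤ s →
                 Σ[ D ∈ Clause v ] (D ⊑ (λ l → neg l ∈ ρ)) × ∃[ ℓ ] (A ⇝[ s , ℓ ] D ∷ A)
  tree-derives (conflict u p n) con A≤s = ⊥-elim (con u p n)
  tree-derives {d} {ρ} {A} (leaf {ls = ls} ls∈φ sub) con A≤s =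
    clause ls , (λ {l} h → sub (clause-⊑ ls {l} h)) , 1 ,
    axiom ls∈φ (λ u p n → con u (sub n) (sub p)) (≤-trans (s≤s (m≤n⇒m≤1+n (m≤n+m _ d))) A≤s)
  tree-derives {suc d} {ρ} {A} {s} (query u t) con A≤s with Pos u ∈? ρ | Neg u ∈? ρ
  -- A repeated query is answered by the path: only the agreeing branch is followed, and its extra
  -- literal is absorbed by `ρ`.
  ... | yes p | _ with tree-derives (t true) (consistent-∷ con (con u p)) (<⇒≤ A≤s)
  ...   | D , D⊑ , ℓ , r = D , (λ {l} h → absorb p (D⊑ {l} h)) , ℓ , r
  tree-derives {suc d} {ρ} {A} {s} (query u t) con A≤s | no _ | yes n
    with tree-derives (t false) (consistent-∷ con (λ p → con u p n)) (<⇒≤ A≤s)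
  ...   | D , D⊑ , ℓ , r = D , (λ {l} h → absorb n (D⊑ {l} h)) , ℓ , r
  tree-derives {suc d} {ρ} {A} {s} (query u t) con A≤s | no p∉ | no n∉
    with tree-derives (t false) (consistent-∷ con p∉) (<⇒≤ A≤s)
  ... | P , P⊑ , ℓ , P⇝
    with tree-derives {A = P ∷ A} (t true) (consistent-∷ con n∉) (≤-trans (≤-reflexive (cong (2 +_) (+-suc d (length A)))) A≤s)
  ...   | N , N⊑ , ℓ′ , N⇝
    with cut {λ l → neg l ∈ ρ} {u} {N ∷ P ∷ A} (λ w p n → con w n p) (there (here refl)) (here refl)
             (λ {l} h → split (P⊑ {l} h)) (λ {l} h → split (N⊑ {l} h)) A+2<s
    where
    A+2<s : 2 + length A < s
    A+2<s = ≤-trans (+-monoʳ-≤ 3 (m≤n+m (length A) d)) A≤s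
  ...     | D , D⊑ , D⇝ = D , (λ {l} → D⊑ {l}) , ℓ + (ℓ′ + (1 + 0)) ,
    ⇝-trans P⇝ (⇝-trans N⇝ (⇝-trans D⇝
      (⇝-forget (≤-trans (+-monoʳ-≤ 3 (m≤n+m (length A) d)) A≤s)
        (λ { (here refl) → here refl ; (there m) → there (there (there m)) }))))

  empty-consistent : Consistent {V} (_∈ [])
  empty-consistent u ()

  tree-refutes : ∀ {d} → Tree φ d [] → Σ[ π ∈ Refutation (cnf φ) ] Sp π ≤ 2 + d
  tree-refutes {d} t with tree-derives {A = []} t empty-consistent (≤-reflexive (cong (2 +_) (+-identityʳ d)))
  ... | D , D⊑ , ℓ , r with ⊑⊥⇒empty {D} (λ {l} h → none (D⊑ {l} h))
    where
    none : ∀ {l : Lit V} → l ∈ [] → ⊥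
    none ()
  ...   | refl with refutation r
  ...     | π , sp , _ = π , sp

  tree-unsat : ∀ {d} → Tree φ d [] → Unsatisfiable (cnf φ)
  tree-unsat t α sat = go t λ ()
    where
    Agrees : List (Lit V) → Set
    Agrees ρ = ∀ {u b} → (u , b) ∈ ρ → α (enc u) ≡ b
    not-≢ : ∀ {a b} → a ≡ b → a ≡ not b → ⊥
    not-≢ {true}  refl ()
    not-≢ {false} refl ()
    go : ∀ {d ρ} → Tree φ d ρ → Agrees ρ → ⊥
    go (conflict u p n) agr = not-≢ (agr p) (agr n)
    go (leaf {ls = ls} ls∈φ sub) agr with All.lookup sat (axiom⁺ ls∈φ λ u p n → not-≢ (agr (sub n)) (agr (sub p)))
    ... | x , h = not-≢ refl (trans (cong α (sym (enc-dec x))) (agr (sub (clause-⊑ ls (from-lookup (clause ls) h)))))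
    go (query u t) agr = go (t (α (enc u))) λ { (here refl) → refl ; (there m) → agr m }

-- The ordering principle with clauses of at most three literals.

length-cartesianProduct : ∀ {A B : Set} (xs : List A) (ys : List B) →
                          length (cartesianProduct xs ys) ≡ length xs * length ys
length-cartesianProduct []       ys = refl
length-cartesianProduct (a ∷ xs) ys = trans (length-++ (map (a ,_) ys))
  (cong₂ _+_ (length-map (a ,_) ys) (length-cartesianProduct xs ys))

-- less i j says i ≺ j, and above j k says that j has a predecessor with index at least k.
Ordvar : ℕ → ℕ → Set
Ordvar m p = (Fin m × Fin m) ⊎ ((Fin m × Fin (suc m)) ⊎ Fin p)

pattern less i j = inj₁ (i , j)
pattern above j k = inj₂ (inj₁ (j , k))
pattern dummy a   = inj₂ (inj₂ a)

module Ordering (m p : ℕ) where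

  V : Set
  V = Ordvar m p

  irrefl : Fin m → List (Lit V)
  irrefl i = Neg (less i i) ∷ []

  transitive : Fin m × (Fin m × Fin m) → List (Lit V)
  transitive (i , j , k) = Neg (less i j) ∷ Neg (less j k) ∷ Pos (less i k) ∷ []

  start : Fin m → List (Lit V)
  start j = Pos (above j zero) ∷ []

  -- A predecessor of index at least `i` is `i` itself or has a larger index. The chain from `start`
  -- to `end` thus splits the wide clause saying that some `i` precedes `j`.
  next : Fin m × Fin m → List (Lit V)
  next (j , i) = Neg (above j (inject₁ i)) ∷ Pos (less i j) ∷ Pos (above j (suc i)) ∷ []

  end : Fin m → List (Lit V)
  end j = Neg (above j (fromℕ m)) ∷ []

  -- The padding makes the size of the formula adjustable.
  pad : Fin p → List (Lit V)
  pad a = Pos (dummy a) ∷ []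

  pairs : List (Fin m × Fin m)
  pairs = cartesianProduct (allFin m) (allFin m)

  triples : List (Fin m × (Fin m × Fin m))
  triples = cartesianProduct (allFin m) pairs

  formula : Formula V
  formula = map irrefl (allFin m) ++ map transitive triples ++ map start (allFin m)
         ++ map next pairs ++ map end (allFin m) ++ map pad (allFin p)

  length-formula : length formula ≡ m + (m * (m * m) + (m + (m * m + (m + p))))
  length-formula
    rewrite length-++ (map irrefl (allFin m)) {map transitive triples ++ map start (allFin m) ++ map next pairs ++ map end (allFin m) ++ map pad (allFin p)}
          | length-++ (map transitive triples) {map start (allFin m) ++ map next pairs ++ map end (allFin m) ++ map pad (allFin p)}
          | length-++ (map start (allFin m)) {map next pairs ++ map end (allFin m) ++ map pad (allFin p)}
          | length-++ (map next pairs) {map end (allFin m) ++ map pad (allFin p)}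
          | length-++ (map end (allFin m)) {map pad (allFin p)}
          | length-map irrefl (allFin m) | length-map transitive triples | length-map start (allFin m)
          | length-map next pairs | length-map end (allFin m) | length-map pad (allFin p)
          | length-cartesianProduct (allFin m) pairs | length-cartesianProduct (allFin m) (allFin m)
          | length-tabulate {n = m} id | length-tabulate {n = p} id = refl

  all-formula : ∀ {P : List (Lit V) → Set} →
    (∀ i → P (irrefl i)) → (∀ t → P (transitive t)) → (∀ j → P (start j)) →
    (∀ q → P (next q)) → (∀ j → P (end j)) → (∀ a → P (pad a)) → All P formula
  all-formula {P} a b c d e f =
    All.++⁺ (all irrefl (allFin m) a) (All.++⁺ (all transitive triples b) (All.++⁺ (all start (allFin m) c)
      (All.++⁺ (all next pairs d) (All.++⁺ (all end (allFin m) e) (all pad (allFin p) f)))))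
    where
    all : ∀ {A : Set} (g : A → List (Lit V)) xs → (∀ i → P (g i)) → All P (map g xs)
    all g xs h = All.map⁺ (All.tabulate {xs = xs} λ _ → h _)

  length-≤3 : All (λ ls → length ls ≤ 3) formula
  length-≤3 = all-formula (λ _ → s≤s z≤n) (λ _ → ≤-refl) (λ _ → s≤s z≤n) (λ _ → ≤-refl) (λ _ → s≤s z≤n) (λ _ → s≤s z≤n)

  irrefl∈ : ∀ i → irrefl i ∈ formula
  irrefl∈ i = ∈-++⁺ˡ (∈-map⁺ irrefl (∈-allFin i))

  transitive∈ : ∀ i j k → transitive (i , j , k) ∈ formula
  transitive∈ i j k = ∈-++⁺ʳ (map irrefl (allFin m)) (∈-++⁺ˡ (∈-map⁺ transitive
    (∈-cartesianProduct⁺ (∈-allFin i) (∈-cartesianProduct⁺ (∈-allFin j) (∈-allFin k)))))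

  private
    skip₂ : ∀ {ls rest} → ls ∈ map start (allFin m) ++ rest →
            ls ∈ map irrefl (allFin m) ++ map transitive triples ++ map start (allFin m) ++ rest
    skip₂ q = ∈-++⁺ʳ (map irrefl (allFin m)) (∈-++⁺ʳ (map transitive triples) q)

    skip₄ : ∀ {ls} → ls ∈ map end (allFin m) ++ map pad (allFin p) → ls ∈ formula
    skip₄ q = skip₂ (∈-++⁺ʳ (map start (allFin m)) (∈-++⁺ʳ (map next pairs) q))

  start∈ : ∀ j → start j ∈ formula
  start∈ j = skip₂ (∈-++⁺ˡ (∈-map⁺ start (∈-allFin j)))

  next∈ : ∀ j i → next (j , i) ∈ formula
  next∈ j i = skip₂ (∈-++⁺ʳ (map start (allFin m)) (∈-++⁺ˡ (∈-map⁺ next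
    (∈-cartesianProduct⁺ (∈-allFin j) (∈-allFin i)))))

  end∈ : ∀ j → end j ∈ formula
  end∈ j = skip₄ (∈-++⁺ˡ (∈-map⁺ end (∈-allFin j)))

  pad∈ : ∀ a → pad a ∈ formula
  pad∈ a = skip₄ (∈-++⁺ʳ (map end (allFin m)) (∈-map⁺ pad (∈-allFin a)))

-- A decision tree of linear depth for the ordering principle.

tree-mono : ∀ {V} {φ : Formula V} {d d′ ρ} → d ≤ d′ → Tree φ d ρ → Tree φ d′ ρ
tree-mono d≤       (conflict u p n) = conflict u p n
tree-mono d≤       (leaf p sub)     = leaf p sub
tree-mono (s≤s d≤) (query u t)      = query u λ b → tree-mono d≤ (t b)

-- The decision tree runs a knockout tournament for a ≺-minimal element c, looks for
-- an alleged predecessor i of c, and refutes i ≺ c along the chain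
-- c ≺ … ≺ e of past champions up to the one that i has lost to.
module OrderingTree (m p : ℕ) where

  open Ordering m p

  data Path (ρ : List (Lit V)) : ℕ → Fin m → Fin m → Set where
    stop : ∀ {ℓ c} → Path ρ ℓ c c
    step : ∀ {ℓ c d e} → Pos (less c d) ∈ ρ → Path ρ ℓ d e → Path ρ (suc ℓ) c e

  path-mono : ∀ {ρ ρ′ ℓ ℓ′ c e} → ρ ⊆ ρ′ → ℓ ≤ ℓ′ → Path ρ ℓ c e → Path ρ′ ℓ′ c e
  path-mono ρ⊆ ℓ≤       stop       = stop
  path-mono ρ⊆ (s≤s ℓ≤) (step q r) = step (ρ⊆ q) (path-mono ρ⊆ ℓ≤ r)

  Lost : List (Lit V) → ℕ → Fin m → Fin m → Set
  Lost ρ ℓ c i = ∃[ e ] Path ρ ℓ c e × (Neg (less i e) ∈ ρ)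

  lost-mono : ∀ {ρ ρ′ ℓ ℓ′ c i} → ρ ⊆ ρ′ → ℓ ≤ ℓ′ → Lost ρ ℓ c i → Lost ρ′ ℓ′ c i
  lost-mono ρ⊆ ℓ≤ (e , r , n) = e , path-mono ρ⊆ ℓ≤ r , ρ⊆ n

  -- Transitivity carries `i ≺ c` along the chain, one query per link, until it contradicts that `i`
  -- does not precede `e`.
  close : ∀ {ρ ℓ i c e} → Path ρ ℓ c e → Pos (less i c) ∈ ρ → Neg (less i e) ∈ ρ → Tree formula ℓ ρ
  close stop p n = conflict _ p n
  close {i = i} {c} (step {d = d} q r) p n = query (less i d) λ
    { true  → close (path-mono there ≤-refl r) (here refl) (there n)
    ; false → leaf (transitive∈ i c d) λ
        { (here refl)                 → there p
        ; (there (here refl))         → there q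
        ; (there (there (here refl))) → here refl } }

  -- Each index costs two queries. The `ℓ` queries of `close` are paid only in a branch that ends
  -- there, so they are added once and not per index.
  scan : ∀ {ℓ} c (k : Fin (suc m)) {ρ} → (∀ i → Lost ρ ℓ c i) → Pos (above c k) ∈ ρ →
         Tree formula ((m ∸ toℕ k) * 2 + ℓ) ρ
  scan {ℓ} c = >-weakInduction Scan last more
    where
    Scan : Fin (suc m) → Set
    Scan k = ∀ {ρ} → (∀ i → Lost ρ ℓ c i) → Pos (above c k) ∈ ρ → Tree formula ((m ∸ toℕ k) * 2 + ℓ) ρ
    last : Scan (fromℕ m)
    last lost q = leaf (end∈ c) λ { (here refl) → q }
    more : ∀ i → Scan (suc i) → Scan (inject₁ i)
    more i scan′ {ρ} lost q = subst (λ d → Tree formula (d * 2 + ℓ) ρ) (sym depth) (query (above c (suc i)) λ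
      { true  → tree-mono (n≤1+n _) (scan′ (λ k → lost-mono there ≤-refl (lost k)) (here refl))
      ; false → query (less i c) λ
          { true  → let e , r , n = lost i
                    in tree-mono (m≤n+m ℓ _) (close (path-mono (there ∘ there) ≤-refl r) (here refl) (there (there n)))
          ; false → leaf (next∈ c i) λ
              { (here refl)                 → there (there q)
              ; (there (here refl))         → here refl
              ; (there (there (here refl))) → there (here refl) } } })
      where
      depth : m ∸ toℕ (inject₁ i) ≡ suc (m ∸ suc (toℕ i))
      depth = trans (cong (m ∸_) (Fin.toℕ-inject₁ i)) (+-∸-assoc 1 (Fin.toℕ<n i))

  depth : List (Fin m) → ℕ → ℕ
  depth []      ℓ = suc (m * 2 + ℓ)
  depth (_ ∷ L) ℓ = suc (suc (depth L (suc ℓ)))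

  knockout : ∀ L {ρ ℓ} c → (∀ i → i ∈ L ⊎ Lost ρ ℓ c i) → Tree formula (depth L ℓ) ρ
  knockout [] c lost = query (above c zero) λ
    { true  → scan c zero (λ i → lost-mono there ≤-refl (all i (lost i))) (here refl)
    ; false → leaf (start∈ c) λ { (here refl) → here refl } }
    where
    all : ∀ i {ρ ℓ} → i ∈ [] ⊎ Lost ρ ℓ c i → Lost ρ ℓ c i
    all i (inj₂ q) = q
  knockout (k ∷ L) {ρ} {ℓ} c lost = query (less k c) λ
    -- A new champion has to count as beaten too, since `scan` asks for a record for every element;
    -- it loses to itself by irreflexivity.
    { true  → query (less k k) λ
        { true  → leaf (irrefl∈ k) λ { (here refl) → here refl }
        ; false → knockout L k λ i → new i (lost i) }
    ; false → tree-mono (n≤1+n _) (knockout L c λ i → old i (lost i)) }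
    where
    old : ∀ i → i ∈ k ∷ L ⊎ Lost ρ ℓ c i → i ∈ L ⊎ Lost (Neg (less k c) ∷ ρ) (suc ℓ) c i
    old i (inj₁ (here refl)) = inj₂ (c , stop , here refl)
    old i (inj₁ (there q))   = inj₁ q
    old i (inj₂ q)           = inj₂ (lost-mono there (n≤1+n _) q)
    new : ∀ i → i ∈ k ∷ L ⊎ Lost ρ ℓ c i → i ∈ L ⊎ Lost (Neg (less k k) ∷ Pos (less k c) ∷ ρ) (suc ℓ) k i
    new i (inj₁ (here refl))   = inj₂ (k , stop , here refl)
    new i (inj₁ (there q))     = inj₁ q
    new i (inj₂ (e , r , n))   = inj₂ (e , step (there (here refl)) (path-mono (there ∘ there) ≤-refl r) , there (there n))

  depth-≡ : ∀ L ℓ → depth L ℓ ≡ suc (length L * 3 + m * 2 + ℓ)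
  depth-≡ []      ℓ = refl
  depth-≡ (_ ∷ L) ℓ = cong (λ d → suc (suc d)) (trans (depth-≡ L (suc ℓ)) (cong suc (+-suc (length L * 3 + m * 2) ℓ)))

-- A comparison costs two queries and adds at most one link to the chain, and the scan costs two
-- queries per element: five for each, and one more for `start`. The first champion stays in the
-- list, so that the comparison with itself supplies its own record.
ordering-tree : ∀ m p → Tree (Ordering.formula (suc m) p) (suc (suc m * 5)) []
ordering-tree m p = subst (λ d → Tree (Ordering.formula (suc m) p) d []) eq
  (knockout (allFin (suc m)) zero (λ i → inj₁ (∈-allFin i)))
  where
  open OrderingTree (suc m) p
  eq : depth (allFin (suc m)) 0 ≡ suc (suc m * 5)
  eq = trans (depth-≡ (allFin (suc m)) 0)
    (cong suc (trans (cong (λ l → l * 3 + suc m * 2 + 0) (length-tabulate {n = suc m} id))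
      (solve 1 (λ n → n :* con 3 :+ n :* con 2 :+ con 0 := n :* con 5) refl (suc m))))
    where open +-*-Solver

-- Substitution of exclusive ors.

-- The variable u is replaced by the exclusive or of (u , false) and (u , true); a literal
-- (u , s) becomes the two clauses that exclude the values a and a xor not s of these.
excluding : ∀ {V : Set} → Lit V → Bool → List (Lit (V × Bool)) → List (Lit (V × Bool))
excluding (u , s) a ks = ((u , false) , not a) ∷ ((u , true) , not (a xor not s)) ∷ ks

-- There is one clause for each choice of the values `a`, and it forbids one way to falsify all
-- literals at once; hence the power of two in the number of clauses.
xor-clause : ∀ {V : Set} → List (Lit V) → List (List (Lit (V × Bool)))
xor-clause []       = [] ∷ []
xor-clause (l ∷ ls) = map (excluding l true) (xor-clause ls) ++ map (excluding l false) (xor-clause ls)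

xor-formula : ∀ {V : Set} → Formula V → Formula (V × Bool)
xor-formula = concatMap xor-clause

length-xor-clause : ∀ {V : Set} (ls : List (Lit V)) → length (xor-clause ls) ≡ 2 ^ length ls
length-xor-clause []       = refl
length-xor-clause (l ∷ ls) = trans (length-++ (map (excluding l true) (xor-clause ls)))
  (cong₂ _+_ (half true) (trans (half false) (sym (+-identityʳ _))))
  where
  half : ∀ a → length (map (excluding l a) (xor-clause ls)) ≡ 2 ^ length ls
  half a = trans (length-map (excluding l a) (xor-clause ls)) (length-xor-clause ls)

length-xor-formula : ∀ {V : Set} k (φ : Formula V) → All (λ ls → length ls ≤ k) φ →
                     length (xor-formula φ) ≤ length φ * 2 ^ k
length-xor-formula k []       []       = z≤n
length-xor-formula k (ls ∷ φ) (h ∷ hs) = begin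
  length (xor-clause ls ++ xor-formula φ)          ≡⟨ length-++ (xor-clause ls) ⟩
  length (xor-clause ls) + length (xor-formula φ)
    ≤⟨ +-mono-≤ (≤-trans (≤-reflexive (length-xor-clause ls)) (^-monoʳ-≤ 2 h)) (length-xor-formula k φ hs) ⟩
  2 ^ k + length φ * 2 ^ k                         ∎
  where open ≤-Reasoning

xor-clause-width : ∀ {V : Set} (ls : List (Lit V)) → All (λ ks → length ks ≡ length ls * 2) (xor-clause ls)
xor-clause-width []       = refl ∷ []
xor-clause-width (l ∷ ls) = All.++⁺ (half true) (half false)
  where
  half : ∀ a → All (λ ks → length ks ≡ suc (suc (length ls * 2))) (map (excluding l a) (xor-clause ls))
  half a = All.map⁺ (All.map (cong (λ n → suc (suc n))) (xor-clause-width ls))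

xor-formula-width : ∀ {V : Set} k (φ : Formula V) → All (λ ls → length ls ≤ k) φ →
                    All (λ ks → length ks ≤ k * 2) (xor-formula φ)
xor-formula-width k []       []       = []
xor-formula-width k (ls ∷ φ) (h ∷ hs) = All.++⁺
  (All.map (λ e → ≤-trans (≤-reflexive e) (*-monoˡ-≤ 2 h)) (xor-clause-width ls)) (xor-formula-width k φ hs)

rename : ∀ {V W : Set} → (V → W) → List (Lit V) → List (Lit W)
rename e = map (map₁ e)

xor-clause∈ : ∀ {V : Set} {φ : Formula V} {ls ks} → ls ∈ φ → ks ∈ xor-clause ls → ks ∈ xor-formula φ
xor-clause∈ {φ = φ} p q = ∈-concatMap⁺ xor-clause {xs = φ} (lose p q)

module _ {V W : Set} {φ : Formula V} {ψ : Formula W} (e : V × Bool → W)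
         (ψ∋ : ∀ {ks} → ks ∈ xor-formula φ → rename e ks ∈ ψ) where

  private
    Lifts : List (Lit V) → List (Lit W) → Set
    Lifts ρ ρ′ = ∀ {u b} → (u , b) ∈ ρ → ∃[ a ] (e (u , false) , a) ∈ ρ′ × (e (u , true) , a xor b) ∈ ρ′

    xor-cancel : ∀ a b → a xor (a xor b) ≡ b
    xor-cancel true  true  = refl
    xor-cancel true  false = refl
    xor-cancel false b     = refl

    falsified : ∀ {ρ ρ′} ls → Lifts ρ ρ′ → (∀ {l} → l ∈ ls → neg l ∈ ρ) →
                ∃[ ks ] ks ∈ xor-clause ls × (∀ {k} → k ∈ rename e ks → neg k ∈ ρ′)
    falsified [] lift sub = [] , here refl , λ ()
    falsified {ρ} {ρ′} ((u , s) ∷ ls) lift sub with falsified ls lift (sub ∘ there) | lift (sub (here refl))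
    ... | ks , ks∈ , ks-false | a , p , q = _ , cube a , false∈
      where
      cube : ∀ a → excluding (u , s) a ks ∈ xor-clause ((u , s) ∷ ls)
      cube true  = ∈-++⁺ˡ (∈-map⁺ _ ks∈)
      cube false = ∈-++⁺ʳ (map (excluding (u , s) true) (xor-clause ls)) (∈-map⁺ _ ks∈)
      false∈ : ∀ {k} → k ∈ rename e (excluding (u , s) a ks) → neg k ∈ ρ′
      false∈ (here refl)         = subst (_∈ ρ′) (sym (neg-involutive (e (u , false) , a))) p
      false∈ (there (here refl)) = subst (_∈ ρ′) (sym (neg-involutive (e (u , true) , a xor not s))) q
      false∈ (there (there r))   = ks-false r

  -- A query becomes two, one per half, which doubles the depth. Contradictory values of `u` force a
  -- disagreement on one of its halves.
  xor-tree : ∀ {d ρ ρ′} → (∀ {u b} → (u , b) ∈ ρ → ∃[ a ] (e (u , false) , a) ∈ ρ′ × (e (u , true) , a xor b) ∈ ρ′) →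
             Tree φ d ρ → Tree ψ (d * 2) ρ′
  xor-tree lift (conflict u p n) with lift p | lift n
  ... | true  , r , s | true  , r′ , s′ = conflict _ s′ s
  ... | false , r , s | false , r′ , s′ = conflict _ s s′
  ... | true  , r , s | false , r′ , s′ = conflict _ r r′
  ... | false , r , s | true  , r′ , s′ = conflict _ r′ r
  xor-tree lift (leaf {ls = ls} ls∈φ sub) with falsified ls lift sub
  ... | ks , ks∈ , ks-false = leaf (ψ∋ (xor-clause∈ ls∈φ ks∈)) ks-false
  xor-tree {ρ = ρ} {ρ′} lift (query u t) = query (e (u , false)) λ a → query (e (u , true)) λ c →
    xor-tree (lift′ a c) (t (a xor c))
    where
    lift′ : ∀ a c {w b} → (w , b) ∈ (u , a xor c) ∷ ρ →
            ∃[ a′ ] (e (w , false) , a′) ∈ (e (u , true) , c) ∷ (e (u , false) , a) ∷ ρ′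
                  × (e (w , true) , a′ xor b) ∈ (e (u , true) , c) ∷ (e (u , false) , a) ∷ ρ′
    lift′ a c (here refl) = a , there (here refl) , here (cong (_ ,_) (xor-cancel a c))
    lift′ a c (there m) with lift m
    ... | a′ , p , q = a′ , there (there p) , there (there q)

-- A short refutation of the ordering principle in small space.

shift-⊆ : ∀ {A : Set} {a : A} xs {ys} → xs ++ a ∷ ys ⊆ a ∷ xs ++ ys
shift-⊆ xs m with ∈-++⁻ xs m
... | inj₁ q           = there (∈-++⁺ˡ q)
... | inj₂ (here refl) = here refl
... | inj₂ (there q)   = there (∈-++⁺ʳ xs q)

unshift-⊆ : ∀ {A : Set} {a : A} xs {ys} → a ∷ xs ++ ys ⊆ xs ++ a ∷ ys
unshift-⊆ xs (here refl) = ∈-++⁺ʳ xs (here refl)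
unshift-⊆ xs (there m) with ∈-++⁻ xs m
... | inj₁ q = ∈-++⁺ˡ q
... | inj₂ q = ∈-++⁺ʳ xs (there q)

-- Eliminating the elements one after the other: P L j says that j has a predecessor
-- in L, and P (a ∷ L) a together with P (a ∷ L) j yields P L j by transitivity.
module OrderingRefutation (m p : ℕ) {W : Set} {w : ℕ} (iso : W ↔ Fin w) (ψ : Formula W)
  (e : Ordvar m p → W) (e-injective : ∀ {a b} → e a ≡ e b → a ≡ b)
  (ψ∋ : ∀ {ls} → ls ∈ Ordering.formula m p → rename e ls ∈ ψ) where

  open Ordering m p
  open Refute iso ψ

  private
    C : Set
    C = Clause w

  X : Fin m → Fin m → W
  X i j = e (less i j)

  X-injective : ∀ {i j k l} → X i j ≡ X k l → i ≡ k × j ≡ l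
  X-injective q with e-injective q
  ... | refl = refl , refl

  P : List (Fin m) → Fin m → Lit W → Set
  P L j l = ∃[ i ] i ∈ L × l ≡ Pos (X i j)

  P-consistent : ∀ {L j} → Consistent (P L j)
  P-consistent u _ (_ , _ , ())

  data Pred⊑ (L : List (Fin m)) (j : Fin m) (D : C) : Set where
    mk : D ⊑ P L j → Pred⊑ L j D

  -- Cutting along the chain of `above` variables reassembles the wide clause. One clause for
  -- `start` and two for every later axiom give the cost; the chain clause, the axiom and the
  -- resolvent give the space.
  predecessor : ∀ {A s} j → 3 + length A ≤ s →
                Σ[ D ∈ C ] Pred⊑ (allFin m) j D × (A ⇝[ s , 3 + m * 2 ] D ∷ A)
  predecessor {A} {s} j A≤s = finish (<-weakInduction Chain first more (fromℕ m))
    where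
    Goal : Fin (suc m) → Lit W → Set
    Goal k l = l ≡ Pos (e (above j k)) ⊎ P (allFin m) j l
    Goal-consistent : ∀ {k} → Consistent (Goal k)
    Goal-consistent u _ (inj₂ (_ , _ , ()))
    Chain : Fin (suc m) → Set
    Chain k = Σ[ D ∈ C ] (∀ {l} → D has l → Goal k l) × (A ⇝[ s , 1 + toℕ k * 2 ] D ∷ A)
    first : Chain zero
    first = clause (rename e (start j)) , (λ {l} h → start⊆ (clause-⊑ _ {l} h)) ,
      axiom (ψ∋ (start∈ j)) (λ { u _ (here ()) ; u _ (there ()) }) (≤-trans (s≤s (m≤n+m _ 2)) A≤s)
      where
      start⊆ : ∀ {l} → l ∈ rename e (start j) → Goal zero l
      start⊆ (here refl) = inj₁ refl
    more : ∀ i → Chain (inject₁ i) → Chain (suc i)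
    more i (M , M⊑ , r) with cut-axiom {Goal (suc i)} {e (above j (inject₁ i))} {A = M ∷ A} {s}
      Goal-consistent (here refl) (ψ∋ (next∈ j i)) next-consistent (λ {l} h → M⊆ (M⊑ {l} h)) next⊆ A≤s
      where
      M⊆ : ∀ {l} → Goal (inject₁ i) l → l ≡ Pos (e (above j (inject₁ i))) ⊎ Goal (suc i) l
      M⊆ (inj₁ q) = inj₁ q
      M⊆ (inj₂ q) = inj₂ (inj₂ q)
      next⊆ : ∀ {l} → l ∈ rename e (next (j , i)) → l ≡ Neg (e (above j (inject₁ i))) ⊎ Goal (suc i) l
      next⊆ (here refl)                 = inj₁ refl
      next⊆ (there (here refl))         = inj₂ (inj₂ (i , ∈-allFin i , refl))
      next⊆ (there (there (here refl))) = inj₂ (inj₁ refl)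
      inject₁≢suc : inject₁ i ≢ suc i
      inject₁≢suc q = m≢1+m+n (toℕ i) (trans (trans (sym (Fin.toℕ-inject₁ i)) (cong toℕ q)) (cong suc (sym (+-identityʳ _))))
      next-consistent : Consistent (_∈ rename e (next (j , i)))
      next-consistent u (there (here refl)) (here q) with e-injective (cong proj₁ q)
      ... | ()
      next-consistent u (there (here refl)) (there (here ()))
      next-consistent u (there (here refl)) (there (there (here ())))
      next-consistent u (there (there (here refl))) (there (here ()))
      next-consistent u (there (there (here refl))) (there (there (here ())))
      next-consistent u (there (there (here refl))) (here q) with e-injective {above j (suc i)} {above j (inject₁ i)} (cong proj₁ q)
      ... | q′ = inject₁≢suc (sym (y-injective q′))
        where
        y-injective : ∀ {k k′} → _≡_ {A = V} (above j k) (above j k′) → k ≡ k′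
        y-injective refl = refl
    ... | D , D⊑ , r′ = D , (λ {l} → D⊑ {l}) ,
      ⇝-cost cost≡ (⇝-trans r (⇝-trans r′
        (⇝-forget (<⇒≤ A≤s) λ { (here refl) → here refl ; (there q) → there (there q) })))
      where
      cost≡ : 1 + toℕ (inject₁ i) * 2 + (2 + 0) ≡ 1 + (suc (toℕ i)) * 2
      cost≡ = trans (cong (λ t → 1 + t * 2 + 2) (Fin.toℕ-inject₁ i)) (+-comm (1 + toℕ i * 2) 2)
    finish : Chain (fromℕ m) → Σ[ D ∈ C ] Pred⊑ (allFin m) j D × (A ⇝[ s , 3 + m * 2 ] D ∷ A)
    finish (M , M⊑ , r) with cut-axiom {P (allFin m) j} {e (above j (fromℕ m))} {A = M ∷ A} {s}
      P-consistent (here refl) (ψ∋ (end∈ j)) (λ { u (here ()) _ ; u (there ()) _ }) (λ {l} → M⊑ {l})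
      (λ { (here refl) → inj₁ refl }) A≤s
    ... | D , D⊑ , r′ = D , mk (λ {l} → D⊑ {l}) ,
      ⇝-cost cost≡ (⇝-trans r (⇝-trans r′
        (⇝-forget (<⇒≤ A≤s) λ { (here refl) → here refl ; (there q) → there (there q) })))
      where
      cost≡ : 1 + toℕ (fromℕ m) * 2 + (2 + 0) ≡ 3 + m * 2
      cost≡ = trans (cong (λ t → 1 + t * 2 + 2) (Fin.toℕ-fromℕ m)) (+-comm (1 + m * 2) 2)

  predecessors : ∀ {s} J → 3 + length J ≤ s →
                 Σ[ A ∈ List C ] Pointwise (Pred⊑ (allFin m)) J A × ([] ⇝[ s , length J * (3 + m * 2) ] A)
  predecessors []      J≤s = [] , [] , ⇝-resp z≤n ≃-refl
  predecessors {s} (j ∷ J) J≤s = cons (predecessors J (<⇒≤ J≤s))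
    where
    cons : Σ[ A ∈ List C ] Pointwise (Pred⊑ (allFin m)) J A × ([] ⇝[ s , length J * (3 + m * 2) ] A) →
           Σ[ A ∈ List C ] Pointwise (Pred⊑ (allFin m)) (j ∷ J) A × ([] ⇝[ s , (3 + m * 2) + length J * (3 + m * 2) ] A)
    cons (A , ps , r) = snoc (predecessor {A} j A≤s)
      where
      A≤s : 3 + length A ≤ s
      A≤s = ≤-trans (+-monoʳ-≤ 3 (≤-reflexive (sym (Pointwise.Pointwise-length ps)))) (<⇒≤ J≤s)
      snoc : Σ[ D ∈ C ] Pred⊑ (allFin m) j D × (A ⇝[ s , 3 + m * 2 ] D ∷ A) →
             Σ[ A ∈ List C ] Pointwise (Pred⊑ (allFin m)) (j ∷ J) A × ([] ⇝[ s , (3 + m * 2) + length J * (3 + m * 2) ] A)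
      snoc (D , q , r′) = D ∷ A , q ∷ ps , ⇝-cost (+-comm (length J * (3 + m * 2)) (3 + m * 2)) (⇝-trans r r′)

  module _ (a : Fin m) (L : List (Fin m)) (a∉L : a ∉ L) where

    private
      -- As long as `K` is left: some element of `K` precedes `a`, or `a` does not precede `j`, or
      -- some element of `L` precedes `j`. With `K` empty this is the implication from `a ≺ j` to
      -- `j` having a predecessor in `L`.
      Goal : Fin m → List (Fin m) → Lit W → Set
      Goal j K l = P K a l ⊎ (l ≡ Neg (X a j) ⊎ P L j l)

      Goal-consistent : ∀ {j K} → K ⊆ L → Consistent (Goal j K)
      Goal-consistent K⊆L u _ (inj₁ (_ , _ , ()))
      Goal-consistent K⊆L u _ (inj₂ (inj₂ (_ , _ , ())))
      Goal-consistent K⊆L u (inj₁ (i , i∈K , q)) (inj₂ (inj₁ q′))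
        with X-injective (trans (sym (cong proj₁ q)) (cong proj₁ q′))
      ... | refl , _ = a∉L (K⊆L i∈K)
      Goal-consistent K⊆L u (inj₂ (inj₂ (i , i∈L , q))) (inj₂ (inj₁ q′))
        with X-injective (trans (sym (cong proj₁ q)) (cong proj₁ q′))
      ... | refl , _ = a∉L i∈L

      -- This instance of transitivity is a tautology, and hence absent from the CNF, exactly if `a`
      -- is `i` or `j`; but these lie in `L` and `a` does not.
      transitive-consistent : ∀ {i j} → i ∈ L → j ∈ L → Consistent (_∈ rename e (transitive (i , a , j)))
      transitive-consistent i∈L j∈L u (there (there (here refl))) (here q) with X-injective (cong proj₁ q)
      ... | _ , refl = a∉L j∈L
      transitive-consistent i∈L j∈L u (there (there (here refl))) (there (here q)) with X-injective (cong proj₁ q)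
      ... | refl , _ = a∉L i∈L
      transitive-consistent i∈L j∈L u (there (there (here refl))) (there (there (here ())))

      transits : ∀ {A s j r} K → K ⊆ L → j ∈ L → 3 + length A ≤ s → (∀ {l} → r has l → Goal j K l) →
                 Σ[ D ∈ C ] (∀ {l} → D has l → Goal j [] l) × (r ∷ A ⇝[ s , length K * 2 ] D ∷ A)
      transits {r = r} [] K⊆L j∈L A≤s r⊑ = r , (λ {l} → r⊑ {l}) , ⇝-resp (≤-trans (m≤n+m _ 2) A≤s) ≃-refl
      transits {A} {s} {j} {r} (i ∷ K) K⊆L j∈L A≤s r⊑
        with cut-axiom {Goal j K} {X i a} {A = r ∷ A} (Goal-consistent (K⊆L ∘ there)) (here refl)
               (ψ∋ (transitive∈ i a j)) (transitive-consistent (K⊆L (here refl)) j∈L)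
               (λ {l} h → r⊆ (r⊑ {l} h)) t⊆ A≤s
        where
        r⊆ : ∀ {l} → Goal j (i ∷ K) l → l ≡ Pos (X i a) ⊎ Goal j K l
        r⊆ (inj₁ (_ , here refl , q)) = inj₁ q
        r⊆ (inj₁ (k , there k∈ , q))  = inj₂ (inj₁ (k , k∈ , q))
        r⊆ (inj₂ q)                   = inj₂ (inj₂ q)
        t⊆ : ∀ {l} → l ∈ rename e (transitive (i , a , j)) → l ≡ Neg (X i a) ⊎ Goal j K l
        t⊆ (here refl)                 = inj₁ refl
        t⊆ (there (here refl))         = inj₂ (inj₂ (inj₁ refl))
        t⊆ (there (there (here refl))) = inj₂ (inj₂ (inj₂ (i , K⊆L (here refl) , refl)))
      ... | r′ , r′⊑ , st with transits {A} {s} {j} {r′} K (K⊆L ∘ there) j∈L A≤s r′⊑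
      ...   | D , D⊑ , rest = D , (λ {l} → D⊑ {l}) ,
        ⇝-trans st (⇝-trans (⇝-forget (<⇒≤ A≤s) λ { (here refl) → here refl ; (there q) → there (there q) }) rest)

    -- A copy of `q`, free of charge because contents are compared as sets, is turned into the
    -- implication from `a ≺ j`; `D` is then cut with it on `a ≺ j`, while `q` remains for the other
    -- elements.
    bypass : ∀ {A s j q D} → j ∈ L → q ∈ A → Pred⊑ L a q → D ∈ A → Pred⊑ (a ∷ L) j D → 3 + length A ≤ s →
             Σ[ D′ ∈ C ] Pred⊑ L j D′ × (A ⇝[ s , 1 + length L * 2 ] D′ ∷ A)
    bypass {A} {s} {j} {q} {D} j∈L q∈A (mk q⊑) D∈A (mk D⊑) A≤s
      with transits {A} {s} {j} {q} L id j∈L A≤s (λ {l} h → inj₁ (q⊑ {l} h))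
    ... | r , r⊑ , st with cut {P L j} {X a j} {r ∷ A} {s} P-consistent (there D∈A) (here refl)
                             (λ {l} h → D⊆ (D⊑ {l} h)) (λ {l} h → r⊆ (r⊑ {l} h)) (<⇒≤ A≤s)
      where
      D⊆ : ∀ {l} → P (a ∷ L) j l → l ≡ Pos (X a j) ⊎ P L j l
      D⊆ (_ , here refl , h) = inj₁ h
      D⊆ (i , there i∈ , h)  = inj₂ (i , i∈ , h)
      r⊆ : ∀ {l} → Goal j [] l → l ≡ Neg (X a j) ⊎ P L j l
      r⊆ (inj₂ h) = h
    ...   | D′ , D′⊑ , st′ = D′ , mk (λ {l} → D′⊑ {l}) ,
      ⇝-cost (+-comm (length L * 2) 1)
        (⇝-trans (⇝-resp (≤-trans (m≤n+m _ 3) A≤s) (there , λ { (here refl) → q∈A ; (there h) → h }))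
          (⇝-trans st (⇝-trans st′ (⇝-forget (<⇒≤ A≤s) λ { (here refl) → here refl ; (there h) → there (there h) }))))

    -- Each old clause is dropped once its successor is there, so a whole round needs only constant
    -- extra space. Finished clauses are moved to `B`.
    bypasses : ∀ {s q} J {A B} → J ⊆ L → Pred⊑ L a q → q ∈ B → Pointwise (Pred⊑ (a ∷ L)) J A →
               3 + length (A ++ B) ≤ s →
               Σ[ A′ ∈ List C ] Pointwise (Pred⊑ L) J A′ × (A ++ B ⇝[ s , length J * (1 + length L * 2) ] A′ ++ B)
    bypasses [] J⊆L q⊑ q∈B [] B≤s = [] , [] , ⇝-resp (≤-trans (m≤n+m _ 3) B≤s) ≃-refl
    bypasses {s} {q} (j ∷ J) {D ∷ A} {B} J⊆L q⊑ q∈B (p ∷ ps) B≤s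
      with bypass {D ∷ A ++ B} (J⊆L (here refl)) (there (∈-++⁺ʳ A q∈B)) q⊑ (here refl) p B≤s
    ... | D′ , p′ , st with bypasses J {A} {D′ ∷ B} (J⊆L ∘ there) q⊑ (there q∈B) ps
                              (≤-trans (≤-reflexive (cong (3 +_) shift-length)) B≤s)
      where
      shift-length : length (A ++ D′ ∷ B) ≡ suc (length (A ++ B))
      shift-length = trans (length-++ A) (trans (+-suc (length A) (length B)) (cong suc (sym (length-++ A))))
    ...   | A′ , ps′ , st′ = D′ ∷ A′ , p′ ∷ ps′ ,
      ⇝-cost (cong (1 + length L * 2 +_) (+-identityʳ (length J * (1 + length L * 2))))
        (⇝-trans st (⇝-trans (⇝-forget (≤-trans (m≤n+m _ 2) B≤s) shuffle)
          (⇝-trans st′ (⇝-forget (≤-trans (≤-reflexive len′) (≤-trans (m≤n+m _ 3) B≤s)) (unshift-⊆ A′)))))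
      where
      shuffle : A ++ D′ ∷ B ⊆ D′ ∷ D ∷ A ++ B
      shuffle h with shift-⊆ A h
      ... | here refl = here refl
      ... | there h′  = there (there h′)
      len′ : length (A′ ++ D′ ∷ B) ≡ suc (length (A ++ B))
      len′ = trans (length-++ A′) (trans (+-suc (length A′) (length B))
        (cong suc (trans (cong (_+ length B) (trans (sym (Pointwise.Pointwise-length ps′)) (Pointwise.Pointwise-length ps)))
          (sym (length-++ A)))))

  round-cost : ℕ
  round-cost = 2 + m * (1 + m * 2)

  -- Irreflexivity removes `a` from its own clause; the result lets all other elements bypass `a`,
  -- and for empty `L` it is the empty clause. A round derives quadratically many clauses, so all
  -- rounds together stay cubic in `m`.
  eliminate : ∀ {s} a L {A} → Unique (a ∷ L) → length L ≤ m → Pointwise (Pred⊑ (a ∷ L)) (a ∷ L) A →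
              4 + length L ≤ s → A ⇝[ s , suc (length L) * round-cost ] [ emptyClause ]
  eliminate {s} a L {D ∷ A} u@(_ ∷ uL) L≤m (mk D⊑ ∷ ps) L≤s
    with cut-axiom {P L a} {X a a} {A = D ∷ A} {s} P-consistent (here refl) (ψ∋ (irrefl∈ a))
           (λ { w (here ()) _ ; w (there ()) _ }) (λ {l} h → D⊆ (D⊑ {l} h)) (λ { (here refl) → inj₁ refl }) A≤s
    where
    D⊆ : ∀ {l} → P (a ∷ L) a l → l ≡ Pos (X a a) ⊎ P L a l
    D⊆ (_ , here refl , h) = inj₁ h
    D⊆ (i , there i∈ , h)  = inj₂ (i , i∈ , h)
    A≤s : 3 + length A ≤ s
    A≤s = ≤-trans (+-monoʳ-≤ 3 (≤-reflexive (sym (Pointwise.Pointwise-length ps)))) (<⇒≤ L≤s)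
  eliminate {s} a [] {D ∷ []} u L≤m (mk D⊑ ∷ []) L≤s | q , q⊑ , st with ⊑⊥⇒empty {q} (λ {l} h → none (q⊑ {l} h))
    where
    none : ∀ {l} → P [] a l → ⊥
    none (_ , () , _)
  ... | refl = ⇝-cost-≤ {ℓ = 2} (s≤s (s≤s z≤n))
    (⇝-trans st (⇝-forget (≤-trans (m≤n+m 2 2) L≤s) λ { (here refl) → here refl }))
  eliminate {s} a L@(b ∷ L′) {D ∷ A} u@(_ ∷ uL) L≤m (mk D⊑ ∷ ps) L≤s | q , q⊑ , st
    with bypasses a L (Unique[x∷xs]⇒x∉xs u) L {A} {[ q ]} id (mk (λ {l} → q⊑ {l})) (here refl) ps
           (≤-trans (≤-reflexive (cong (3 +_) A+1)) L≤s)
    where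
    A+1 : length (A ++ [ q ]) ≡ suc (length L)
    A+1 = trans (length-++ A) (trans (+-comm _ 1) (cong suc (sym (Pointwise.Pointwise-length ps))))
  ... | A′ , ps′ , st′ = ⇝-cost-≤ cost≤
    (⇝-trans st (⇝-trans (⇝-forget D≤s shuffle) (⇝-trans st′ (⇝-trans (⇝-forget A′≤s ∈-++⁺ˡ)
      (eliminate b L′ uL (<⇒≤ L≤m) ps′ (<⇒≤ L≤s))))))
    where
    D≤s : 2 + length A ≤ s
    D≤s = ≤-trans (s≤s (s≤s (≤-reflexive (sym (Pointwise.Pointwise-length ps))))) (≤-trans (m≤n+m _ 2) L≤s)
    shuffle : A ++ [ q ] ⊆ q ∷ D ∷ A
    shuffle h with ∈-++⁻ A h
    ... | inj₁ h′          = there (there h′)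
    ... | inj₂ (here refl) = here refl
    A′≤s : length (A′ ++ [ q ]) ≤ s
    A′≤s = ≤-trans (≤-reflexive (trans (length-++ A′) (trans (+-comm _ 1) (cong suc (sym (Pointwise.Pointwise-length ps′))))))
             (≤-trans (m≤n+m _ 3) L≤s)
    cost≤ : 2 + (0 + (length L * (1 + length L * 2) + (0 + length L * round-cost))) ≤ round-cost + length L * round-cost
    cost≤ = ≤-trans (≤-reflexive (sym (+-assoc 2 (length L * (1 + length L * 2)) _)))
      (+-monoˡ-≤ (length L * round-cost) (+-monoʳ-≤ 2 (*-mono-≤ L≤m (s≤s (*-monoˡ-≤ 2 L≤m)))))

  refutes : ∀ a L → allFin m ≡ a ∷ L →
            Σ[ π ∈ Refutation (cnf ψ) ] (Sp π ≤ 4 + m) × (Len π ≤ m * (3 + m * 2) + m * round-cost)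
  refutes a L all≡ = finish (predecessors (allFin m) (m≤n⇒m≤1+n (≤-reflexive (cong (3 +_) all-length))))
    where
    all-length : length (allFin m) ≡ m
    all-length = length-tabulate {n = m} id
    L-length : suc (length L) ≡ m
    L-length = trans (cong length (sym all≡)) all-length
    finish : Σ[ A ∈ List C ] Pointwise (Pred⊑ (allFin m)) (allFin m) A × ([] ⇝[ 4 + m , length (allFin m) * (3 + m * 2) ] A) →
             Σ[ π ∈ Refutation (cnf ψ) ] (Sp π ≤ 4 + m) × (Len π ≤ m * (3 + m * 2) + m * round-cost)
    finish (A , ps , r) = refutation (⇝-trans
      (⇝-cost (cong (_* (3 + m * 2)) all-length) r)
      (⇝-cost (cong (_* round-cost) L-length)
        (eliminate a L (subst Unique all≡ (allFin⁺ m)) L≤m (subst (λ K → Pointwise (Pred⊑ K) K A) all≡ ps) L≤s)))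
      where
      L≤m : length L ≤ m
      L≤m = <⇒≤ (≤-reflexive L-length)
      L≤s : 4 + length L ≤ 4 + m
      L≤s = +-monoʳ-≤ 4 L≤m

-- Adversaries for the ordering principle and its substitution.

-- An adversary defending φ as long as fewer than r variables are to be remembered:
-- Safe A U means that the assignment A falsifies no clause of φ whose variables are
-- fixed or listed in U.
record Game {V : Set} (φ : Formula V) (r : ℕ) : Set₁ where
  field
    State   : Set
    val     : State → V → Bool
    Safe    : State → List V → Set
    Fixed   : V → Set
    fixed   : ∀ {u} → Fixed u → ∀ A B → val A u ≡ val B u
    initial : State
    safe-[] : Safe initial []
    shrink  : ∀ {A U U′} → U′ ⊆ U → Safe A U → Safe A U′
    extend  : ∀ {A U} → Safe A U → length U < r → ∀ u →
              Σ[ B ∈ State ] Safe B (u ∷ U) × (∀ {w} → w ∈ U → val B w ≡ val A w)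
    sound   : ∀ {A U ls} → ls ∈ φ → Safe A U → (∀ {l} → l ∈ ls → Fixed (proj₁ l) ⊎ proj₁ l ∈ U) →
              ∃[ u ] (u , val A u) ∈ ls

module OrderingGame (m p : ℕ) where

  open Ordering (suc m) p

  private
    M : Set
    M = Fin (suc m)

  -- The ranks describe a linear preorder whose only possible minimum is `bad`.
  record Preorder : Set where
    field
      rank  : M → ℕ
      wit   : M → M
      bad   : M
      below : ∀ j → j ≢ bad → rank (wit j) < rank j

  open Preorder

  -- The value of `above j` depends on one chosen witness and not on all predecessors. Otherwise a
  -- new element at the bottom, being a predecessor of everything else, could change values that
  -- have to be remembered.
  truth : Preorder → V → Bool
  truth A (less i j) = ⌊ rank A i <? rank A j ⌋
  truth A (above j k) = ⌊ toℕ k ≤? toℕ (wit A j) ⌋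
  truth A (dummy a)   = true

  touches : V → List M
  touches (less i j) = i ∷ j ∷ []
  touches (above j k) = j ∷ []
  touches (dummy a)   = []

  SafeOrder : Preorder → List V → Set
  SafeOrder A U = ∀ {u} → u ∈ U → bad A ∉ touches u

  -- Only the old `bad` gets a new witness, namely `b`. The other witnesses remain valid: all ranks
  -- but that of `b` shift alike, and that of `b` drops in comparison.
  lower : Preorder → M → Preorder
  lower A b = record
    { rank  = rank′
    ; wit   = wit′
    ; bad   = b
    ; below = below′
    }
    where
    rank′ : M → ℕ
    rank′ i = if does (i Fin.≟ b) then 0 else suc (rank A i)
    wit′ : M → M
    wit′ j = if does (j Fin.≟ bad A) then b else wit A j
    rank′-b : rank′ b ≡ 0
    rank′-b rewrite dec-true (b Fin.≟ b) refl = refl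
    rank′-≤ : ∀ i → rank′ i ≤ suc (rank A i)
    rank′-≤ i with i Fin.≟ b
    ... | yes _ = z≤n
    ... | no _  = ≤-refl
    below′ : ∀ j → j ≢ b → rank′ (wit′ j) < rank′ j
    below′ j j≢b rewrite dec-false (j Fin.≟ b) j≢b with j Fin.≟ bad A
    ... | yes _ = ≤-trans (s≤s (≤-reflexive rank′-b)) (s≤s z≤n)
    ... | no j≢ = s≤s (≤-trans (rank′-≤ (wit A j)) (below A j j≢))

  lower-agrees : ∀ A b u → bad A ∉ touches u → b ∉ touches u → truth (lower A b) u ≡ truth A u
  lower-agrees A b (less i j) _ b∉
    rewrite dec-false (i Fin.≟ b) (λ { refl → b∉ (here refl) }) | dec-false (j Fin.≟ b) (λ { refl → b∉ (there (here refl)) })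
    with rank A i <? rank A j | suc (rank A i) <? suc (rank A j)
  ... | yes _ | yes _ = refl
  ... | no _  | no _  = refl
  ... | yes h | no n  = contradiction (s≤s h) n
  ... | no n  | yes (s≤s h) = contradiction h n
  lower-agrees A b (above j k) bad∉ _ rewrite dec-false (j Fin.≟ bad A) (λ { refl → bad∉ (here refl) }) = refl
  lower-agrees A b (dummy a) _ _ = refl

  fresh : ∀ (T : List M) → length T < suc m → ∃[ b ] b ∉ T
  fresh T T<m with Fin.any? (λ b → b ∉? T)
    where open import Data.List.Membership.DecPropositional (Fin._≟_ {suc m}) using (_∉?_)
  ... | yes q = q
  ... | no ¬q = contradiction (≤-trans (≤-reflexive (sym (length-tabulate {n = suc m} id))) (length-⊆ (allFin⁺ (suc m)) all)) (<⇒≱ T<m)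
    where
    open import Data.List.Membership.DecPropositional (Fin._≟_ {suc m}) using (_∈?_)
    all : allFin (suc m) ⊆ T
    all {b} _ with b ∈? T
    ... | yes q = q
    ... | no ∉T = contradiction (b , ∉T) ¬q

  length-touches : ∀ U → length (concatMap touches U) ≤ length U * 2
  length-touches []      = z≤n
  length-touches (u ∷ U) = begin
    length (touches u ++ concatMap touches U)         ≡⟨ length-++ (touches u) ⟩
    length (touches u) + length (concatMap touches U) ≤⟨ +-mono-≤ (two u) (length-touches U) ⟩
    2 + length U * 2                                  ∎
    where
    open ≤-Reasoning
    two : ∀ u → length (touches u) ≤ 2
    two (less _ _) = ≤-refl
    two (above _ _) = s≤s z≤n
    two (dummy _)   = z≤n

  -- A variable touches at most two elements, so `r` variables always leave one that can become the
  -- new `bad`.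
  ordering-game : ∀ {r} → r * 2 < suc m → Game formula r
  ordering-game {r} r<m = record
    { State   = Preorder
    ; val     = truth
    ; Safe    = SafeOrder
    ; Fixed   = λ _ → ⊥
    ; fixed   = λ ()
    ; initial = record
      { rank  = λ i → toℕ i
      ; wit   = λ _ → zero
      ; bad   = zero
      ; below = λ { zero z≢z → contradiction refl z≢z ; (suc j) _ → s≤s z≤n }
      }
    ; safe-[] = λ ()
    ; shrink  = λ U′⊆U safe q → safe (U′⊆U q)
    ; extend  = extend
    ; sound   = λ {A} {U} {ls} p safe cover → All.lookup (sound A U safe) p (cover′ cover)
    }
    where
    cover′ : ∀ {U ls} → (∀ {l : Lit V} → l ∈ ls → ⊥ ⊎ proj₁ l ∈ U) → ∀ {l} → l ∈ ls → proj₁ l ∈ U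
    cover′ cover q with cover q
    ... | inj₂ h = h
    extend : ∀ {A U} → SafeOrder A U → length U < r → ∀ u →
             Σ[ B ∈ Preorder ] SafeOrder B (u ∷ U) × (∀ {w} → w ∈ U → truth B w ≡ truth A w)
    extend {A} {U} safe U<r u with fresh (concatMap touches (u ∷ U))
      (≤-trans (s≤s (≤-trans (length-touches (u ∷ U)) (*-monoˡ-≤ 2 U<r))) r<m)
    ... | b , b∉ = lower A b , safe′ , λ {w} w∈U → lower-agrees A b w (safe w∈U) (safe′ (there w∈U))
      where
      safe′ : SafeOrder (lower A b) (u ∷ U)
      safe′ w∈ b∈ = b∉ (∈-concatMap⁺ touches {xs = u ∷ U} (lose w∈ b∈))
    true-lit : ∀ {P : Set} (d : Dec P) → P → ⌊ d ⌋ ≡ true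
    true-lit (yes _) _ = refl
    true-lit (no ¬p) q = contradiction q ¬p
    false-lit : ∀ {P : Set} (d : Dec P) → ¬ P → ⌊ d ⌋ ≡ false
    false-lit (yes p) ¬q = contradiction p ¬q
    false-lit (no _)  _  = refl
    holds : ∀ {A ls u b} → truth A u ≡ b → (u , b) ∈ ls → ∃[ w ] (w , truth A w) ∈ ls
    holds {u = u} refl q = u , q
    sound : ∀ A U → SafeOrder A U → All (λ ls → (∀ {l} → l ∈ ls → proj₁ l ∈ U) → ∃[ u ] (u , truth A u) ∈ ls) formula
    sound A U safe = all-formula
      (λ i _ → holds {A} {u = less i i} (false-lit (rank A i <? rank A i) (<-irrefl refl)) (here refl))
      (λ { (i , j , k) _ → trans-sound i j k })
      (λ j _ → holds {A} {u = above j zero} refl (here refl))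
      (λ { (j , i) cover → next-sound j i λ { refl → safe (cover (here refl)) (here refl) } })
      (λ j _ → holds {A} {u = above j (fromℕ _)} (false-lit (toℕ (fromℕ (suc m)) ≤? toℕ (wit A j))
         (λ h → <⇒≱ (Fin.toℕ<n (wit A j)) (≤-trans (≤-reflexive (sym (Fin.toℕ-fromℕ (suc m)))) h))) (here refl))
      (λ a _ → holds {A} {u = dummy a} refl (here refl))
      where
      trans-sound : ∀ i j k → ∃[ u ] (u , truth A u) ∈ transitive (i , j , k)
      trans-sound i j k with rank A i <? rank A j | rank A j <? rank A k
      ... | no h  | _     = holds {A} {u = less i j} (false-lit (rank A i <? rank A j) h) (here refl)
      ... | yes _ | no h  = holds {A} {u = less j k} (false-lit (rank A j <? rank A k) h) (there (here refl))
      ... | yes g | yes h = holds {A} {u = less i k} (true-lit (rank A i <? rank A k) (<-trans g h)) (there (there (here refl)))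
      next-sound : ∀ j i → j ≢ bad A → ∃[ u ] (u , truth A u) ∈ next (j , i)
      next-sound j i j≢bad with toℕ (inject₁ i) ≤? toℕ (wit A j) | toℕ (suc i) ≤? toℕ (wit A j)
      ... | no h  | _     = holds {A} {u = above j (inject₁ i)} (false-lit (toℕ (inject₁ i) ≤? toℕ (wit A j)) h) (here refl)
      ... | yes _ | yes h = holds {A} {u = above j (suc i)} (true-lit (toℕ (suc i) ≤? toℕ (wit A j)) h) (there (there (here refl)))
      ... | yes g | no h  = holds {A} {u = less i j}
        (true-lit (rank A i <? rank A j) (subst (λ k → rank A k < rank A j) wit≡i (below A j j≢bad))) (there (here refl))
        where
        wit≡i : wit A j ≡ i
        wit≡i = Fin.toℕ-injective (≤-antisym (≤-pred (≰⇒> h)) (subst (_≤ _) (Fin.toℕ-inject₁ i) g))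

module XorGame {V : Set} (ρ : V → Bool × Bool) where

  -- ρ u = (c , s) fixes the variable (u , c) to s, which leaves the other half of u to decide the value of u.
  restricted : (V → Bool) → V × Bool → Bool
  restricted α (u , b) = if does (b Bool.≟ proj₁ (ρ u)) then proj₂ (ρ u) else proj₂ (ρ u) xor α u

  private
    restricted-xor : ∀ α u → restricted α (u , false) xor restricted α (u , true) ≡ α u
    restricted-xor α u with ρ u
    ... | false , false = refl
    ... | false , true  = Bool.not-involutive (α u)
    ... | true  , false = Bool.xor-identityʳ (α u)
    ... | true  , true  = trans (Bool.xor-comm (not (α u)) true) (Bool.not-involutive (α u))

    both-halves : ∀ ls {ks} {u : V} {s} → ks ∈ xor-clause ls → (u , s) ∈ ls →
                  ∃[ a ] ((u , false) , not a) ∈ ks × ((u , true) , not (a xor not s)) ∈ ks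
    both-halves (l ∷ ls) {ks} {u} {s} ks∈ q = [ half true q , half false q ]′ (∈-++⁻ (map (excluding l true) (xor-clause ls)) ks∈)
      where
      half : ∀ a → (u , s) ∈ l ∷ ls → ks ∈ map (excluding l a) (xor-clause ls) →
             ∃[ a ] ((u , false) , not a) ∈ ks × ((u , true) , not (a xor not s)) ∈ ks
      half a q h with ∈-map⁻ (excluding l a) h | q
      ... | ks′ , ks′∈ , refl | here refl = a , here refl , there (here refl)
      ... | ks′ , ks′∈ , refl | there q′ with both-halves ls ks′∈ q′
      ...   | a′ , h₀ , h₁ = a′ , there (there h₀) , there (there h₁)

    -- If the first equation fails, then `b` is `a`, and `a xor not (a xor c)` is `not c`. So a true
    -- literal on `u` makes one of the two literals that replace it in a clause true.
    some-half : ∀ a b c → (b ≡ not a) ⊎ (c ≡ not (a xor not (b xor c)))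
    some-half true  false c     = inj₁ refl
    some-half false true  c     = inj₁ refl
    some-half true  true  true  = inj₂ refl
    some-half true  true  false = inj₂ refl
    some-half false false true  = inj₂ refl
    some-half false false false = inj₂ refl

  restricted-fixed : ∀ α u {b} → b ≡ proj₁ (ρ u) → restricted α (u , b) ≡ proj₂ (ρ u)
  restricted-fixed α u {b} e rewrite dec-true (b Bool.≟ proj₁ (ρ u)) e = refl

  -- The fixed half is determined by `ρ` and the other one by the value of `u`, so a remembered half
  -- costs one remembered variable of `G`, and `r` is preserved. A clause contains both halves of
  -- each of its variables, so covering its free halves covers the original clause.
  xor-game : ∀ {φ r} → Game φ r → Game (xor-formula φ) r
  xor-game {φ} {r} G = record
    { State   = State
    ; val     = λ A → restricted (val A)
    ; Safe    = λ A U → Safe A (map proj₁ U)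
    ; Fixed   = λ (u , b) → b ≡ proj₁ (ρ u)
    ; fixed   = fixed′
    ; initial = initial
    ; safe-[] = safe-[]
    ; shrink  = λ U′⊆U → shrink (⊆.map⁺ proj₁ U′⊆U)
    ; extend  = extend′
    ; sound   = sound′
    }
    where
    open Game G
    fixed′ : ∀ {w} → proj₂ w ≡ proj₁ (ρ (proj₁ w)) → ∀ A B → restricted (val A) w ≡ restricted (val B) w
    fixed′ {u , b} e A B = trans (restricted-fixed (val A) u e) (sym (restricted-fixed (val B) u e))
    extend′ : ∀ {A U} → Safe A (map proj₁ U) → length U < r → ∀ w →
              Σ[ B ∈ State ] Safe B (map proj₁ (w ∷ U)) × (∀ {w} → w ∈ U → restricted (val B) w ≡ restricted (val A) w)
    extend′ {A} {U} safe U<r (u , b) with extend safe (≤-trans (s≤s (≤-reflexive (length-map proj₁ U))) U<r) u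
    ... | B , safe′ , agree = B , safe′ , agree′
      where
      agree′ : ∀ {w} → w ∈ U → restricted (val B) w ≡ restricted (val A) w
      agree′ {u , b} q = cong (λ t → if does (b Bool.≟ proj₁ (ρ u)) then proj₂ (ρ u) else proj₂ (ρ u) xor t) (agree (∈-map⁺ proj₁ q))
    free-half : ∀ c {P : Bool → Set} → (∀ b → b ≡ c ⊎ P b) → ∃[ b ] P b
    free-half true  h with h false
    ... | inj₂ p = false , p
    free-half false h with h true
    ... | inj₂ p = true , p
    sound′ : ∀ {A U ks} → ks ∈ xor-formula φ → Safe A (map proj₁ U) →
             (∀ {l} → l ∈ ks → (proj₂ (proj₁ l) ≡ proj₁ (ρ (proj₁ (proj₁ l)))) ⊎ proj₁ l ∈ U) →
             ∃[ w ] (w , restricted (val A) w) ∈ ks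
    sound′ {A} {U} {ks} p safe cover with find (∈-concatMap⁻ xor-clause {xs = φ} p)
    ... | ls , ls∈φ , ks∈ with sound ls∈φ safe (λ q → inj₂ (cover′ q))
      where
      cover′ : ∀ {l} → l ∈ ls → proj₁ l ∈ map proj₁ U
      cover′ {u , s} q with both-halves ls ks∈ q
      ... | a , h₀ , h₁ with free-half (proj₁ (ρ u)) {λ b → (u , b) ∈ U} (λ { false → cover h₀ ; true → cover h₁ })
      ...   | b , r = ∈-map⁺ proj₁ r
    ...   | u , q with both-halves ls ks∈ q
    ...     | a , h₀ , h₁ with some-half a (restricted (val A) (u , false)) (restricted (val A) (u , true))
    ...       | inj₁ e = (u , false) , subst (λ b → ((u , false) , b) ∈ ks) (sym e) h₀
    ...       | inj₂ e = (u , true) , subst (λ b → ((u , true) , b) ∈ ks)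
      (sym (trans e (cong (λ t → not (a xor not t)) (restricted-xor (val A) u)))) h₁

-- Conjunctions in disjoint variables.

lefts : ∀ {V W : Set} → List (V ⊎ W) → List V
lefts []           = []
lefts (inj₁ u ∷ U) = u ∷ lefts U
lefts (inj₂ _ ∷ U) = lefts U

rights : ∀ {V W : Set} → List (V ⊎ W) → List W
rights []           = []
rights (inj₁ _ ∷ U) = rights U
rights (inj₂ w ∷ U) = w ∷ rights U

module _ {V W : Set} where

  ∈-lefts⁺ : ∀ {u : V} {U : List (V ⊎ W)} → inj₁ u ∈ U → u ∈ lefts U
  ∈-lefts⁺ (here refl)               = here refl
  ∈-lefts⁺ {U = inj₁ _ ∷ _} (there q) = there (∈-lefts⁺ q)
  ∈-lefts⁺ {U = inj₂ _ ∷ _} (there q) = ∈-lefts⁺ q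

  ∈-lefts⁻ : ∀ {u : V} (U : List (V ⊎ W)) → u ∈ lefts U → inj₁ u ∈ U
  ∈-lefts⁻ (inj₁ _ ∷ U) (here refl) = here refl
  ∈-lefts⁻ (inj₁ _ ∷ U) (there q)   = there (∈-lefts⁻ U q)
  ∈-lefts⁻ (inj₂ _ ∷ U) q           = there (∈-lefts⁻ U q)

  ∈-rights⁺ : ∀ {w : W} {U : List (V ⊎ W)} → inj₂ w ∈ U → w ∈ rights U
  ∈-rights⁺ (here refl)               = here refl
  ∈-rights⁺ {U = inj₁ _ ∷ _} (there q) = ∈-rights⁺ q
  ∈-rights⁺ {U = inj₂ _ ∷ _} (there q) = there (∈-rights⁺ q)

  ∈-rights⁻ : ∀ {w : W} (U : List (V ⊎ W)) → w ∈ rights U → inj₂ w ∈ U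
  ∈-rights⁻ (inj₁ _ ∷ U) q           = there (∈-rights⁻ U q)
  ∈-rights⁻ (inj₂ _ ∷ U) (here refl) = here refl
  ∈-rights⁻ (inj₂ _ ∷ U) (there q)   = there (∈-rights⁻ U q)

  lefts-length : ∀ (U : List (V ⊎ W)) → length (lefts U) ≤ length U
  lefts-length []           = z≤n
  lefts-length (inj₁ _ ∷ U) = s≤s (lefts-length U)
  lefts-length (inj₂ _ ∷ U) = m≤n⇒m≤1+n (lefts-length U)

  rights-length : ∀ (U : List (V ⊎ W)) → length (rights U) ≤ length U
  rights-length []           = z≤n
  rights-length (inj₁ _ ∷ U) = m≤n⇒m≤1+n (rights-length U)
  rights-length (inj₂ _ ∷ U) = s≤s (rights-length U)

_⊕_ : ∀ {V W : Set} → Formula V → Formula W → Formula (V ⊎ W)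
φ ⊕ ψ = map (rename inj₁) φ ++ map (rename inj₂) ψ

module SumGame {V W : Set} {φ : Formula V} {ψ : Formula W} {r : ℕ} (G : Game φ r) (H : Game ψ r) where

  private
    module G = Game G
    module H = Game H

    value : G.State × H.State → V ⊎ W → Bool
    value (A , B) = [ G.val A , H.val B ]′

    SafeBoth : G.State × H.State → List (V ⊎ W) → Set
    SafeBoth (A , B) U = G.Safe A (lefts U) × H.Safe B (rights U)

    FixedEither : V ⊎ W → Set
    FixedEither = [ G.Fixed , H.Fixed ]′

    extend : ∀ {S U} → SafeBoth S U → length U < r → ∀ u →
             Σ[ T ∈ G.State × H.State ] SafeBoth T (u ∷ U) × (∀ {w} → w ∈ U → value T w ≡ value S w)
    extend {A , B} {U} (safe , safe′) U<r (inj₁ u) with G.extend safe (≤-trans (s≤s (lefts-length U)) U<r) u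
    ... | A′ , s , agree = (A′ , B) , (s , safe′) , λ { {inj₁ w} q → agree (∈-lefts⁺ q) ; {inj₂ w} q → refl }
    extend {A , B} {U} (safe , safe′) U<r (inj₂ u) with H.extend safe′ (≤-trans (s≤s (rights-length U)) U<r) u
    ... | B′ , s , agree = (A , B′) , (safe , s) , λ { {inj₁ w} q → refl ; {inj₂ w} q → agree (∈-rights⁺ q) }

    sound : ∀ {S U ls} → ls ∈ φ ⊕ ψ → SafeBoth S U → (∀ {l} → l ∈ ls → FixedEither (proj₁ l) ⊎ proj₁ l ∈ U) →
            ∃[ u ] (u , value S u) ∈ ls
    sound {A , B} {U} p (safe , safe′) cover with ∈-++⁻ (map (rename inj₁) φ) p
    ... | inj₁ q with ∈-map⁻ (rename inj₁) q
    ...   | ks , ks∈ , refl with G.sound ks∈ safe (λ h → Sum.map₂ ∈-lefts⁺ (cover (∈-map⁺ (map₁ inj₁) h)))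
    ...     | u , h = inj₁ u , ∈-map⁺ (map₁ inj₁) h
    sound {A , B} {U} p (safe , safe′) cover | inj₂ q with ∈-map⁻ (rename inj₂) q
    ...   | ks , ks∈ , refl with H.sound ks∈ safe′ (λ h → Sum.map₂ ∈-rights⁺ (cover (∈-map⁺ (map₁ inj₂) h)))
    ...     | u , h = inj₂ u , ∈-map⁺ (map₁ inj₂) h

  ⊕-game : Game (φ ⊕ ψ) r
  ⊕-game = record
    { State   = G.State × H.State
    ; val     = value
    ; Safe    = SafeBoth
    ; Fixed   = FixedEither
    ; fixed   = λ { {inj₁ u} f (A , _) (B , _) → G.fixed f A B ; {inj₂ w} f (_ , A) (_ , B) → H.fixed f A B }
    ; initial = G.initial , H.initial
    ; safe-[] = G.safe-[] , H.safe-[]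
    ; shrink  = λ {_} {U} {U′} sub (s , s′) →
        G.shrink (λ q → ∈-lefts⁺ (sub (∈-lefts⁻ U′ q))) s , H.shrink (λ q → ∈-rights⁺ (sub (∈-rights⁻ U′ q))) s′
    ; extend  = extend
    ; sound   = sound
    }

game-mono : ∀ {V : Set} {φ : Formula V} {r r′} → r′ ≤ r → Game φ r → Game φ r′
game-mono r′≤r G = record
  { State   = State
  ; val     = val
  ; Safe    = Safe
  ; Fixed   = Fixed
  ; fixed   = fixed
  ; initial = initial
  ; safe-[] = safe-[]
  ; shrink  = shrink
  ; extend  = λ safe U<r′ → extend safe (≤-trans U<r′ r′≤r)
  ; sound   = sound
  }
  where open Game G

-- Space and width lower bounds from games.

-- Small space keeps the clauses of the part χ simultaneously satisfied by a safe assignment with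
-- one remembered variable per clause; the other clauses are controlled one by one through `Inv`.
module SpaceStrategy {V W : Set} {v : ℕ} (iso : V ↔ Fin v) (Φ : Formula V)
  (ι : W → V) (ι-injective : ∀ {a b} → ι a ≡ ι b → a ≡ b)
  {χ : Formula W} {r : ℕ} (G : Game χ r) (k : ℕ) (χ-width : All (λ ls → length ls ≤ k) χ)
  (Inv Fine : Clause v → Set)
  (axioms : ∀ {ls} → ls ∈ Φ → Consistent (_∈ ls) →
            (∃[ ks ] ks ∈ χ × ls ≡ rename ι ks) ⊎ Inv (Encoding.clause iso ls))
  (Inv-infer : ∀ {P N D} → Inv P → Inv N → Encoding.Cuts iso P N D → Fine D → Inv D)
  (Inv-apart : ∀ {D w b} → Inv D → Encoding._has_ iso D (ι w , b) → ⊥)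
  (Inv-empty : ¬ Inv emptyClause)
  where

  open Refute iso Φ
  open Game G

  Only : Clause v → Set
  Only D = ∀ {l} → D has l → ∃[ w ] proj₁ l ≡ ι w

  Sat : State → List W → Clause v → Set
  Sat A U D = ∃[ w ] w ∈ U × D has (ι w , val A w)

  Defended : State → List W → List (Clause v) → Set
  Defended A U Ds = ∀ {D} → D ∈ Ds → (Only D × Sat A U D) ⊎ Inv D

  Position : List (Clause v) → Set
  Position Ds = Σ[ A ∈ State ] ∃[ U ] Safe A U × Defended A U Ds

  -- One witness per clause is enough, which turns the bound on space into a bound on remembered
  -- variables. This is applied before each download of an axiom of `χ` to make room for its
  -- variables.
  compress : ∀ {A U} Ds → Defended A U Ds → ∃[ U′ ] (U′ ⊆ U) × length U′ ≤ length Ds × Defended A U′ Ds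
  compress [] def = [] , (λ ()) , z≤n , λ ()
  compress {A} {U} (D ∷ Ds) def with compress Ds (def ∘ there) | def (here refl)
  ... | U′ , U′⊆U , len , def′ | inj₂ inv = U′ , U′⊆U , m≤n⇒m≤1+n len ,
    λ { (here refl) → inj₂ inv ; (there q) → def′ q }
  ... | U′ , U′⊆U , len , def′ | inj₁ (only , w , w∈U , h) = w ∷ U′ ,
    (λ { (here refl) → w∈U ; (there q) → U′⊆U q }) , s≤s len ,
    λ { (here refl) → inj₁ (only , w , here refl , h)
      ; (there q) → Sum.map₁ (λ { (o , w′ , w′∈ , h′) → o , w′ , there w′∈ , h′ }) (def′ q) }

  extends : ∀ ws {A U} → Safe A U → length ws + length U ≤ r →
            Σ[ B ∈ State ] Safe B (ws ++ U) × (∀ {w} → w ∈ U → val B w ≡ val A w)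
  extends [] safe le = _ , safe , λ _ → refl
  extends (w ∷ ws) {A} {U} safe le with extends ws safe (<⇒≤ le)
  ... | B , safe′ , agree with extend safe′ (≤-trans (s≤s (≤-reflexive (length-++ ws))) le) w
  ...   | B′ , safe″ , agree′ = B′ , safe″ , λ q → trans (agree′ (∈-++⁺ʳ ws q)) (agree q)

  -- Two premises satisfied by the same assignment cannot have the two opposite pivot literals as
  -- witnesses; so one witness survives in `D`, and no variable has to be added. Premises of
  -- different kinds share no variable that could be the pivot.
  infer-defended : ∀ {A U Ds P N D} → Defended A U Ds → P ∈ Ds → N ∈ Ds → Cuts P N D → Fine D →
                   (Only D × Sat A U D) ⊎ Inv D
  infer-defended {A} {U} {Ds} {P} {N} {D} def P∈ N∈ c fine with def P∈ | def N∈
  ... | inj₂ i | inj₂ j = inj₂ (Inv-infer i j c fine)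
  ... | inj₁ (only , _) | inj₂ j with only (Cuts.P-pivot c)
  ...   | w , e = ⊥-elim (Inv-apart j (subst (λ u → N has Neg u) e (Cuts.N-pivot c)))
  infer-defended {A} {U} {Ds} {P} {N} {D} def P∈ N∈ c fine | inj₂ i | inj₁ (only , _) with only (Cuts.N-pivot c)
  ...   | w , e = ⊥-elim (Inv-apart i (subst (λ u → P has Pos u) e (Cuts.P-pivot c)))
  infer-defended {A} {U} {Ds} {P} {N} {D} def P∈ N∈ c fine | inj₁ (onlyP , w , w∈ , h) | inj₁ (onlyN , w′ , w′∈ , h′) =
    inj₁ ((λ {l} q → [ onlyP {l} , onlyN {l} ]′ (Cuts.D-from c {l} q)) , sat)
    where
    sat : Sat A U D
    sat with (ι w , val A w) ≟ˡ Pos (Cuts.pivot c)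
    ... | no ≢  = w , w∈ , Cuts.P-rest c h ≢
    ... | yes e = w′ , w′∈ , Cuts.N-rest c h′ λ e′ → clash e e′
      where
      clash : (ι w , val A w) ≡ Pos (Cuts.pivot c) → (ι w′ , val A w′) ≡ Neg (Cuts.pivot c) → ⊥
      clash e e′ with ι-injective {w} {w′} (trans (cong proj₁ e) (sym (cong proj₁ e′)))
      ... | refl with trans (sym (cong proj₂ e)) (cong proj₂ e′)
      ...   | ()

  step-position : ∀ {a b} → Step (cnf Φ) a b → ∣ a ∣ˢ + k ≤ r → (∀ {D} → D ∈ elems b → Fine D) →
                  Position (elems a) → Position (elems b)
  step-position (erase p e) _ _ (A , U , safe , def) = A , U , safe , λ q → def (∈-─⁻ p (proj₁ (set⇒≃ e) q))
  step-position (infer {P} {N} {D} p n res e) _ fine (A , U , safe , def) = A , U , safe , λ q → new (proj₁ (set⇒≃ e) q)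
    where
    new : ∀ {E} → E ∈ D ∷ _ → (Only E × Sat A U E) ⊎ Inv E
    new (here refl) = infer-defended def p n (cuts res) (fine (proj₂ (set⇒≃ e) (here refl)))
    new (there q)   = def q
  step-position {a} (download {C} p e) a≤r _ (A , U , safe , def) with axiom⁻ Φ p
  ... | ls , ls∈Φ , con , refl with axioms ls∈Φ con
  ...   | inj₂ inv = A , U , safe , λ q → new (proj₁ (set⇒≃ e) q)
    where
    new : ∀ {E} → E ∈ clause ls ∷ elems a → (Only E × Sat A U E) ⊎ Inv E
    new (here refl) = inj₂ inv
    new (there q)   = def q
  ...   | inj₁ (ks , ks∈χ , refl) with compress (elems a) def
  ...     | U′ , U′⊆U , len , def′ with extends (map proj₁ ks) (shrink U′⊆U safe) U′≤r
    where
    U′≤r : length (map proj₁ ks) + length U′ ≤ r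
    U′≤r = begin
      length (map proj₁ ks) + length U′  ≡⟨ cong (_+ length U′) (length-map proj₁ ks) ⟩
      length ks + length U′              ≤⟨ +-mono-≤ (All.lookup χ-width ks∈χ) len ⟩
      k + ∣ a ∣ˢ                         ≡⟨ +-comm k _ ⟩
      ∣ a ∣ˢ + k                         ≤⟨ a≤r ⟩
      r                                  ∎
      where open ≤-Reasoning
  ...       | B , safe′ , agree with sound ks∈χ safe′ (λ q → inj₂ (∈-++⁺ˡ (∈-map⁺ proj₁ q)))
  ...         | w , lit = B , map proj₁ ks ++ U′ , safe′ , λ q → new (proj₁ (set⇒≃ e) q)
    where
    new : ∀ {E} → E ∈ clause (rename ι ks) ∷ elems a → (Only E × Sat B (map proj₁ ks ++ U′) E) ⊎ Inv E
    new (here refl) = inj₁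
      ( (λ {l} h → only (clause-⊑ (rename ι ks) {l} h))
      , w , ∈-++⁺ˡ (∈-map⁺ proj₁ lit) , clause-has (rename ι ks) con (∈-map⁺ (map₁ ι) lit) )
      where
      only : ∀ {l} → l ∈ rename ι ks → ∃[ w ] proj₁ l ≡ ι w
      only q with ∈-map⁻ (map₁ ι) q
      ... | (w , _) , _ , refl = w , refl
    new {E} (there q) with def′ q
    ... | inj₂ inv = inj₂ inv
    ... | inj₁ (only , w , w∈ , h) = inj₁ ((λ {l} → only {l}) , w , ∈-++⁺ʳ _ w∈ , subst (λ b → E has (ι w , b)) (sym (agree w∈)) h)

  run-position : ∀ {a b} (π : Star (Step (cnf Φ)) a b) → Configs (λ c → ∣ c ∣ˢ + k ≤ r) π →
                 Configs (λ c → ∀ {D} → D ∈ elems c → Fine D) π → Position (elems a) → Position (elems b)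
  run-position ε        _        _        pos = pos
  run-position (st ◅ π) (p ∷ ps) (_ ∷ qs) pos =
    run-position π ps qs (step-position st p (configs-source π qs) pos)

  no-refutation : (π : Refutation (cnf Φ)) → Sp π + k ≤ r → Configs (λ c → ∀ {D} → D ∈ elems c → Fine D) π → ⊥
  no-refutation π sp fine
    with run-position π (All.map (λ le → ≤-trans (+-monoˡ-≤ k le) sp) (≤-Sp π)) fine
                      (initial , [] , safe-[] , λ ())
  ... | A , U , safe , def with def (here refl)
  ...   | inj₂ inv = Inv-empty inv
  ...   | inj₁ (_ , w , _ , h) = empty-⊑ {λ _ → ⊥} {_ , _} h

-- The invariant passes through any resolution step whose conclusion is satisfied by
-- fixed variables or mentions fewer than r free ones.
module WidthInvariant {V W : Set} {v : ℕ} (iso : V ↔ Fin v) (ι : W → V) {χ : Formula W} {r : ℕ} (G : Game χ r) where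

  open Encoding iso
  open Game G

  Killed Narrow Fine : Clause v → Set
  Killed D = ∃[ w ] Fixed w × (∀ A → D has (ι w , val A w))
  Narrow D = ∃[ U ] length U < r × (∀ {w b} → D has (ι w , b) → Fixed w ⊎ w ∈ U)
  Fine D   = Killed D ⊎ Narrow D

  -- Quantifying over all safe assignments makes this a property of the clause alone, independent of
  -- the rest of the memory and of its size.
  record Inv (D : Clause v) : Set where
    field
      only : ∀ {l} → D has l → ∃[ w ] proj₁ l ≡ ι w
      sat  : ∀ A U → Safe A U → (∀ {w b} → D has (ι w , b) → Fixed w ⊎ w ∈ U) → ∃[ w ] D has (ι w , val A w)

  Inv-axiom : ∀ {ks} → ks ∈ χ → Consistent (_∈ rename ι ks) → Inv (clause (rename ι ks))
  Inv-axiom {ks} ks∈χ con = record { only = λ {l} h → only (clause-⊑ (rename ι ks) {l} h) ; sat = sat }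
    where
    only : ∀ {l} → l ∈ rename ι ks → ∃[ w ] proj₁ l ≡ ι w
    only q with ∈-map⁻ (map₁ ι) q
    ... | (w , _) , _ , refl = w , refl
    sat : ∀ A U → Safe A U → (∀ {w b} → clause (rename ι ks) has (ι w , b) → Fixed w ⊎ w ∈ U) →
          ∃[ w ] clause (rename ι ks) has (ι w , val A w)
    sat A U safe cover with sound ks∈χ safe (λ q → cover (clause-has (rename ι ks) con (∈-map⁺ (map₁ ι) q)))
    ... | w , q = w , clause-has (rename ι ks) con (∈-map⁺ (map₁ ι) q)

  Inv-axiom′ : ∀ {ls} → (∃[ ks ] ks ∈ χ × ls ≡ rename ι ks) → Consistent (_∈ ls) → Inv (clause ls)
  Inv-axiom′ (ks , ks∈χ , refl) = Inv-axiom ks∈χ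

  Inv-apart : ∀ {D u b} → (∀ w → u ≢ ι w) → Inv D → D has (u , b) → ⊥
  Inv-apart u≢ inv h = let w , e = Inv.only inv h in u≢ w e

  Inv-empty : ¬ Inv emptyClause
  Inv-empty inv with Inv.sat inv initial [] safe-[] (λ {w} {b} h → ⊥-elim (empty-⊑ {λ _ → ⊥} {ι w , b} h))
  ... | w , h = empty-⊑ {λ _ → ⊥} {ι w , val initial w} h

  -- For a narrow conclusion the remembered variables are first reduced to few that cover the free
  -- ones of `D` and then extended by the pivot. The new assignment covers and satisfies both
  -- premises and agrees with the old one on `D`. A killed conclusion is satisfied at once.
  Inv-infer : (∀ {a b} → ι a ≡ ι b → a ≡ b) → ∀ {P N D} → Inv P → Inv N → Cuts P N D → Fine D → Inv D
  Inv-infer ι-injective {P} {N} {D} i j c fine = record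
    { only = λ {l} h → [ Inv.only i {l} , Inv.only j {l} ]′ (Cuts.D-from c {l} h)
    ; sat  = sat fine
    }
    where
    clash : ∀ {A w w′} → (ι w , val A w) ≡ Pos (Cuts.pivot c) → (ι w′ , val A w′) ≡ Neg (Cuts.pivot c) → ⊥
    clash {A} {w} {w′} e e′ with ι-injective {w} {w′} (trans (cong proj₁ e) (sym (cong proj₁ e′)))
    ... | refl with trans (sym (cong proj₂ e)) (cong proj₂ e′)
    ...   | ()
    combine : ∀ A → (∃[ w ] P has (ι w , val A w)) → (∃[ w ] N has (ι w , val A w)) → ∃[ w ] D has (ι w , val A w)
    combine A (w , h) (w′ , h′) with (ι w , val A w) ≟ˡ Pos (Cuts.pivot c)
    ... | no ≢  = w , Cuts.P-rest c h ≢
    ... | yes e = w′ , Cuts.N-rest c h′ λ e′ → clash {A} {w} {w′} e e′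
    sat : Fine D → ∀ A U → Safe A U → (∀ {w b} → D has (ι w , b) → Fixed w ⊎ w ∈ U) → ∃[ w ] D has (ι w , val A w)
    sat (inj₁ (w , f , h)) A U safe cover = w , h A
    sat (inj₂ (U₀ , U₀<r , cover₀)) A U safe cover with Inv.only i (Cuts.P-pivot c)
    ... | p , p≡ = transfer (extend (shrink (λ q → proj₂ (∈-filter⁻ (_∈? U) {xs = U₀} q)) safe)
                                    (≤-trans (s≤s (length-filter (_∈? U) U₀)) U₀<r) p)
      where
      open import Data.List.Membership.DecPropositional
        (λ a b → map′ ι-injective (cong ι) (ι a ≟ⱽ ι b)) using (_∈?_)
      -- `U₀` is small but perhaps not safe, `U` is safe but perhaps too large; the intersection is
      -- both and still covers `D`.
      U₁ : List W
      U₁ = filter (_∈? U) U₀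
      cover₁ : ∀ {w b} → D has (ι w , b) → Fixed w ⊎ w ∈ U₁
      cover₁ h with cover₀ h | cover h
      ... | inj₁ f | _      = inj₁ f
      ... | _      | inj₁ f = inj₁ f
      ... | inj₂ q | inj₂ r = inj₂ (∈-filter⁺ (_∈? U) q r)
      transfer : Σ[ B ∈ State ] Safe B (p ∷ U₁) × (∀ {w} → w ∈ U₁ → val B w ≡ val A w) → ∃[ w ] D has (ι w , val A w)
      transfer (B , safe′ , agree)
        with combine B (Inv.sat i B (p ∷ U₁) safe′ (premise P true (Cuts.P-rest c)))
                       (Inv.sat j B (p ∷ U₁) safe′ (premise N false (Cuts.N-rest c)))
        where
        premise : ∀ C s → (∀ {l} → C has l → l ≢ (Cuts.pivot c , s) → D has l) →
                  ∀ {w b} → C has (ι w , b) → Fixed w ⊎ w ∈ p ∷ U₁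
        premise C s rest {w} {b} h with (ι w , b) ≟ˡ (Cuts.pivot c , s)
        ... | yes e = inj₂ (here (ι-injective (trans (cong proj₁ e) p≡)))
        ... | no ≢  = Sum.map₂ there (cover₁ (rest h ≢))
      ... | w , h with cover₁ h
      ...   | inj₁ f = w , subst (λ b → D has (ι w , b)) (fixed f B A) h
      ...   | inj₂ q = w , subst (λ b → D has (ι w , b)) (agree q) h

-- Restrictions by averaging.

Choice : Set
Choice = Bool × Bool

-- A uniformly random choice at the position i kills an object mentioned there with probability at
-- least 1/4; `weight` is 4 ^ N times a bound on the probability to survive all N positions.
module Restriction {D : Set} where

  Kill : ℕ → Set
  Kill N = Fin N → Choice → D → Bool

  mentioned : (Choice → D → Bool) → D → Bool
  mentioned kill d = (kill (false , false) d ∨ kill (false , true) d) ∨ (kill (true , false) d ∨ kill (true , true) d)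

  later : ∀ {N} → Kill (suc N) → Kill N
  later kill i = kill (suc i)

  weight : ∀ N → Kill N → D → ℕ
  weight zero    kill d = 1
  weight (suc N) kill d = (if mentioned (kill zero) d then 3 else 4) * weight N (later kill) d

  mentions : ∀ N → Kill N → D → List (Fin N)
  mentions zero    kill d = []
  mentions (suc N) kill d =
    (if mentioned (kill zero) d then zero ∷_ else id) (map suc (mentions N (later kill) d))

  kill⇒mentioned : ∀ kill c d → kill c d ≡ true → mentioned kill d ≡ true
  kill⇒mentioned kill (false , false) d e rewrite e = refl
  kill⇒mentioned kill (false , true)  d e rewrite e =
    cong (_∨ (kill (true , false) d ∨ kill (true , true) d)) (Bool.∨-zeroʳ (kill (false , false) d))
  kill⇒mentioned kill (true , false)  d e rewrite e = Bool.∨-zeroʳ _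
  kill⇒mentioned kill (true , true)   d e rewrite e =
    trans (cong ((kill (false , false) d ∨ kill (false , true) d) ∨_) (Bool.∨-zeroʳ (kill (true , false) d))) (Bool.∨-zeroʳ _)

  kill⇒∈mentions : ∀ N kill i c d → kill i c d ≡ true → i ∈ mentions N kill d
  kill⇒∈mentions (suc N) kill zero c d e rewrite kill⇒mentioned (kill zero) c d e = here refl
  kill⇒∈mentions (suc N) kill (suc i) c d e with mentioned (kill zero) d
  ... | true  = there (∈-map⁺ suc (kill⇒∈mentions N (later kill) i c d e))
  ... | false = ∈-map⁺ suc (kill⇒∈mentions N (later kill) i c d e)

  -- The weight is `4 ^ N` times a factor 3/4 for each mention; here the denominators are cleared.
  weight-mentions : ∀ N kill d → weight N kill d * 4 ^ length (mentions N kill d) ≡ 3 ^ length (mentions N kill d) * 4 ^ N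
  weight-mentions zero    kill d = refl
  weight-mentions (suc N) kill d with mentioned (kill zero) d | weight-mentions N (later kill) d
  ... | true  | ih = trans (cong (λ l → 3 * weight N (later kill) d * (4 * 4 ^ l)) (length-map suc (mentions N (later kill) d)))
    (trans (regroup (weight N (later kill) d) (4 ^ length (mentions N (later kill) d)))
    (trans (cong (12 *_) ih)
    (trans (sym (regroup (3 ^ length (mentions N (later kill) d)) (4 ^ N)))
    (cong (λ l → 3 * 3 ^ l * (4 * 4 ^ N)) (sym (length-map suc (mentions N (later kill) d)))))))
    where
    open +-*-Solver
    regroup : ∀ a b → 3 * a * (4 * b) ≡ 12 * (a * b)
    regroup = solve 2 (λ a b → con 3 :* a :* (con 4 :* b) := con 12 :* (a :* b)) refl
  ... | false | ih rewrite length-map (Fin.suc {N}) (mentions N (later kill) d) =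
    trans (*-assoc 4 (weight N (later kill) d) _) (trans (cong (4 *_) ih) (shift (3 ^ length (mentions N (later kill) d)) (4 ^ N)))
    where
    open +-*-Solver
    shift : ∀ a b → 4 * (a * b) ≡ a * (4 * b)
    shift = solve 2 (λ a b → con 4 :* (a :* b) := a :* (con 4 :* b)) refl

  survive : (Choice → D → Bool) → Choice → (D → ℕ) → List D → ℕ
  survive kill c w S = sum (map (λ d → if kill c d then 0 else w d) S)

  survivors : (Choice → D → Bool) → Choice → List D → List D
  survivors kill c = filter (λ d → kill c d Bool.≟ false)

  sum-survivors : ∀ kill c w S → sum (map w (survivors kill c S)) ≡ survive kill c w S
  sum-survivors kill c w [] = refl
  sum-survivors kill c w (d ∷ S) with kill c d
  ... | true  = sum-survivors kill c w S
  ... | false = cong (w d +_) (sum-survivors kill c w S)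

  four : (Choice → ℕ) → ℕ
  four f = (f (false , false) + f (false , true)) + (f (true , false) + f (true , true))

  average : ∀ f n → four f < 4 * n → ∃[ c ] f c < n
  average f n le with f (false , false) <? n | f (false , true) <? n | f (true , false) <? n | f (true , true) <? n
  ... | yes h | _ | _ | _ = _ , h
  ... | _ | yes h | _ | _ = _ , h
  ... | _ | _ | yes h | _ = _ , h
  ... | _ | _ | _ | yes h = _ , h
  ... | no a | no b | no c | no d = contradiction le (≤⇒≯ (≤-trans (≤-reflexive eq)
    (+-mono-≤ (+-mono-≤ (≮⇒≥ a) (≮⇒≥ b)) (+-mono-≤ (≮⇒≥ c) (≮⇒≥ d)))))
    where
    open +-*-Solver
    eq : 4 * n ≡ (n + n) + (n + n)
    eq = solve 1 (λ n → con 4 :* n := (n :+ n) :+ (n :+ n)) refl n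

  -- An object mentioned at this position is killed by at least one of the four choices, so at most
  -- three copies of its weight survive.
  four-survive : ∀ kill w S →
    four (λ c → survive kill c w S) ≤ sum (map (λ d → (if mentioned kill d then 3 else 4) * w d) S)
  four-survive kill w [] = z≤n
  four-survive kill w (d ∷ S) = begin
    four (λ c → loss c + survive kill c w S)           ≡⟨ split (loss _) (loss _) (loss _) (loss _) (rest _) (rest _) (rest _) (rest _) ⟩
    four loss + four (λ c → survive kill c w S)        ≤⟨ +-mono-≤ (one (kill (false , false) d) (kill (false , true) d) (kill (true , false) d) (kill (true , true) d)) (four-survive kill w S) ⟩
    _                                                  ∎
    where
    open ≤-Reasoning
    open +-*-Solver
    loss rest : Choice → ℕ
    loss c = if kill c d then 0 else w d
    rest c = survive kill c w S
    split : ∀ a b c d e f g h → ((a + e) + (b + f)) + ((c + g) + (d + h)) ≡ ((a + b) + (c + d)) + ((e + f) + (g + h))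
    split = solve 8 (λ a b c d e f g h → ((a :+ e) :+ (b :+ f)) :+ ((c :+ g) :+ (d :+ h)) := ((a :+ b) :+ (c :+ d)) :+ ((e :+ f) :+ (g :+ h))) refl
    kept : Bool → ℕ
    kept k = if k then 0 else 1
    kept≤1 : ∀ k → kept k ≤ 1
    kept≤1 true  = z≤n
    kept≤1 false = ≤-refl
    kept-* : ∀ k → (if k then 0 else w d) ≡ kept k * w d
    kept-* true  = refl
    kept-* false = sym (*-identityˡ (w d))
    count : ∀ k₀ k₁ k₂ k₃ → (kept k₀ + kept k₁) + (kept k₂ + kept k₃) ≤ (if (k₀ ∨ k₁) ∨ (k₂ ∨ k₃) then 3 else 4)
    count true  k₁    k₂    k₃    = +-mono-≤ (kept≤1 k₁) (+-mono-≤ (kept≤1 k₂) (kept≤1 k₃))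
    count false true  k₂    k₃    = s≤s (+-mono-≤ (kept≤1 k₂) (kept≤1 k₃))
    count false false true  k₃    = s≤s (s≤s (kept≤1 k₃))
    count false false false true  = ≤-refl
    count false false false false = ≤-refl
    one : ∀ k₀ k₁ k₂ k₃ →
          ((if k₀ then 0 else w d) + (if k₁ then 0 else w d)) + ((if k₂ then 0 else w d) + (if k₃ then 0 else w d))
          ≤ (if (k₀ ∨ k₁) ∨ (k₂ ∨ k₃) then 3 else 4) * w d
    one k₀ k₁ k₂ k₃ rewrite kept-* k₀ | kept-* k₁ | kept-* k₂ | kept-* k₃ =
      ≤-trans (≤-reflexive (collect (kept k₀) (kept k₁) (kept k₂) (kept k₃) (w d))) (*-monoˡ-≤ (w d) (count k₀ k₁ k₂ k₃))
      where
      collect : ∀ a b c e x → (a * x + b * x) + (c * x + e * x) ≡ ((a + b) + (c + e)) * x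
      collect = solve 5 (λ a b c e x → (a :* x :+ b :* x) :+ (c :* x :+ e :* x) := ((a :+ b) :+ (c :+ e)) :* x) refl

  -- The method of conditional expectations: some choice leaves at most the average weight, and at
  -- the end each survivor has weight 1, so a total below 1 means that none is left.
  restrict : ∀ N (kill : Kill N) S → sum (map (weight N kill) S) < 4 ^ N →
             Σ[ ρ ∈ (Fin N → Choice) ] (∀ {d} → d ∈ S → ∃[ i ] kill i (ρ i) d ≡ true)
  restrict zero kill [] _ = (λ ()) , λ ()
  restrict zero kill (d ∷ S) (s≤s ())
  restrict (suc N) kill S lt with average _ (4 ^ N) (≤-trans (s≤s (four-survive (kill zero) (weight N (later kill)) S)) lt)
  ... | c , lt′ with restrict N (later kill) (survivors (kill zero) c S)
                       (subst (_< 4 ^ N) (sym (sum-survivors (kill zero) c (weight N (later kill)) S)) lt′)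
  ...   | ρ , dead = ρ′ , λ d∈S → dead′ _ d∈S
    where
    ρ′ : Fin (suc N) → Choice
    ρ′ zero    = c
    ρ′ (suc i) = ρ i
    dead′ : ∀ d → d ∈ S → ∃[ i ] kill i (ρ′ i) d ≡ true
    dead′ d d∈S with kill zero c d in e
    ... | true  = zero , e
    ... | false with dead (∈-filter⁺ (λ d → kill zero c d Bool.≟ false) d∈S e)
    ...   | i , h = suc i , h

  weight-≤ : ∀ N kill q d → q ≤ length (mentions N kill d) → weight N kill d * 4 ^ q ≤ 3 ^ q * 4 ^ N
  weight-≤ N kill q d q≤ = *-cancelʳ-≤ _ _ (4 ^ e) {{m^n≢0 4 e}} (begin
    weight N kill d * 4 ^ q * 4 ^ e   ≡⟨ *-assoc (weight N kill d) (4 ^ q) (4 ^ e) ⟩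
    weight N kill d * (4 ^ q * 4 ^ e) ≡⟨ cong (weight N kill d *_) (sym (^-distribˡ-+-* 4 q e)) ⟩
    weight N kill d * 4 ^ (q + e)     ≡⟨ cong (λ l → weight N kill d * 4 ^ l) q+e ⟩
    weight N kill d * 4 ^ ℓ           ≡⟨ weight-mentions N kill d ⟩
    3 ^ ℓ * 4 ^ N                     ≡⟨ cong (λ l → 3 ^ l * 4 ^ N) (sym q+e) ⟩
    3 ^ (q + e) * 4 ^ N               ≡⟨ cong (_* 4 ^ N) (^-distribˡ-+-* 3 q e) ⟩
    3 ^ q * 3 ^ e * 4 ^ N             ≤⟨ *-monoˡ-≤ (4 ^ N) (*-monoʳ-≤ (3 ^ q) (^-monoˡ-≤ e (n≤1+n 3))) ⟩
    3 ^ q * 4 ^ e * 4 ^ N             ≡⟨ *-assoc (3 ^ q) (4 ^ e) (4 ^ N) ⟩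
    3 ^ q * (4 ^ e * 4 ^ N)           ≡⟨ cong (3 ^ q *_) (*-comm (4 ^ e) (4 ^ N)) ⟩
    3 ^ q * (4 ^ N * 4 ^ e)           ≡⟨ sym (*-assoc (3 ^ q) (4 ^ N) (4 ^ e)) ⟩
    3 ^ q * 4 ^ N * 4 ^ e             ∎)
    where
    open ≤-Reasoning
    ℓ e : ℕ
    ℓ = length (mentions N kill d)
    e = ℓ ∸ q
    q+e : q + e ≡ ℓ
    q+e = m+[n∸m]≡n q≤

  -- A union bound over the objects with at least `q` mentions: each weighs at most `4 ^ N` times
  -- the `q`-th power of 3/4, so their total is below `4 ^ N` and all of them can be killed.
  restriction : ∀ N (kill : Kill N) q S → length S * 3 ^ q < 4 ^ q →
                Σ[ ρ ∈ (Fin N → Choice) ]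
                  (∀ {d} → d ∈ S → (∃[ i ] kill i (ρ i) d ≡ true) ⊎ (length (mentions N kill d) < q))
  restriction N kill q S small with restrict N kill wide (*-cancelʳ-< (4 ^ q) _ _ total)
    where
    open ≤-Reasoning
    weights : ∀ S → (∀ {d} → d ∈ S → q ≤ length (mentions N kill d)) →
              sum (map (weight N kill) S) * 4 ^ q ≤ length S * (3 ^ q * 4 ^ N)
    weights [] _ = z≤n
    weights (d ∷ S) h = ≤-trans (≤-reflexive (*-distribʳ-+ (4 ^ q) (weight N kill d) _))
      (+-mono-≤ (weight-≤ N kill q d (h (here refl))) (weights S (h ∘ there)))
    wide : List D
    wide = filter (λ d → q ≤? length (mentions N kill d)) S
    total : sum (map (weight N kill) wide) * 4 ^ q < 4 ^ N * 4 ^ q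
    total = begin-strict
      sum (map (weight N kill) wide) * 4 ^ q
        ≤⟨ weights wide (λ m → proj₂ (∈-filter⁻ (λ d → q ≤? length (mentions N kill d)) {xs = S} m)) ⟩
      length wide * (3 ^ q * 4 ^ N)  ≤⟨ *-monoˡ-≤ (3 ^ q * 4 ^ N) (length-filter (λ d → q ≤? length (mentions N kill d)) S) ⟩
      length S * (3 ^ q * 4 ^ N)     ≡⟨ sym (*-assoc (length S) (3 ^ q) (4 ^ N)) ⟩
      length S * 3 ^ q * 4 ^ N       <⟨ *-monoˡ-< (4 ^ N) {{m^n≢0 4 N}} small ⟩
      4 ^ q * 4 ^ N                  ≡⟨ *-comm (4 ^ q) (4 ^ N) ⟩
      4 ^ N * 4 ^ q                  ∎
  ... | ρ , dead = ρ , λ d∈S → classify d∈S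
    where
    classify : ∀ {d} → d ∈ S → (∃[ i ] kill i (ρ i) d ≡ true) ⊎ (length (mentions N kill d) < q)
    classify {d} d∈S with q ≤? length (mentions N kill d)
    ... | yes q≤ = inj₁ (dead (∈-filter⁺ (λ d → q ≤? length (mentions N kill d)) d∈S q≤))
    ... | no q≰  = inj₂ (≰⇒> q≰)

-- Computing the minimal space.

least : ∀ {P : ℕ → Set} → (∀ n → Dec (P n)) → ∀ n → P n → ∃[ m ] P m × (∀ j → P j → m ≤ j)
least P? zero    p = 0 , p , λ _ _ → z≤n
least P? (suc n) p with P? 0
... | yes p₀ = 0 , p₀ , λ _ _ → z≤n
... | no ¬p₀ with least (P? ∘ suc) n p
...   | m , pm , min = suc m , pm , λ { zero p₀ → contradiction p₀ ¬p₀ ; (suc j) pj → s≤s (min j pj) }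

-- Reachability in a finite graph, by the Floyd–Warshall recursion on the list of
-- admissible intermediate points.
module Reachability {A : Set} (R : A → A → Set) where

  Via : List A → A → A → Set
  Via []       a b = R a b
  Via (k ∷ ks) a b = Via ks a b ⊎ (Via ks a k × Via ks k b)

  via? : (∀ a b → Dec (R a b)) → ∀ ks a b → Dec (Via ks a b)
  via? R? []       a b = R? a b
  via? R? (k ∷ ks) a b = via? R? ks a b ⊎-dec (via? R? ks a k ×-dec via? R? ks k b)

  via-step : ∀ ks {a b} → R a b → Via ks a b
  via-step []       r = r
  via-step (k ∷ ks) r = inj₁ (via-step ks r)

  via-trans : ∀ ks {a k b} → k ∈ ks → Via ks a k → Via ks k b → Via ks a b
  via-trans (k ∷ ks) (here refl) p q = inj₂ ([ id , proj₁ ]′ p , [ id , proj₂ ]′ q)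
  via-trans (_ ∷ ks) (there k∈) (inj₁ p)        (inj₁ q)        = inj₁ (via-trans ks k∈ p q)
  via-trans (_ ∷ ks) (there k∈) (inj₁ p)        (inj₂ (q , q′)) = inj₂ (via-trans ks k∈ p q , q′)
  via-trans (_ ∷ ks) (there k∈) (inj₂ (p , p′)) (inj₁ q)        = inj₂ (p , via-trans ks k∈ p′ q)
  -- Both halves pass through the head, so the detour between these two visits is cut out.
  via-trans (_ ∷ ks) (there k∈) (inj₂ (p , _))  (inj₂ (_ , q′)) = inj₂ (p , q′)

  via⇒star : ∀ ks {a b} → Via ks a b → Star R a b
  via⇒star []       r              = r ◅ ε
  via⇒star (k ∷ ks) (inj₁ p)       = via⇒star ks p
  via⇒star (k ∷ ks) (inj₂ (p , q)) = via⇒star ks p ◅◅ via⇒star ks q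

allClauses : ∀ v → List (Clause v)
allClauses zero    = [] ∷ []
allClauses (suc v) = concatMap (λ C → (nothing ∷ C) ∷ (just true ∷ C) ∷ (just false ∷ C) ∷ []) (allClauses v)

∈-allClauses : ∀ {v} (C : Clause v) → C ∈ allClauses v
∈-allClauses []      = here refl
∈-allClauses {suc v} (c ∷ C) =
  ∈-concatMap⁺ (λ C → (nothing ∷ C) ∷ (just true ∷ C) ∷ (just false ∷ C) ∷ []) (lose (∈-allClauses C) (entry c))
  where
  entry : ∀ c → c ∷ C ∈ (nothing ∷ C) ∷ (just true ∷ C) ∷ (just false ∷ C) ∷ []
  entry nothing      = here refl
  entry (just true)  = there (here refl)
  entry (just false) = there (there (here refl))

sublists : ∀ {A : Set} → List A → List (List A)
sublists []       = [] ∷ []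
sublists (a ∷ as) = map (a ∷_) (sublists as) ++ sublists as

filter∈sublists : ∀ {A : Set} {P : A → Set} (P? : ∀ a → Dec (P a)) as → filter P? as ∈ sublists as
filter∈sublists P? []       = here refl
filter∈sublists P? (a ∷ as) with P? a
... | yes _ = ∈-++⁺ˡ (∈-map⁺ (a ∷_) (filter∈sublists P? as))
... | no _  = ∈-++⁺ʳ (map (a ∷_) (sublists as)) (filter∈sublists P? as)

module _ {v : ℕ} where

  open import Data.List.Membership.DecPropositional (_≟ᶜ_ {v}) using (_∈?_)

  allConfigs : List (ClauseSet v)
  allConfigs = map toSet (sublists (allClauses v))

  -- A set has many listings; filtering the list of all clauses selects one of them, so that the
  -- search can run through a fixed finite list.
  canonical : (c : ClauseSet v) → ∃[ d ] d ∈ allConfigs × elems d ≃ elems c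
  canonical c = toSet A , ∈-map⁺ toSet (filter∈sublists (_∈? elems c) (allClauses v)) ,
    ≃-trans (toSet-≃ A) ((λ q → proj₂ (∈-filter⁻ (_∈? elems c) {xs = allClauses v} q)) , ∈-filter⁺ (_∈? elems c) (∈-allClauses _))
    where
    A : List (Clause v)
    A = filter (_∈? elems c) (allClauses v)

  ⊆-dec : ∀ (A B : List (Clause v)) → Dec (A ⊆ B)
  ⊆-dec A B = map′ (λ h q → All.lookup h q) (λ h → All.tabulate h) (all? (_∈? B) A)

  ≃-dec : ∀ (A B : List (Clause v)) → Dec (A ≃ B)
  ≃-dec A B = ⊆-dec A B ×-dec ⊆-dec B A

  exists-clause? : ∀ {P : Clause v → Set} → (∀ C → Dec (P C)) → Dec (∃[ C ] P C)
  exists-clause? P? = map′ (λ h → let C , _ , p = find h in C , p) (λ (C , p) → lose (∈-allClauses C) p)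
    (any? P? (allClauses v))

  ∈ᶜ-dec : ∀ (l : Literal v) C → Dec (l ∈ᶜ C)
  ∈ᶜ-dec (x , b) C = Maybe.≡-dec Bool._≟_ (lookup C x) (just b)

  ∨-dec : ∀ (D B C : Clause v) → Dec (D ≐ B ∨ C)
  ∨-dec D B C = map′ (λ { h (x , true) → proj₁ (h x) ; h (x , false) → proj₂ (h x) })
    (λ h x → h (x , true) , h (x , false)) (Fin.all? λ x → at (x , true) ×-dec at (x , false))
    where
    at : ∀ l → Dec ((l ∈ᶜ D) ⇔ ((l ∈ᶜ B) ⊎ (l ∈ᶜ C)))
    at l = map′ (λ (f , g) → mk⇔ f g) (λ e → Equivalence.to e , Equivalence.from e)
      ((∈ᶜ-dec l D →-dec (∈ᶜ-dec l B ⊎-dec ∈ᶜ-dec l C)) ×-dec ((∈ᶜ-dec l B ⊎-dec ∈ᶜ-dec l C) →-dec ∈ᶜ-dec l D))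

  resolves? : ∀ (P N D : Clause v) → Dec (Resolves P N D)
  resolves? P N D = map′
    (λ (x , B , C , a , b , p , n , d) → resolve x B C a b p n d)
    (λ { (resolve x B C a b p n d) → x , B , C , a , b , p , n , d })
    (Fin.any? λ x → exists-clause? λ B → exists-clause? λ C →
      free? x B ×-dec free? x C ×-dec ∨-dec P B (unitClause (x , true)) ×-dec
      ∨-dec N C (unitClause (x , false)) ×-dec ∨-dec D B C)
    where
    free? : ∀ x (C : Clause v) → Dec (x ∉vars C)
    free? x C = Maybe.≡-dec Bool._≟_ (lookup C x) nothing

module MinimalSpace (F : CNF) where

  open Derive F

  private
    v : ℕ
    v = vars F

  step? : ∀ (a b : ClauseSet v) → Dec (Step F a b)
  step? a b = map′ to from
    (any? (λ C → ≃-dec (elems b) (C ∷ elems a)) (elems (clauses F))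
     ⊎-dec any? (λ C → ≃-dec (elems b) (without C (elems a))) (elems a)
     ⊎-dec any? (λ P → any? (λ N → exists-clause? λ D → resolves? P N D ×-dec ≃-dec (elems b) (D ∷ elems a)) (elems a)) (elems a))
    where
    to : _ → Step F a b
    to (inj₁ h)        = let C , p , e = find h in download p (≃⇒set e)
    to (inj₂ (inj₁ h)) = let C , p , e = find h in erase p (≃⇒set (≃-trans e (≃-sym (─-≃ (unique a) p))))
    to (inj₂ (inj₂ h)) = let P , p , h′ = find h
                             N , n , D , r , e = find h′ in infer p n r (≃⇒set e)
    from : Step F a b → _
    from (download p e)  = inj₁ (lose p (set⇒≃ e))
    from (erase p e)     = inj₂ (inj₁ (lose p (≃-trans (set⇒≃ e) (─-≃ (unique a) p))))
    from (infer p n r e) = inj₂ (inj₂ (lose p (lose n (_ , r , set⇒≃ e))))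

  step-source : ∀ {a a′ b} → elems a ≃ elems a′ → Step F a b → Step F a′ b
  step-source a≃a′ (download p e)  = download p (≃⇒set (≃-trans (set⇒≃ e) (≃-∷ a≃a′)))
  step-source {a} {a′} a≃a′ (erase {C} p e) = erase (proj₁ a≃a′ p)
    (≃⇒set (≃-trans (set⇒≃ e) (≃-trans (─-≃ (unique a) p) (≃-trans without-≃ (≃-sym (─-≃ (unique a′) (proj₁ a≃a′ p)))))))
    where
    without-≃ : without C (elems a) ≃ without C (elems a′)
    without-≃ = (λ q → let m , ≢C = ∈-without⁻ {A = elems a} q in ∈-without⁺ (proj₁ a≃a′ m) ≢C)
              , (λ q → let m , ≢C = ∈-without⁻ {A = elems a′} q in ∈-without⁺ (proj₂ a≃a′ m) ≢C)
  step-source a≃a′ (infer p n r e) = infer (proj₁ a≃a′ p) (proj₁ a≃a′ n) r (≃⇒set (≃-trans (set⇒≃ e) (≃-∷ a≃a′)))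

  module _ (s : ℕ) where

    Small : ClauseSet v → ClauseSet v → Set
    Small a b = Step F a b × ∣ b ∣ˢ ≤ s

    open Reachability Small

    -- Interior configurations are replaced by their canonical listings, which is possible because a
    -- step depends on its source and target only as sets; the two endpoints are left as they are.
    small⇒via : ∀ {a c b} → Small a c → Star Small c b → Via allConfigs a b
    small⇒via r ε = via-step allConfigs r
    small⇒via {a} {c} (st , le) ((st′ , le′) ◅ rs) with canonical c
    ... | d , d∈ , d≃c = via-trans allConfigs d∈
      (via-step allConfigs (step-target st d≃c , ≤-trans (∣∣-≤ d (proj₁ d≃c)) le))
      (small⇒via (step-source (≃-sym d≃c) st′ , le′) rs)

    small⇒configs : ∀ {a b} → ∣ a ∣ˢ ≤ s → Star Small a b → Σ[ π ∈ Star (Step F) a b ] Configs (λ c → ∣ c ∣ˢ ≤ s) π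
    small⇒configs le ε = ε , le ∷ []
    small⇒configs le ((st , le′) ◅ rs) with small⇒configs le′ rs
    ... | π , ps = st ◅ π , le ∷ ps

    configs⇒small : ∀ {a b} (π : Star (Step F) a b) → Configs (λ c → ∣ c ∣ˢ ≤ s) π → Star Small a b
    configs⇒small ε _ = ε
    configs⇒small (st ◅ π) (_ ∷ ps) = (st , configs-source π ps) ◅ configs⇒small π ps

    refutable? : Dec (Σ[ π ∈ Refutation F ] Sp π ≤ s)
    refutable? = map′ to from (via? (λ a b → step? a b ×-dec (∣ b ∣ˢ ≤? s)) allConfigs ∅ ｛0｝)
      where
      to : Via allConfigs ∅ ｛0｝ → Σ[ π ∈ Refutation F ] Sp π ≤ s
      to h with small⇒configs z≤n (via⇒star allConfigs h)
      ... | π , ps = π , Sp-≤ π ps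
      from : Σ[ π ∈ Refutation F ] Sp π ≤ s → Via allConfigs ∅ ｛0｝
      from (π , sp) with configs⇒small π (All.map (λ le → ≤-trans le sp) (≤-Sp π))
      ... | r ◅ rs = small⇒via r rs

  minimal-space : Refutation F → ∃[ s ] IsMinSpace F s
  minimal-space π with least refutable? (Sp π) (π , ≤-refl)
  ... | s , (π₀ , sp) , min = s , (π₀ , ≤-antisym sp (min (Sp π₀) (π₀ , ≤-refl))) , λ π → min (Sp π) (π , ≤-refl)

-- The tradeoff for fixed parameters.

Ordvar↔Fin : ∀ m p → Ordvar m p ↔ Fin (m * m + (m * suc m + p))
Ordvar↔Fin m p = ↔-trans (↔-sym Fin.*↔× ⊎-↔ ↔-trans (↔-sym Fin.*↔× ⊎-↔ ↔-id (Fin p)) (↔-sym Fin.+↔⊎)) (↔-sym Fin.+↔⊎)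

has⇒width : ∀ {n} (C : Clause n) {x b} → lookup C x ≡ just b → 1 ≤ width C
has⇒width (just _ ∷ C)  {zero}  _ = s≤s z≤n
has⇒width (just _ ∷ C)  {suc x} _ = s≤s z≤n
has⇒width (nothing ∷ C) {suc x} h = has⇒width C h

length-≤-sum : ∀ {A : Set} (f : A → ℕ) xs → All (λ x → 1 ≤ f x) xs → length xs ≤ sum (map f xs)
length-≤-sum f []       []       = z≤n
length-≤-sum f (x ∷ xs) (h ∷ hs) = +-mono-≤ h (length-≤-sum f xs hs)

does⇒ : ∀ {P : Set} (d : Dec P) → does d ≡ true → P
does⇒ (yes p) _ = p

configs-from-Len : ∀ {F} (π : Refutation F) {P : Clause (vars F) → Set} →
  (∀ {D} → D ∈ deduplicate _≟ᶜ_ (concatMap elems (configurations π)) → P D) →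
  Derive.Configs F (λ c → ∀ {D} → D ∈ elems c → P D) π
configs-from-Len π h = All.tabulate λ c∈ D∈ →
  h (∈-deduplicate⁺ _≟ᶜ_ (∈-concatMap⁺ elems {xs = configurations π} (lose c∈ D∈)))

^-distribʳ-* : ∀ a b n → (a * b) ^ n ≡ a ^ n * b ^ n
^-distribʳ-* a b zero    = refl
^-distribʳ-* a b (suc n) = trans (cong (a * b *_) (^-distribʳ-* a b n))
  (solve 4 (λ a b c d → a :* b :* (c :* d) := a :* c :* (b :* d)) refl a b (a ^ n) (b ^ n))
  where open +-*-Solver

-- Cube the hypothesis and use 4³ ≥ 2 · 3³.
exponential : ∀ L m → 4 ^ m ≤ L * 3 ^ m → 2 ^ m ≤ L ^ 3
exponential L m h = *-cancelʳ-≤ _ _ (27 ^ m) {{m^n≢0 27 m}} (begin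
  2 ^ m * 27 ^ m    ≡⟨ sym (^-distribʳ-* 2 27 m) ⟩
  54 ^ m            ≤⟨ ^-monoˡ-≤ m (m≤m+n 54 10) ⟩
  (4 ^ 3) ^ m       ≡⟨ swap 4 ⟩
  (4 ^ m) ^ 3       ≤⟨ ^-monoˡ-≤ 3 h ⟩
  (L * 3 ^ m) ^ 3   ≡⟨ ^-distribʳ-* L (3 ^ m) 3 ⟩
  L ^ 3 * (3 ^ m) ^ 3 ≡⟨ cong (L ^ 3 *_) (sym (swap 3)) ⟩
  L ^ 3 * 27 ^ m    ∎)
  where
  open ≤-Reasoning
  swap : ∀ b → (b ^ 3) ^ m ≡ (b ^ m) ^ 3
  swap b = trans (^-*-assoc b 3 m) (trans (cong (b ^_) (*-comm 3 m)) (sym (^-*-assoc b m 3)))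

-- Up to additive constants, q is the width needed by H, and r the space needed by G.
module Tradeoff (q n h r g : ℕ) (q≤h : q * 2 ≤ h) (space≤r : 2 + suc (suc h * 5) * 2 + 3 ≤ r) (r≤g : r * 2 ≤ g) where

  mᴴ mᴳ spaceᴴ : ℕ
  mᴴ     = suc h
  mᴳ     = suc g
  -- Twice the depth of the tree for the ordering principle, plus the two places that the conversion
  -- of a tree takes on top.
  spaceᴴ = 2 + suc (mᴴ * 5) * 2

  K Vᴳ Vᴴ V : Set
  K  = Ordvar mᴴ 0
  Vᴳ = Ordvar mᴳ n
  Vᴴ = K × Bool
  V  = Vᴳ ⊎ Vᴴ

  φᴴ : Formula K
  φᴴ = Ordering.formula mᴴ 0

  φᴳ : Formula Vᴳ
  φᴳ = Ordering.formula mᴳ n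

  Φ : Formula V
  Φ = φᴳ ⊕ xor-formula φᴴ

  N v : ℕ
  N = mᴴ * mᴴ + (mᴴ * suc mᴴ + 0)
  v = (mᴳ * mᴳ + (mᴳ * suc mᴳ + n)) + N * 2

  abstract
    isoᴷ : K ↔ Fin N
    isoᴷ = Ordvar↔Fin mᴴ 0

    iso : V ↔ Fin v
    iso = ↔-trans (Ordvar↔Fin mᴳ n ⊎-↔ ↔-trans (isoᴷ ×-↔ ↔-sym Fin.2↔Bool) (↔-sym Fin.*↔×)) (↔-sym Fin.+↔⊎)

  open Refute iso Φ
  module K = Encoding isoᴷ

  F : CNF
  F = cnf Φ

  Φ∋ᴳ : ∀ {ls} → ls ∈ φᴳ → rename inj₁ ls ∈ Φ
  Φ∋ᴳ p = ∈-++⁺ˡ (∈-map⁺ (rename inj₁) p)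

  Φ∋ᴴ : ∀ {ks} → ks ∈ xor-formula φᴴ → rename inj₂ ks ∈ Φ
  Φ∋ᴴ p = ∈-++⁺ʳ (map (rename inj₁) φᴳ) (∈-map⁺ (rename inj₂) p)

  treeᴴ : Tree Φ (suc (mᴴ * 5) * 2) []
  treeᴴ = xor-tree inj₂ Φ∋ᴴ (λ ()) (ordering-tree h 0)

  unsatisfiable : Unsatisfiable F
  unsatisfiable = tree-unsat treeᴴ

  Φ-width : All (λ ls → length ls ≤ 6) Φ
  Φ-width = All.++⁺
    (All.map⁺ (All.map (λ {ls} h → ≤-trans (≤-reflexive (length-map (map₁ inj₁) ls)) (≤-trans h (m≤m+n 3 3)))
      (Ordering.length-≤3 mᴳ n)))
    (All.map⁺ (All.map (λ {ls} h → ≤-trans (≤-reflexive (length-map (map₁ inj₂) ls)) h)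
      (xor-formula-width 3 φᴴ (Ordering.length-≤3 mᴴ 0))))

  6-CNF : Is 6 -CNF F
  6-CNF = cnf-width Φ 6 Φ-width

  refutationᴴ : Σ[ π ∈ Refutation F ] Sp π ≤ spaceᴴ
  refutationᴴ = tree-refutes treeᴴ

  minimal : ∃[ s ] IsMinSpace F s
  minimal = MinimalSpace.minimal-space F (proj₁ refutationᴴ)

  sp : ℕ
  sp = proj₁ minimal

  sp-≤ : sp ≤ spaceᴴ
  sp-≤ = ≤-trans (proj₂ (proj₂ minimal) (proj₁ refutationᴴ)) (proj₂ refutationᴴ)

  refutationᴳ : Σ[ π ∈ Refutation F ] (Sp π ≤ 4 + mᴳ) × (Len π ≤ mᴳ * (3 + mᴳ * 2) + mᴳ * (2 + mᴳ * (1 + mᴳ * 2)))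
  refutationᴳ = OrderingRefutation.refutes mᴳ n iso Φ inj₁ inj₁-injective Φ∋ᴳ zero (List.tabulate suc) refl

  gameᴴ : Game φᴴ q
  gameᴴ = OrderingGame.ordering-game h 0 (s≤s q≤h)

  gameᴳ : Game φᴳ r
  gameᴳ = OrderingGame.ordering-game g n (s≤s r≤g)

  q≤r : q ≤ r
  q≤r = begin
    q                    ≤⟨ m≤m*n q 2 ⟩
    q * 2                ≤⟨ m≤n⇒m≤1+n q≤h ⟩
    mᴴ                   ≤⟨ m≤m*n mᴴ 5 ⟩
    mᴴ * 5               ≤⟨ n≤1+n _ ⟩
    suc (mᴴ * 5)         ≤⟨ m≤m*n (suc (mᴴ * 5)) 2 ⟩
    suc (mᴴ * 5) * 2     ≤⟨ m≤n+m _ 2 ⟩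
    spaceᴴ               ≤⟨ m≤m+n spaceᴴ 3 ⟩
    spaceᴴ + 3           ≤⟨ space≤r ⟩
    r                    ∎
    where open ≤-Reasoning

  -- Here the joint strategy defends all of `Φ`, so `Inv` is empty, and a constant restriction
  -- serves for the xor part. The 6 is the room for the variables of a downloaded clause.
  space-lower-bound : (π : Refutation F) → q < Sp π + 6
  space-lower-bound π = ≰⇒> λ le → no-refutation π le (All.tabulate λ _ _ → tt)
    where
    open SpaceStrategy iso Φ id id (SumGame.⊕-game (game-mono q≤r gameᴳ) (XorGame.xor-game (λ _ → false , false) gameᴴ)) 6 Φ-width
      (λ _ → ⊥) (λ _ → ⊤)
      (λ {ls} p _ → inj₁ (ls , p , sym (map-id ls))) (λ ()) (λ ()) (λ ())

  -- If `π` were short, some restriction would leave each of its clauses killed or narrow, so `Inv`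
  -- would persist on the H part; and the space of `π`, with room for the three literals of an
  -- axiom, is within the reach of the adversary for G.
  length-lower-bound : (π : Refutation F) → Sp π ≡ sp → 4 ^ q ≤ Len π * 3 ^ q
  length-lower-bound π sp≡ = ≮⇒≥ λ short → contradict (restriction N kill q S short)
    where
    open Restriction {Clause v}
    S : List (Clause v)
    S = deduplicate _≟ᶜ_ (concatMap elems (configurations π))
    -- A choice kills a clause if it makes one of its literals true. Every literal on a half of `i`
    -- is the outcome of one of the four choices, whence the probability 1/4.
    kill : Kill N
    kill i (c , s) D = does (D has? (inj₂ (K.dec i , c) , s))
    contradict : Σ[ ρ ∈ (Fin N → Choice) ] (∀ {D} → D ∈ S →
                   (∃[ i ] kill i (ρ i) D ≡ true) ⊎ (length (mentions N kill D) < q)) → ⊥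
    contradict (ρ , classify) = no-refutation π
        (≤-trans (+-monoˡ-≤ 3 (≤-trans (≤-reflexive sp≡) sp-≤)) space≤r) (configs-from-Len π λ {D} D∈ → fine {D} (classify D∈))
      where
      ρᴷ : K → Choice
      ρᴷ u = ρ (K.enc u)
      module Width = WidthInvariant iso inj₂ (XorGame.xor-game ρᴷ gameᴴ)
      axioms : ∀ {ls} → ls ∈ Φ → Consistent (_∈ ls) →
               (∃[ ks ] ks ∈ φᴳ × ls ≡ rename inj₁ ks) ⊎ Width.Inv (clause ls)
      axioms p con = Sum.map (∈-map⁻ (rename inj₁)) (λ h → Width.Inv-axiom′ (∈-map⁻ (rename inj₂) h) con)
        (∈-++⁻ (map (rename inj₁) φᴳ) p)
      open SpaceStrategy iso Φ inj₁ inj₁-injective gameᴳ 3 (Ordering.length-≤3 mᴳ n)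
        Width.Inv Width.Fine axioms (Width.Inv-infer inj₂-injective) (λ {D} {w} → Width.Inv-apart {D} {inj₁ w} λ _ ()) Width.Inv-empty
      -- Each original variable keeps a single free half, so fewer than `q` mentioned variables
      -- leave fewer than `q` free ones.
      free : Fin N → Vᴴ
      free i = K.dec i , not (proj₁ (ρᴷ (K.dec i)))
      fine : ∀ {D} → (∃[ i ] kill i (ρ i) D ≡ true) ⊎ (length (mentions N kill D) < q) → Width.Fine D
      fine {D} (inj₁ (i , h)) = inj₁ ((K.dec i , proj₁ (ρ i)) , cong (proj₁ ∘ ρ) (sym (K.enc-dec i)) , killed)
        where
        killed : ∀ A → D has (inj₂ (K.dec i , proj₁ (ρ i)) , XorGame.restricted ρᴷ (Game.val gameᴴ A) (K.dec i , proj₁ (ρ i)))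
        killed A = subst (λ b → D has (inj₂ (K.dec i , proj₁ (ρ i)) , b))
          (sym (trans (XorGame.restricted-fixed ρᴷ (Game.val gameᴴ A) (K.dec i) (cong (proj₁ ∘ ρ) (sym (K.enc-dec i))))
                      (cong (proj₂ ∘ ρ) (K.enc-dec i))))
          (does⇒ (D has? (inj₂ (K.dec i , proj₁ (ρ i)) , proj₂ (ρ i))) h)
      fine {D} (inj₂ h) = inj₂ (map free (mentions N kill D) , ≤-trans (s≤s (≤-reflexive (length-map free (mentions N kill D)))) h , cover)
        where
        cover : ∀ {w b} → D has (inj₂ w , b) → (proj₂ w ≡ proj₁ (ρᴷ (proj₁ w))) ⊎ w ∈ map free (mentions N kill D)
        cover {u , c} {b} h with c Bool.≟ proj₁ (ρᴷ u)
        ... | yes e = inj₁ e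
        ... | no ≢  = inj₂ (subst (_∈ map free (mentions N kill D)) free≡ (∈-map⁺ free (kill⇒∈mentions N kill (K.enc u) (c , b) D kill≡)))
          where
          kill≡ : kill (K.enc u) (c , b) D ≡ true
          kill≡ = dec-true (D has? _) (subst (λ u → D has (inj₂ (u , c) , b)) (sym (K.dec-enc u)) h)
          free≡ : free (K.enc u) ≡ (u , c)
          free≡ = trans (cong (λ t → t , not (proj₁ (ρᴷ t))) (K.dec-enc u)) (cong (u ,_) (sym (Bool.¬-not ≢)))

  size-upper-bound : size F ≤ (length φᴳ + length φᴴ * 8) * 6
  size-upper-bound = ≤-trans (size-≤ Φ 6 Φ-width) (*-monoˡ-≤ 6 (begin
    length Φ                                                    ≡⟨ length-++ (map (rename inj₁) φᴳ) ⟩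
    length (map (rename inj₁) φᴳ) + length (map (rename inj₂) (xor-formula φᴴ))
      ≡⟨ cong₂ _+_ (length-map (rename inj₁) φᴳ) (length-map (rename inj₂) (xor-formula φᴴ)) ⟩
    length φᴳ + length (xor-formula φᴴ)
      ≤⟨ +-monoʳ-≤ (length φᴳ) (length-xor-formula 3 φᴴ (Ordering.length-≤3 mᴴ 0)) ⟩
    length φᴳ + length φᴴ * 8                                   ∎))
    where open ≤-Reasoning

  -- The padding clauses are pairwise distinct, and each contributes a literal.
  size-lower-bound : n ≤ size F
  size-lower-bound = begin
    n                                      ≡⟨ sym (trans (length-map padding (allFin n)) (length-tabulate {n = n} id)) ⟩
    length (map padding (allFin n))        ≤⟨ length-≤-sum width (map padding (allFin n)) (All.map⁺ (All.tabulate {xs = allFin n} λ {a} _ → padding-width a)) ⟩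
    sum (map width (map padding (allFin n))) ≤⟨ sum-⊆ width (Unique.map⁺ padding-injective (Unique.allFin⁺ n)) sub ⟩
    size F                                 ∎
    where
    open ≤-Reasoning
    unit : Fin n → List (Lit V)
    unit a = rename inj₁ (Ordering.pad mᴳ n a)
    padding : Fin n → Clause v
    padding a = clause (unit a)
    unit-consistent : ∀ a → Consistent (_∈ unit a)
    unit-consistent a u _ (here ())
    unit-consistent a u _ (there ())
    padding-has : ∀ a → padding a has Pos (inj₁ (dummy a))
    padding-has a = clause-has (unit a) (unit-consistent a) (here refl)
    padding-width : ∀ a → 1 ≤ width (padding a)
    padding-width a = has⇒width (padding a) (padding-has a)
    padding-injective : ∀ {a b} → padding a ≡ padding b → a ≡ b
    padding-injective {a} {b} e with clause-⊑ (unit b) {Pos (inj₁ (dummy a))} (subst (_has Pos (inj₁ (dummy a))) e (padding-has a))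
    ... | here refl = refl
    sub : map padding (allFin n) ⊆ elems (clauses F)
    sub m with ∈-map⁻ padding m
    ... | a , _ , refl = axiom⁺ (Φ∋ᴳ (Ordering.pad∈ mᴳ n a)) (unit-consistent a)

-- Cube roots, linear bounds and the family.

cbrt : ℕ → ℕ
cbrt zero = 0
cbrt (suc n) with suc (cbrt n) ^ 3 ≤? suc n
... | yes _ = suc (cbrt n)
... | no _  = cbrt n

cbrt-lower : ∀ n → cbrt n ^ 3 ≤ n
cbrt-lower zero = z≤n
cbrt-lower (suc n) with suc (cbrt n) ^ 3 ≤? suc n
... | yes h = h
... | no _  = m≤n⇒m≤1+n (cbrt-lower n)

cbrt-upper : ∀ n → n < suc (cbrt n) ^ 3
cbrt-upper zero = s≤s z≤n
cbrt-upper (suc n) with suc (cbrt n) ^ 3 ≤? suc n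
... | yes _ = ≤-trans (s≤s (cbrt-upper n)) (^-monoˡ-< 3 (n<1+n (suc (cbrt n))))
... | no h  = ≰⇒> h

cbrt-nonZero : ∀ n .⦃ _ : NonZero n ⦄ → NonZero (cbrt n)
cbrt-nonZero n = ≢-nonZero λ q≡0 →
  ≢-nonZero⁻¹ n (n≤0⇒n≡0 (≤-pred (subst (λ q → n < suc q ^ 3) q≡0 (cbrt-upper n))))

infix 4 _≼_
-- The restriction to positive arguments lets constants be dominated by the identity.
_≼_ : (ℕ → ℕ) → (ℕ → ℕ) → Set
f ≼ g = ∃[ c ] ∀ q .⦃ _ : NonZero q ⦄ → f q ≤ c * g q

≼-refl : ∀ {f} → f ≼ f
≼-refl {f} = 1 , λ q → ≤-reflexive (sym (*-identityˡ (f q)))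

≼-const : ∀ k → (λ _ → k) ≼ (λ q → q)
≼-const k = k , λ q → m≤m*n k q

≼-+ : ∀ {f f′ g} → f ≼ g → f′ ≼ g → (λ q → f q + f′ q) ≼ g
≼-+ {g = g} (c , h) (c′ , h′) = c + c′ , λ q →
  ≤-trans (+-mono-≤ (h q) (h′ q)) (≤-reflexive (sym (*-distribʳ-+ (g q) c c′)))

≼-* : ∀ {f f′ g g′} → f ≼ g → f′ ≼ g′ → (λ q → f q * f′ q) ≼ (λ q → g q * g′ q)
≼-* {g = g} {g′} (c , h) (c′ , h′) = c * c′ , λ q → ≤-trans (*-mono-≤ (h q) (h′ q))
  (≤-reflexive (solve 4 (λ a b d e → a :* b :* (d :* e) := a :* d :* (b :* e)) refl c (g q) c′ (g′ q)))
  where open +-*-Solver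

≼-weaken : ∀ {f g g′} → f ≼ g → (∀ q .⦃ _ : NonZero q ⦄ → g q ≤ g′ q) → f ≼ g′
≼-weaken (c , h) g≤g′ = c , λ q → ≤-trans (h q) (*-monoʳ-≤ c (g≤g′ q))

≼-scale : ∀ {f} k → f ≼ (λ q → q) → (λ q → f q * k) ≼ (λ q → q)
≼-scale k (c , h) = c * k , λ q → ≤-trans (*-monoˡ-≤ k (h q))
  (≤-reflexive (trans (*-assoc c q k) (trans (cong (c *_) (*-comm q k)) (sym (*-assoc c k q)))))

abstract
  -- The smallest values that the hypotheses of `Tradeoff` allow; all three are linear in `q`.
  orderᴴ radius orderᴳ : ℕ → ℕ
  orderᴴ q = q * 2
  radius q = 2 + suc (suc (orderᴴ q) * 5) * 2 + 3
  orderᴳ q = radius q * 2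

  q≤h : ∀ q → q * 2 ≤ orderᴴ q
  q≤h q = ≤-refl

  space≤r : ∀ q → 2 + suc (suc (orderᴴ q) * 5) * 2 + 3 ≤ radius q
  space≤r q = ≤-refl

  r≤g : ∀ q → radius q * 2 ≤ orderᴳ q
  r≤g q = ≤-refl

  orderᴴ-linear : (λ q → suc (orderᴴ q)) ≼ (λ q → q)
  orderᴴ-linear = ≼-+ (≼-const 1) (≼-scale 2 ≼-refl)

  space-linear : (λ q → 2 + suc (suc (orderᴴ q) * 5) * 2) ≼ (λ q → q)
  space-linear = ≼-+ (≼-const 2) (≼-scale 2 (≼-+ (≼-const 1) (≼-scale 5 orderᴴ-linear)))

  orderᴳ-linear : (λ q → suc (orderᴳ q)) ≼ (λ q → q)
  orderᴳ-linear = ≼-+ (≼-const 1) (≼-scale 2 (≼-+ space-linear (≼-const 3)))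

cube : ℕ → ℕ
cube q = q * (q * q)

cube≡ : ∀ q → cube q ≡ q ^ 3
cube≡ q = cong (λ t → q * (q * t)) (sym (*-identityʳ q))

length-cubic : (λ q → suc (orderᴳ q) * (3 + suc (orderᴳ q) * 2) + suc (orderᴳ q) * (2 + suc (orderᴳ q) * (1 + suc (orderᴳ q) * 2))) ≼ cube
length-cubic = ≼-+
  (≼-weaken (≼-* orderᴳ-linear (≼-+ (≼-const 3) (≼-scale 2 orderᴳ-linear))) (λ q → *-monoʳ-≤ q (m≤m*n q q)))
  (≼-* orderᴳ-linear (≼-+ (≼-weaken (≼-const 2) (λ q → m≤m*n q q)) (≼-* orderᴳ-linear (≼-+ (≼-const 1) (≼-scale 2 orderᴳ-linear)))))

ordering-length-≤ : ∀ m p .⦃ _ : NonZero m ⦄ → length (Ordering.formula m p) ≤ 5 * cube m + p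
ordering-length-≤ m p = begin
  length (Ordering.formula m p)                                ≡⟨ Ordering.length-formula m p ⟩
  m + (cube m + (m + (m * m + (m + p))))
    ≤⟨ +-mono-≤ m≤ (+-monoʳ-≤ (cube m) (+-mono-≤ m≤ (+-mono-≤ m*m≤ (+-monoˡ-≤ p m≤)))) ⟩
  cube m + (cube m + (cube m + (cube m + (cube m + p))))
    ≡⟨ solve 2 (λ a b → a :+ (a :+ (a :+ (a :+ (a :+ b)))) := con 5 :* a :+ b) refl (cube m) p ⟩
  5 * cube m + p                                               ∎
  where
  open ≤-Reasoning
  open +-*-Solver
  m≤ : m ≤ cube m
  m≤ = m≤m*n m (m * m) ⦃ m*n≢0 m m ⦄
  m*m≤ : m * m ≤ cube m
  m*m≤ = m≤n*m (m * m) m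

module Family-member (n : ℕ) where

  q : ℕ
  q = cbrt n

  open Tradeoff q n (orderᴴ q) (radius q) (orderᴳ q) (q≤h q) (space≤r q) (r≤g q) public

theorem1p3 : ∃[ k ] Σ[ F ∈ Family CNF ] Σ[ sp ∈ Family ℕ ]
    (∀ n .⦃ _ : NonZero n ⦄ → Unsatisfiable (F n) × Is k -CNF (F n) × IsMinSpace (F n) (sp n))
    × ((λ n → size (F n)) =Θ (λ n → n))
    × ((λ n → sp n ^ 3) =Θ (λ n → n))
    × (∃[ d ] ∃[ N ] ∀ n .⦃ _ : NonZero n ⦄ → N ≤ n →
    ∀ (π : Refutation (F n)) → Sp π ≡ sp n →
    ∀ m → m ^ 3 ≤ n → 2 ^ m ≤ Len π ^ d)
    × (Σ[ π′ ∈ (∀ n .⦃ _ : NonZero n ⦄ → Refutation (F n)) ]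
    ((λ n → Sp (π′ n)) =O sp) × ((λ n → Len (π′ n)) =O (λ n → n)))
theorem1p3 =
  6 , (λ n → M.F n) , (λ n → M.sp n) ,
  (λ n → M.unsatisfiable n , M.6-CNF n , proj₂ (M.minimal n)) ,
  (size-upper , (1 , 0 , λ n _ → ≤-trans (M.size-lower-bound n) (≤-reflexive (sym (*-identityˡ _))))) ,
  (space-upper , space-lower) ,
  -- Any admissible `m` is at most `q`, and the exponent 3 comes from replacing the base 4/3 by 2.
  (3 , 0 , λ n _ π sp≡ m m³≤n → ≤-trans (^-monoʳ-≤ 2 (below-cbrt n m m³≤n))
    (exponential (Len π) (M.q n) (M.length-lower-bound n π sp≡))) ,
  (λ n → proj₁ (M.refutationᴳ n)) , short-space , short-length
  where
  module M = Family-member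

  cube-q≤n : ∀ n → cube (M.q n) ≤ n
  cube-q≤n n = ≤-trans (≤-reflexive (cube≡ (M.q n))) (cbrt-lower n)

  below-cbrt : ∀ n m → m ^ 3 ≤ n → m ≤ M.q n
  below-cbrt n m m³≤n = ≮⇒≥ λ q<m → <⇒≱ (cbrt-upper n) (≤-trans (^-monoˡ-≤ 3 q<m) m³≤n)

  q<7sp : ∀ n → M.q n < 7 * M.sp n
  q<7sp n = begin
    suc (M.q n)                  ≤⟨ M.space-lower-bound n π ⟩
    Sp π + 6                     ≡⟨ cong (_+ 6) sp≡ ⟩
    M.sp n + 6                   ≤⟨ +-monoʳ-≤ (M.sp n) (*-monoʳ-≤ 6 1≤sp) ⟩
    7 * M.sp n                   ∎
    where
    open ≤-Reasoning
    π : Refutation (M.F n)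
    π = proj₁ (proj₁ (proj₂ (M.minimal n)))
    sp≡ : Sp π ≡ M.sp n
    sp≡ = proj₂ (proj₁ (proj₂ (M.minimal n)))
    -- The last configuration contains a clause, so the minimal space is positive and absorbs the
    -- additive 6 into the factor 7.
    1≤sp : 1 ≤ M.sp n
    1≤sp = subst (1 ≤_) sp≡ (Derive.configs-target (M.F n) π (Derive.≤-Sp (M.F n) π))

  size-upper : (λ n → size (M.F n)) =O (λ n → n)
  size-upper = (5 * c + 1 + 5 * c′ * 8) * 6 , 0 , λ n _ → bound n
    where
    c c′ : ℕ
    c  = proj₁ (≼-* orderᴳ-linear (≼-* orderᴳ-linear orderᴳ-linear))
    c′ = proj₁ (≼-* orderᴴ-linear (≼-* orderᴴ-linear orderᴴ-linear))
    bound : ∀ n .⦃ _ : NonZero n ⦄ → size (M.F n) ≤ (5 * c + 1 + 5 * c′ * 8) * 6 * n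
    bound n = begin
      size (M.F n)                                                   ≤⟨ M.size-upper-bound n ⟩
      (length (M.φᴳ n) + length (M.φᴴ n) * 8) * 6
        ≤⟨ *-monoˡ-≤ 6 (+-mono-≤ (ordering-length-≤ (suc (orderᴳ q)) n) (*-monoˡ-≤ 8 (ordering-length-≤ (suc (orderᴴ q)) 0))) ⟩
      (5 * cube (suc (orderᴳ q)) + n + (5 * cube (suc (orderᴴ q)) + 0) * 8) * 6
        ≤⟨ *-monoˡ-≤ 6 (+-mono-≤ (+-monoˡ-≤ n (*-monoʳ-≤ 5 cG)) (*-monoˡ-≤ 8 (+-monoˡ-≤ 0 (*-monoʳ-≤ 5 cH)))) ⟩
      (5 * (c * n) + n + (5 * (c′ * n) + 0) * 8) * 6
        ≡⟨ solve 3 (λ a b n → (con 5 :* (a :* n) :+ n :+ (con 5 :* (b :* n) :+ con 0) :* con 8) :* con 6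
                   := (con 5 :* a :+ con 1 :+ con 5 :* b :* con 8) :* con 6 :* n) refl c c′ n ⟩
      (5 * c + 1 + 5 * c′ * 8) * 6 * n                               ∎
      where
      open ≤-Reasoning
      open +-*-Solver
      q : ℕ
      q = M.q n
      instance
        q≢0 : NonZero q
        q≢0 = cbrt-nonZero n
      cG : cube (suc (orderᴳ q)) ≤ c * n
      cG = ≤-trans (proj₂ (≼-* orderᴳ-linear (≼-* orderᴳ-linear orderᴳ-linear)) q) (*-monoʳ-≤ c (cube-q≤n n))
      cH : cube (suc (orderᴴ q)) ≤ c′ * n
      cH = ≤-trans (proj₂ (≼-* orderᴴ-linear (≼-* orderᴴ-linear orderᴴ-linear)) q) (*-monoʳ-≤ c′ (cube-q≤n n))

  space-upper : (λ n → M.sp n ^ 3) =O (λ n → n)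
  space-upper = c ^ 3 , 0 , λ n _ → ≤-trans (^-monoˡ-≤ 3 (≤-trans (M.sp-≤ n) (proj₂ space-linear (M.q n) ⦃ cbrt-nonZero n ⦄)))
    (≤-trans (≤-reflexive (^-distribʳ-* c (M.q n) 3)) (*-monoʳ-≤ (c ^ 3) (cbrt-lower n)))
    where
    c : ℕ
    c = proj₁ space-linear

  space-lower : (λ n → n) =O (λ n → M.sp n ^ 3)
  space-lower = 7 ^ 3 , 0 , λ n _ → ≤-trans (<⇒≤ (cbrt-upper n))
    (≤-trans (^-monoˡ-≤ 3 (q<7sp n)) (≤-reflexive (^-distribʳ-* 7 (M.sp n) 3)))

  short-space : (λ n → Sp (proj₁ (M.refutationᴳ n))) =O (λ n → M.sp n)
  short-space = c * 7 , 0 , λ n _ → ≤-trans (proj₁ (proj₂ (M.refutationᴳ n)))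
    (≤-trans (proj₂ bound (M.q n) ⦃ cbrt-nonZero n ⦄)
      (≤-trans (*-monoʳ-≤ c (<⇒≤ (q<7sp n))) (≤-reflexive (sym (*-assoc c 7 (M.sp n))))))
    where
    bound : (λ q → 4 + suc (orderᴳ q)) ≼ (λ q → q)
    bound = ≼-+ (≼-const 4) orderᴳ-linear
    c : ℕ
    c = proj₁ bound

  short-length : (λ n → Len (proj₁ (M.refutationᴳ n))) =O (λ n → n)
  short-length = proj₁ length-cubic , 0 , λ n _ → ≤-trans (proj₂ (proj₂ (M.refutationᴳ n)))
    (≤-trans (proj₂ length-cubic (M.q n) ⦃ cbrt-nonZero n ⦄) (*-monoʳ-≤ (proj₁ length-cubic) (cube-q≤n n)))
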